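{- Let $S$ be a source theory in $\mathcal L_S$ and $T$ a target theory in $\mathcal L_T$, and let a $T$-sound type-informative base interpretation of $S$ be given, with associated $\mathcal I$-interpretation $A\mapsto|A|^{\boldsymbol a}_{\boldsymbol b}$. If $\Gamma(\boldsymbol x^{\boldsymbol\sigma})\vdash_S A(\boldsymbol x^{\boldsymbol\sigma})$, where the free variables of $\Gamma$ and $A$ are among $\boldsymbol x$, then there are tuples of closed witnessing terms $\boldsymbol q,\boldsymbol s,\boldsymbol t$ such that $T$ proves: for all $\boldsymbol a,\boldsymbol c,\boldsymbol d$ and all $\boldsymbol x^{\boldsymbol\sigma}$, $$\text{if } \forall\boldsymbol e\in\boldsymbol q\boldsymbol a\boldsymbol c\boldsymbol d\ |\mathcal I_{\boldsymbol\sigma}(\boldsymbol x)|^{\boldsymbol c}_{\boldsymbol e}\ \text{ and }\ \forall\boldsymbol b\in\boldsymbol s\boldsymbol a\boldsymbol c\boldsymbol d\ |\Gamma(\boldsymbol x)|^{\boldsymbol a}_{\boldsymbol b},\ \text{ then }\ |A(\boldsymbol x)|^{\boldsymbol t\boldsymbol a\boldsymbol c}_{\boldsymbol d}.$$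
   Context: Source. The finite-type language $\mathcal L_S$ has ground types and the types generated from them by $\sigma\to\tau$; a constant $e_X$ for each ground type $X$; combinators $\Pi,\Sigma$; possibly other constants; a logical equality symbol $\equiv_\sigma$ for each type $\sigma$; possibly other relation symbols. Formulas are built from atomic formulas and $\bot$ with $\wedge,\to,\forall x^\sigma,\exists x^\sigma$ (there is no disjunction). $S$ is a theory in intuitionistic logic (sequent calculus with cut) with axioms $\forall x(x\equiv_\sigma x)$; $\forall x,y(A\wedge x\equiv_\sigma y\to A')$ ($A$ quantifier-free, $A'$ obtained from $A$ by replacing one or more $x$ by $y$); $\Pi xy\equiv x$; $\Sigma xyz\equiv xz(yz)$; and further non-logical axioms. $\vdash_S$ is derivability in $S$. Target. The types and terms of $\mathcal L_T$ include those of $\mathcal L_S$. $\mathcal L_T$ also has ground witnessing types (new, or coinciding with ground types of $\mathcal L_S$); the witnessing types are generated from these by $\rho\to\tau$ and $\rho^*$ (the type of non-empty finite subsets of $\rho$). Terms of witnessing type are called witnessing terms; they include a constant $e_W$ for each ground witnessing type $W$, combinators for all witnessing types, and constants for singleton $\{q\}$, binary union $\cup$ and indexed union $\bigcup_{w\in t}qw$. There are membership relations $\in$ between $\sigma$ and $\sigma^*$. $T$ (intuitionistic or classical) treats equality as usual mathematical equality, satisfies the combinator equations and proves the usual set-theoretic properties of $\{\cdot\},\cup,\bigcup,\in$. Tuples. Boldface letters are (possibly empty) tuples; $\forall\boldsymbol b\in\boldsymbol B$ means $\forall b_1\in B_1\cdots\forall b_n\in B_n$; application is componentwise. For a list $\Gamma=B_1,\dots,B_n$,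 the interpretation of $\Gamma$ is the conjunction of those of the $B_i$, each with its own tuples of witnesses and counter-witnesses; similarly $\mathcal I_{\boldsymbol\sigma}(\boldsymbol x)$ is the list $\mathcal I_{\sigma_1}(x_1),\mathcal I_{\sigma_2}(x_2),\dots$. Type-informative predicates. $\mathcal L_S^{\mathcal I}$ is $\mathcal L_S$ extended with a new unary predicate symbol $\mathcal I_\sigma(x^\sigma)$ for each finite type $\sigma$ of $\mathcal L_S$. Base interpretation of $\mathcal L_S^{\mathcal I}$. To each relation symbol $R(x_1,\dots,x_r)$ of $\mathcal L_S^{\mathcal I}$ are assigned two (possibly empty) tuples of witnessing types $\boldsymbol\tau_R^+,\boldsymbol\tau_R^-$ and a relation $\langle R(x_1,\dots,x_r)\rangle^{\boldsymbol c}_{\boldsymbol d}$ expressed in $\mathcal L_T$, with $\boldsymbol c$ of types $\boldsymbol\tau^+_R$ and $\boldsymbol d$ of types $\boldsymbol\tau_R^-$. For $\equiv_\sigma$ both tuples are empty and $\langle x\equiv_\sigma y\rangle$ is $x=y$. $\mathcal U$-interpretation. $\langle\bot\rangle:\equiv\bot$, and given $\langle A\rangle^{\boldsymbol a}_{\boldsymbol b}$, $\langle B\rangle^{\boldsymbol c}_{\boldsymbol d}$: $\langle A\wedge B\rangle^{\boldsymbol a,\boldsymbol c}_{\boldsymbol b,\boldsymbol d}:\equiv\langle A\rangle^{\boldsymbol a}_{\boldsymbol b}\wedge\langle B\rangle^{\boldsymbol c}_{\boldsymbol d}$; $\langle A\to B\rangle^{\boldsymbol f,\boldsymbol g}_{\boldsymbol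 a,\boldsymbol d}:\equiv\forall\boldsymbol b\in\boldsymbol g\boldsymbol a\boldsymbol d\,\langle A\rangle^{\boldsymbol a}_{\boldsymbol b}\to\langle B\rangle^{\boldsymbol f\boldsymbol a}_{\boldsymbol d}$; $\langle\forall x^\sigma A(x)\rangle^{\boldsymbol a}_{\boldsymbol b}:\equiv\forall x^\sigma\langle A(x)\rangle^{\boldsymbol a}_{\boldsymbol b}$; $\langle\exists x^\sigma A(x)\rangle^{\boldsymbol a}_{\boldsymbol B}:\equiv\exists x^\sigma\forall\boldsymbol b\in\boldsymbol B\,\langle A(x)\rangle^{\boldsymbol a}_{\boldsymbol b}$. A formula $A(\boldsymbol x)$ of $\mathcal L^{\mathcal I}_S$ is $\mathcal U$-interpretable in $T$ if there are closed witnessing terms $\boldsymbol t$ such that $T$ proves $\forall\boldsymbol b\,\langle A(\boldsymbol x)\rangle^{\boldsymbol t}_{\boldsymbol b}$. Relativization and $\mathcal I$-interpretation. For a formula $A$ of $\mathcal L_S$, $A^{\mathcal I}$ is obtained by replacing each $\forall x^\sigma(\dots)$ by $\forall x^\sigma(\mathcal I_\sigma(x)\to\dots)$ and each $\exists x^\sigma(\dots)$ by $\exists x^\sigma(\mathcal I_\sigma(x)\wedge\dots)$. Then $|A|^{\boldsymbol a}_{\boldsymbol b}:\equiv\langle A^{\mathcal I}\rangle^{\boldsymbol a}_{\boldsymbol b}$; also $|\mathcal I_\sigma(x)|^{\boldsymbol a}_{\boldsymbol b}$ denotes $\langle\mathcal I_\sigma(x)\rangle^{\boldsymbol a}_{\boldsymbol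 b}$. A formula $A(\boldsymbol x^{\boldsymbol\sigma})$ of $\mathcal L_S$ is $\mathcal I$-interpretable in $T$ if $\forall\boldsymbol x^{\boldsymbol\sigma}(\mathcal I_{\boldsymbol\sigma}(\boldsymbol x)\to A(\boldsymbol x)^{\mathcal I})$ is $\mathcal U$-interpretable in $T$. A base interpretation of $\mathcal L_S^{\mathcal I}$ is a $T$-sound type-informative base interpretation of $S$ if (i) each $\mathcal I_\sigma(c)$, $c^\sigma$ a constant of $\mathcal L_S$, is $\mathcal U$-interpretable in $T$; (ii) each $\forall x^\sigma\forall f^{\sigma\to\tau}(\mathcal I_\sigma(x)\wedge\mathcal I_{\sigma\to\tau}(f)\to\mathcal I_\tau(fx))$ is $\mathcal U$-interpretable in $T$; (iii) each non-logical axiom of $S$ is $\mathcal I$-interpretable in $T$. -}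

module Defs where

open import Data.Empty using (⊥)
open import Data.List using (List; []; _∷_; _++_; _ʳ++_; map; foldr)
open import Data.List.Membership.Propositional using (_∈_)
open import Data.List.Membership.Propositional.Properties using (∈-++⁺ˡ; ∈-++⁺ʳ)
open import Data.List.Relation.Binary.Subset.Propositional using (_⊆_)
open import Data.List.Relation.Unary.All as All using (All; []; _∷_)
open import Data.List.Relation.Unary.All.Properties using (++⁺; ++⁻ˡ; ++⁻ʳ; map⁺; map⁻)
open import Data.List.Relation.Unary.Any using (here; there)
open import Data.Product using (Σ-syntax)
open import Data.Unit using (⊤)
open import Function.Definitions using (Injective)
open import Relation.Binary.PropositionalEquality using (_≡_; refl)

record Signature : Set₁ where
  field
    Type     : Set
    arrow    : Type → Type → Type
    Constant : Type → Set

-- Disjunction is a primitive connective exactly when HasDisjunction is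
-- inhabited: ⊥ for the source languages, ⊤ for the target language.
record Language : Set₁ where
  field
    signature      : Signature
  open Signature signature public
  field
    Relation       : List Type → Set
    HasDisjunction : Set

open Signature using (Type; arrow; Constant)
open Language using (signature; Relation; HasDisjunction)

-- Well-typed de Bruijn syntax. The head of a context is the variable bound
-- last.
infixl 20 _·_

data Term (𝕊 : Signature) (Γ : List (Type 𝕊)) : Type 𝕊 → Set where
  var : ∀ {σ} → σ ∈ Γ → Term 𝕊 Γ σ
  con : ∀ {σ} → Constant 𝕊 σ → Term 𝕊 Γ σ
  _·_ : ∀ {σ τ} → Term 𝕊 Γ (arrow 𝕊 σ τ) → Term 𝕊 Γ σ → Term 𝕊 Γ τ

module _ {𝕊 : Signature} where

  rename : ∀ {Γ Δ} → Γ ⊆ Δ → ∀ {σ} → Term 𝕊 Γ σ → Term 𝕊 Δ σ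
  rename ρ (var x) = var (ρ x)
  rename ρ (con c) = con c
  rename ρ (s · t) = rename ρ s · rename ρ t

  weaken : ∀ {Γ τ σ} → Term 𝕊 Γ σ → Term 𝕊 (τ ∷ Γ) σ
  weaken = rename there

  fromClosed : ∀ {Γ σ} → Term 𝕊 [] σ → Term 𝕊 Γ σ
  fromClosed = rename λ ()

  Sub : List (Type 𝕊) → List (Type 𝕊) → Set
  Sub Γ Δ = All (Term 𝕊 Δ) Γ

  idSub : ∀ {Γ} → Sub Γ Γ
  idSub = All.tabulate var

  lift : ∀ {Γ Δ τ} → Sub Γ Δ → Sub (τ ∷ Γ) (τ ∷ Δ)
  lift θ = var (here refl) ∷ All.map weaken θ

  subst : ∀ {Γ Δ} → Sub Γ Δ → ∀ {σ} → Term 𝕊 Γ σ → Term 𝕊 Δ σ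
  subst θ (var x) = All.lookup θ x
  subst θ (con c) = con c
  subst θ (s · t) = subst θ s · subst θ t

infixr 15 _∧_
infixr 14 _∨_
infixr 13 _⊃_

data Formula (L : Language) (Γ : List (Language.Type L)) : Set where
  rel   : ∀ {ts} → Relation L ts → All (Term (signature L) Γ) ts → Formula L Γ
  falso : Formula L Γ
  _∧_   : Formula L Γ → Formula L Γ → Formula L Γ
  _∨_   : ⦃ HasDisjunction L ⦄ → Formula L Γ → Formula L Γ → Formula L Γ
  _⊃_   : Formula L Γ → Formula L Γ → Formula L Γ
  all   : ∀ σ → Formula L (σ ∷ Γ) → Formula L Γ
  ex    : ∀ σ → Formula L (σ ∷ Γ) → Formula L Γ

module _ {L : Language} where

  substF : ∀ {Γ Δ} → Sub {signature L} Γ Δ → Formula L Γ → Formula L Δ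
  substF θ (rel R ts) = rel R (All.map (subst θ) ts)
  substF θ falso      = falso
  substF θ (A ∧ B)    = substF θ A ∧ substF θ B
  substF θ (A ∨ B)    = substF θ A ∨ substF θ B
  substF θ (A ⊃ B)    = substF θ A ⊃ substF θ B
  substF θ (all σ A)  = all σ (substF (lift θ) A)
  substF θ (ex σ A)   = ex σ (substF (lift θ) A)

  weakenF : ∀ {Γ σ} → Formula L Γ → Formula L (σ ∷ Γ)
  weakenF = substF (All.map weaken idSub)

  infix 30 _[_]
  _[_] : ∀ {Γ σ} → Formula L (σ ∷ Γ) → Term (signature L) Γ σ → Formula L Γ
  A [ t ] = substF (t ∷ idSub) A

  infix 12 _⇔_
  _⇔_ : ∀ {Γ} → Formula L Γ → Formula L Γ → Formula L Γ
  A ⇔ B = (A ⊃ B) ∧ (B ⊃ A)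

  -- The empty conjunction is falso ⊃ falso.
  ⋀ : ∀ {Γ} → List (Formula L Γ) → Formula L Γ
  ⋀ = foldr _∧_ (falso ⊃ falso)

  closure : ∀ {Γ} → Formula L Γ → Formula L []
  closure {[]}    A = A
  closure {σ ∷ Γ} A = closure (all σ A)

  -- ∀x₁ … ∀xₙ A with x₁ outermost; in A the context is extended by x₁, …, xₙ
  -- in this order, so that xₙ is at its head.
  all* : ∀ ts {Γ} → Formula L (ts ʳ++ Γ) → Formula L Γ
  all* []       A = A
  all* (σ ∷ ts) A = all σ (all* ts A)

module _ {T : Set} where

  there* : ∀ (ts : List T) {Γ} → Γ ⊆ (ts ʳ++ Γ)
  there* []       x = x
  there* (_ ∷ ts) x = there* ts (there x)

vars* : ∀ {𝕊 : Signature} ts {Γ} → All (Term 𝕊 (ts ʳ++ Γ)) ts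
vars* []       = []
vars* (_ ∷ ts) = var (there* ts (here refl)) ∷ vars* ts

data Logic : Set where
  intuitionistic classical : Logic

record Theory (L : Language) : Set₁ where
  field
    Axiom : ∀ {Γ} → Formula L Γ → Set
    logic : Logic

-- Sequent calculus with cut. Every formula of a sequent lives in one context
-- Γ of free variables; an axiom may be used in any substitution instance.
-- The rule `fresh` lets a derivation use free variables not occurring in its
-- end sequent, as is automatic with named variables (types are nonempty).
data Derivation {L : Language} (𝕋 : Theory L) :
       ∀ {Γ} → List (Formula L Γ) → Formula L Γ → Set where

  hyp        : ∀ {Γ Φ} {A : Formula L Γ} → A ∈ Φ → Derivation 𝕋 Φ A
  axiom      : ∀ {Γ Δ Φ} {A : Formula L Γ} → Theory.Axiom 𝕋 A →
               (θ : Sub Γ Δ) → Derivation 𝕋 Φ (substF θ A)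
  structural : ∀ {Γ Φ Ψ} {A : Formula L Γ} → Φ ⊆ Ψ →
               Derivation 𝕋 Φ A → Derivation 𝕋 Ψ A
  cut        : ∀ {Γ Φ} {A C : Formula L Γ} → Derivation 𝕋 Φ A →
               Derivation 𝕋 (A ∷ Φ) C → Derivation 𝕋 Φ C
  fresh      : ∀ {Γ Φ} {A : Formula L Γ} σ →
               Derivation 𝕋 (map (weakenF {σ = σ}) Φ) (weakenF A) →
               Derivation 𝕋 Φ A

  falsoL     : ∀ {Γ Φ} {C : Formula L Γ} → Derivation 𝕋 (falso ∷ Φ) C

  ∧L         : ∀ {Γ Φ} {A B C : Formula L Γ} →
               Derivation 𝕋 (A ∷ B ∷ Φ) C → Derivation 𝕋 (A ∧ B ∷ Φ) C
  ∧R         : ∀ {Γ Φ} {A B : Formula L Γ} →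
               Derivation 𝕋 Φ A → Derivation 𝕋 Φ B → Derivation 𝕋 Φ (A ∧ B)

  ∨L         : ∀ ⦃ _ : HasDisjunction L ⦄ {Γ Φ} {A B C : Formula L Γ} →
               Derivation 𝕋 (A ∷ Φ) C → Derivation 𝕋 (B ∷ Φ) C →
               Derivation 𝕋 (A ∨ B ∷ Φ) C
  ∨R₁        : ∀ ⦃ _ : HasDisjunction L ⦄ {Γ Φ} {A B : Formula L Γ} →
               Derivation 𝕋 Φ A → Derivation 𝕋 Φ (A ∨ B)
  ∨R₂        : ∀ ⦃ _ : HasDisjunction L ⦄ {Γ Φ} {A B : Formula L Γ} →
               Derivation 𝕋 Φ B → Derivation 𝕋 Φ (A ∨ B)

  ⊃L         : ∀ {Γ Φ} {A B C : Formula L Γ} →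
               Derivation 𝕋 Φ A → Derivation 𝕋 (B ∷ Φ) C →
               Derivation 𝕋 (A ⊃ B ∷ Φ) C
  ⊃R         : ∀ {Γ Φ} {A B : Formula L Γ} →
               Derivation 𝕋 (A ∷ Φ) B → Derivation 𝕋 Φ (A ⊃ B)

  allL       : ∀ {Γ Φ σ} {A : Formula L (σ ∷ Γ)} {C : Formula L Γ} t →
               Derivation 𝕋 (A [ t ] ∷ Φ) C → Derivation 𝕋 (all σ A ∷ Φ) C
  allR       : ∀ {Γ Φ σ} {A : Formula L (σ ∷ Γ)} →
               Derivation 𝕋 (map weakenF Φ) A → Derivation 𝕋 Φ (all σ A)

  exL        : ∀ {Γ Φ σ} {A : Formula L (σ ∷ Γ)} {C : Formula L Γ} →
               Derivation 𝕋 (A ∷ map weakenF Φ) (weakenF C) →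
               Derivation 𝕋 (ex σ A ∷ Φ) C
  exR        : ∀ {Γ Φ σ} {A : Formula L (σ ∷ Γ)} t →
               Derivation 𝕋 Φ (A [ t ]) → Derivation 𝕋 Φ (ex σ A)

  reductio   : ∀ {Γ Φ} {A : Formula L Γ} → Theory.logic 𝕋 ≡ classical →
               Derivation 𝕋 (A ⊃ falso ∷ Φ) falso → Derivation 𝕋 Φ A

infix 4 _⊢[_]_
_⊢[_]_ : ∀ {L Γ} → List (Formula L Γ) → Theory L → Formula L Γ → Set
Φ ⊢[ 𝕋 ] A = Derivation 𝕋 Φ A

infixr 7 _⇒_

data FinType (G : Set) : Set where
  gr  : G → FinType G
  _⇒_ : FinType G → FinType G → FinType G

data SourceConstant (G : Set) (Other : FinType G → Set) : FinType G → Set where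
  e     : ∀ X → SourceConstant G Other (gr X)
  Π     : ∀ σ τ → SourceConstant G Other (σ ⇒ τ ⇒ σ)
  Σ     : ∀ ρ σ τ →
          SourceConstant G Other ((ρ ⇒ σ ⇒ τ) ⇒ (ρ ⇒ σ) ⇒ ρ ⇒ τ)
  other : ∀ {σ} → Other σ → SourceConstant G Other σ

data SourceRelation (G : Set) (Other : List (FinType G) → Set) :
       List (FinType G) → Set where
  equality : ∀ σ → SourceRelation G Other (σ ∷ σ ∷ [])
  other    : ∀ {ts} → Other ts → SourceRelation G Other ts

record SourceLanguage : Set₁ where
  field
    Ground        : Set
    OtherConstant : FinType Ground → Set
    OtherRelation : List (FinType Ground) → Set

  SType : Set
  SType = FinType Ground

  sourceSignature : Signature
  sourceSignature = record
    { Type     = SType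
    ; arrow    = _⇒_
    ; Constant = SourceConstant Ground OtherConstant
    }

  language : Language
  language = record
    { signature      = sourceSignature
    ; Relation       = SourceRelation Ground OtherRelation
    ; HasDisjunction = ⊥
    }

  STerm : List SType → SType → Set
  STerm = Term sourceSignature

open SourceLanguage using (SType; STerm; sourceSignature; language)

data WithTypeInfo {G : Set} (Other : List (FinType G) → Set) :
       List (FinType G) → Set where
  original : ∀ {ts} → Other ts → WithTypeInfo Other ts
  𝓘        : ∀ σ → WithTypeInfo Other (σ ∷ [])

infix 40 _ᴵ
_ᴵ : SourceLanguage → SourceLanguage
L ᴵ = record
  { Ground        = Ground
  ; OtherConstant = OtherConstant
  ; OtherRelation = WithTypeInfo OtherRelation
  }
  where open SourceLanguage L

SFormula : (L : SourceLanguage) → List (SType L) → Set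
SFormula L = Formula (language L)

module _ {L : SourceLanguage} where

  infix 16 _≡ˢ_
  _≡ˢ_ : ∀ {Γ σ} → STerm L Γ σ → STerm L Γ σ → SFormula L Γ
  s ≡ˢ t = rel (equality _) (s ∷ t ∷ [])

  data QuantifierFree {Γ : List (SType L)} : SFormula L Γ → Set where
    rel   : ∀ {ts} R ss → QuantifierFree (rel {ts = ts} R ss)
    falso : QuantifierFree falso
    _∧_   : ∀ {A B} → QuantifierFree A → QuantifierFree B → QuantifierFree (A ∧ B)
    _⊃_   : ∀ {A B} → QuantifierFree A → QuantifierFree B → QuantifierFree (A ⊃ B)

-- In `replacement`, B has variables z, y, x (z at the head), where z marks the
-- occurrences of x to be replaced by y: A is B[x/z] and A′ is B[y/z]. (If z
-- does not occur in B, the instance is derivable outright.)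
data SourceAxiom (L : SourceLanguage)
       (NonLogical : ∀ {Γ} → SFormula L Γ → Set) :
       ∀ {Γ} → SFormula L Γ → Set where
  reflexivity : ∀ σ →
    SourceAxiom L NonLogical {[]} (all σ (var (here refl) ≡ˢ var (here refl)))
  replacement : ∀ {Γ} σ {B : SFormula L (σ ∷ σ ∷ σ ∷ Γ)} → QuantifierFree B →
    let x = var (there (here refl))
        y = var (here refl)
    in SourceAxiom L NonLogical
         (all σ (all σ ((B [ x ] ∧ x ≡ˢ y) ⊃ B [ y ])))
  Π-equation  : ∀ σ τ →
    let x = var (here refl)
        y = var (there (here refl))
    in SourceAxiom L NonLogical {σ ∷ τ ∷ []} (con (Π σ τ) · x · y ≡ˢ x)
  Σ-equation  : ∀ ρ σ τ →
    let x = var (here refl)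
        y = var (there (here refl))
        z = var (there (there (here refl)))
    in SourceAxiom L NonLogical {(ρ ⇒ σ ⇒ τ) ∷ (ρ ⇒ σ) ∷ ρ ∷ []}
         (con (Σ ρ σ τ) · x · y · z ≡ˢ x · z · (y · z))
  nonLogical  : ∀ {Γ} {A : SFormula L Γ} → NonLogical A →
    SourceAxiom L NonLogical A

record SourceTheory (L : SourceLanguage) : Set₁ where
  field
    NonLogicalAxiom : ∀ {Γ} → SFormula L Γ → Set

  theory : Theory (language L)
  theory = record
    { Axiom = SourceAxiom L NonLogicalAxiom
    ; logic = intuitionistic
    }

infix 8 _✶

data StarType (G : Set) : Set where
  gr  : G → StarType G
  _⇒_ : StarType G → StarType G → StarType G
  _✶  : StarType G → StarType G

mapGround : ∀ {G H} → (G → H) → StarType G → StarType H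
mapGround f (gr X)  = gr (f X)
mapGround f (σ ⇒ τ) = mapGround f σ ⇒ mapGround f τ
mapGround f (σ ✶)   = mapGround f σ ✶

embed : ∀ {G H} → (G → H) → FinType G → StarType H
embed f (gr X)  = gr (f X)
embed f (σ ⇒ τ) = embed f σ ⇒ embed f τ

-- The images of srcGround and witGround may overlap (ground witnessing types
-- coinciding with ground source types) and need not exhaust Ground. Likewise
-- for the constants, of which only some are named by the fields.
record TargetLanguage (L : SourceLanguage) : Set₁ where
  private module L = SourceLanguage L
  field
    Ground              : Set
    WitGround           : Set
    srcGround           : L.Ground → Ground
    srcGround-injective : Injective _≡_ _≡_ srcGround
    witGround           : WitGround → Ground
    witGround-injective : Injective _≡_ _≡_ witGround

  TType : Set
  TType = StarType Ground

  WType : Set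
  WType = StarType WitGround

  src : SType L → TType
  src = embed srcGround

  wit : WType → TType
  wit = mapGround witGround

  field
    TConstant             : TType → Set
    srcConstant           : ∀ {σ} → Constant (sourceSignature L) σ → TConstant (src σ)
    srcConstant-injective : ∀ {σ} → Injective _≡_ _≡_ (srcConstant {σ})
    eʷ                    : ∀ W → TConstant (wit (gr W))
    Πʷ                    : ∀ ρ τ → TConstant (wit (ρ ⇒ τ ⇒ ρ))
    Σʷ                    : ∀ ρ σ τ →
                            TConstant (wit ((ρ ⇒ σ ⇒ τ) ⇒ (ρ ⇒ σ) ⇒ ρ ⇒ τ))
    singletonʷ            : ∀ ρ → TConstant (wit (ρ ⇒ ρ ✶))
    unionʷ                : ∀ ρ → TConstant (wit (ρ ✶ ⇒ ρ ✶ ⇒ ρ ✶))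
    indexedUnionʷ         : ∀ ρ τ → TConstant (wit ((ρ ⇒ τ ✶) ⇒ ρ ✶ ⇒ τ ✶))
    TRelation             : List TType → Set
    equalityᵗ             : ∀ τ → TRelation (τ ∷ τ ∷ [])
    membershipᵗ           : ∀ ρ → TRelation (wit ρ ∷ wit (ρ ✶) ∷ [])

  targetSignature : Signature
  targetSignature = record
    { Type     = TType
    ; arrow    = _⇒_
    ; Constant = TConstant
    }

  targetLanguage : Language
  targetLanguage = record
    { signature      = targetSignature
    ; Relation       = TRelation
    ; HasDisjunction = ⊤
    }

  TTerm : List TType → TType → Set
  TTerm = Term targetSignature

  TFormula : List TType → Set
  TFormula = Formula targetLanguage

  WTerm : List TType → WType → Set
  WTerm Δ ρ = TTerm Δ (wit ρ)

  Tuple : List TType → List WType → Set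
  Tuple Δ ρs = All (WTerm Δ) ρs

  infix 16 _≐_ _∈ᵗ_
  _≐_ : ∀ {Δ τ} → TTerm Δ τ → TTerm Δ τ → TFormula Δ
  s ≐ t = rel (equalityᵗ _) (s ∷ t ∷ [])

  _∈ᵗ_ : ∀ {Δ ρ} → WTerm Δ ρ → WTerm Δ (ρ ✶) → TFormula Δ
  _∈ᵗ_ {ρ = ρ} s t = rel (membershipᵗ ρ) (s ∷ t ∷ [])

  ⟨_⟩ᵘ : ∀ {Δ ρ} → WTerm Δ ρ → WTerm Δ (ρ ✶)
  ⟨ q ⟩ᵘ = con (singletonʷ _) · q

  infixr 17 _∪_
  _∪_ : ∀ {Δ ρ} → WTerm Δ (ρ ✶) → WTerm Δ (ρ ✶) → WTerm Δ (ρ ✶)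
  _∪_ {ρ = ρ} s t = con (unionʷ ρ) · s · t

  -- ⋃ q t is the union of q w over w ∈ t.
  ⋃ : ∀ {Δ ρ τ} → WTerm Δ (ρ ⇒ τ ✶) → WTerm Δ (ρ ✶) → WTerm Δ (τ ✶)
  ⋃ {ρ = ρ} {τ} q t = con (indexedUnionʷ ρ τ) · q · t

  witVars* : ∀ ρs {Δ} → Tuple (map wit ρs ʳ++ Δ) ρs
  witVars* ρs = map⁻ (vars* (map wit ρs))

  -- ∀b₁∈B₁ … ∀bₙ∈Bₙ A
  all∈ : ∀ {ρs Δ} → Tuple Δ (map _✶ ρs) → TFormula (map wit ρs ʳ++ Δ) → TFormula Δ
  all∈ {[]}     []       A = A
  all∈ {ρ ∷ ρs} (B ∷ Bs) A =
    all (wit ρ)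
      (_∈ᵗ_ {ρ = ρ} (var (here refl)) (weaken B) ⊃ all∈ (All.map weaken Bs) A)

  infixr 7 _⇛_
  _⇛_ : List WType → WType → WType
  σs ⇛ ρ = foldr _⇒_ ρ σs

  -- The type of a tuple of functions, one for each member of ρs, all taking
  -- the tuple σs of arguments.
  infixr 7 _⇛*_
  _⇛*_ : List WType → List WType → List WType
  σs ⇛* ρs = map (σs ⇛_) ρs

  apply : ∀ {Δ} {σs ρ} → WTerm Δ (σs ⇛ ρ) → Tuple Δ σs → WTerm Δ ρ
  apply f []       = f
  apply f (a ∷ as) = apply (f · a) as

  infixl 20 _··_
  _··_ : ∀ {Δ σs ρs} → Tuple Δ (σs ⇛* ρs) → Tuple Δ σs → Tuple Δ ρs
  fs ·· as = All.map (λ f → apply f as) (map⁻ fs)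

  Env : List (SType L) → List TType → Set
  Env Γ Δ = All (λ σ → TTerm Δ (src σ)) Γ

  idEnv : ∀ {Γ} → Env Γ (map src Γ)
  idEnv = map⁻ idSub

  -- The inclusion of source terms in target terms, with the source variables
  -- instantiated.
  ⌜_⌝ : ∀ {Γ Δ σ} → STerm L Γ σ → Env Γ Δ → TTerm Δ (src σ)
  ⌜ var x ⌝ η = All.lookup η x
  ⌜ con c ⌝ η = con (srcConstant c)
  ⌜ s · t ⌝ η = ⌜ s ⌝ η · ⌜ t ⌝ η

-- A classical theory is one with logic = classical; extensionality and
-- nonemptiness of the members of ρ ✶ are allowed but not required.
record TargetTheory {L : SourceLanguage} (TL : TargetLanguage L) : Set₁ where
  open TargetLanguage TL
  field
    theory : Theory targetLanguage

  infix 4 ⊢ᵗ_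
  ⊢ᵗ_ : ∀ {Δ} → TFormula Δ → Set
  ⊢ᵗ A = [] ⊢[ theory ] A

  field
    ≐-refl      : ∀ {Δ τ} (t : TTerm Δ τ) → ⊢ᵗ t ≐ t
    ≐-replace   : ∀ {Δ τ} (A : TFormula (τ ∷ Δ)) (s t : TTerm Δ τ) →
                  ⊢ᵗ (s ≐ t ⊃ A [ s ] ⊃ A [ t ])

    Π-eq        : ∀ {Δ} σ τ (x : TTerm Δ (src σ)) (y : TTerm Δ (src τ)) →
                  ⊢ᵗ con (srcConstant (Π σ τ)) · x · y ≐ x
    Σ-eq        : ∀ {Δ} ρ σ τ (x : TTerm Δ (src (ρ ⇒ σ ⇒ τ)))
                  (y : TTerm Δ (src (ρ ⇒ σ))) (z : TTerm Δ (src ρ)) →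
                  ⊢ᵗ con (srcConstant (Σ ρ σ τ)) · x · y · z ≐ x · z · (y · z)
    Πʷ-eq       : ∀ {Δ} ρ τ (x : WTerm Δ ρ) (y : WTerm Δ τ) →
                  ⊢ᵗ con (Πʷ ρ τ) · x · y ≐ x
    Σʷ-eq       : ∀ {Δ} ρ σ τ (x : WTerm Δ (ρ ⇒ σ ⇒ τ))
                  (y : WTerm Δ (ρ ⇒ σ)) (z : WTerm Δ ρ) →
                  ⊢ᵗ con (Σʷ ρ σ τ) · x · y · z ≐ x · z · (y · z)

    ∈-singleton : ∀ {Δ} ρ (x q : WTerm Δ ρ) →
                  ⊢ᵗ (_∈ᵗ_ {ρ = ρ} x (⟨_⟩ᵘ {ρ = ρ} q) ⇔ x ≐ q)
    ∈-union     : ∀ {Δ} ρ (x : WTerm Δ ρ) (s t : WTerm Δ (ρ ✶)) →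
                  ⊢ᵗ (_∈ᵗ_ {ρ = ρ} x (_∪_ {ρ = ρ} s t)
                       ⇔ _∈ᵗ_ {ρ = ρ} x s ∨ _∈ᵗ_ {ρ = ρ} x t)
    ∈-⋃         : ∀ {Δ} ρ τ (x : WTerm Δ τ) (q : WTerm Δ (ρ ⇒ τ ✶))
                  (t : WTerm Δ (ρ ✶)) →
                  ⊢ᵗ (_∈ᵗ_ {ρ = τ} x (⋃ {ρ = ρ} {τ} q t)
                       ⇔ ex (wit ρ) (_∈ᵗ_ {ρ = ρ} (var (here refl)) (weaken t)
                           ∧ _∈ᵗ_ {ρ = τ} (weaken x) (weaken q · var (here refl))))

-- Equality is absent here because its interpretation is fixed: both tuples are
-- empty and x ≡ y is interpreted as x = y.
record BaseInterpretation {L : SourceLanguage} (TL : TargetLanguage L) : Set₁ where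
  open TargetLanguage TL
  field
    pos neg : ∀ {ts} → SourceLanguage.OtherRelation (L ᴵ) ts → List WType
    base    : ∀ {ts} (R : SourceLanguage.OtherRelation (L ᴵ) ts) →
              TFormula (map src ts ++ map wit (pos R) ++ map wit (neg R))

  τ⁺ τ⁻ : ∀ {Γ} → SFormula (L ᴵ) Γ → List WType

  τ⁺ (rel (equality _) _) = []
  τ⁺ (rel (other R) _)    = pos R
  τ⁺ falso                = []
  τ⁺ (A ∧ B)              = τ⁺ A ++ τ⁺ B
  τ⁺ (_∨_ ⦃ () ⦄ _ _)
  τ⁺ (A ⊃ B)              =
    (τ⁺ A ⇛* τ⁺ B) ++ ((τ⁺ A ++ τ⁻ B) ⇛* map _✶ (τ⁻ A))
  τ⁺ (all _ A)            = τ⁺ A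
  τ⁺ (ex _ A)             = τ⁺ A

  τ⁻ (rel (equality _) _) = []
  τ⁻ (rel (other R) _)    = neg R
  τ⁻ falso                = []
  τ⁻ (A ∧ B)              = τ⁻ A ++ τ⁻ B
  τ⁻ (_∨_ ⦃ () ⦄ _ _)
  τ⁻ (A ⊃ B)              = τ⁺ A ++ τ⁻ B
  τ⁻ (all _ A)            = τ⁻ A
  τ⁻ (ex _ A)             = map _✶ (τ⁻ A)

  -- ⟨ A ⟩ η a b is the formula ⟨A⟩ with witnesses a and counter-witnesses b, in
  -- which the free variables of A are instantiated by η.
  ⟨_⟩ : ∀ {Γ Δ} (A : SFormula (L ᴵ) Γ) →
        Env Γ Δ → Tuple Δ (τ⁺ A) → Tuple Δ (τ⁻ A) → TFormula Δ
  ⟨ rel (equality _) (s ∷ t ∷ []) ⟩ η _ _ = ⌜ s ⌝ η ≐ ⌜ t ⌝ η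
  ⟨ rel (other R) ts ⟩ η c d =
    substF (++⁺ (map⁺ (All.map (λ t → ⌜ t ⌝ η) ts)) (++⁺ (map⁺ c) (map⁺ d))) (base R)
  ⟨ falso ⟩ η _ _ = falso
  ⟨ A ∧ B ⟩ η ac bd =
    ⟨ A ⟩ η (++⁻ˡ (τ⁺ A) ac) (++⁻ˡ (τ⁻ A) bd)
      ∧ ⟨ B ⟩ η (++⁻ʳ (τ⁺ A) ac) (++⁻ʳ (τ⁻ A) bd)
  ⟨ _∨_ ⦃ () ⦄ _ _ ⟩
  ⟨ A ⊃ B ⟩ η fg ad =
    all∈ (g ·· ad)
         (⟨ A ⟩ (All.map (rename w) η) (All.map (rename w) a) (witVars* (τ⁻ A)))
      ⊃ ⟨ B ⟩ η (f ·· a) d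
    where
    f = ++⁻ˡ (τ⁺ A ⇛* τ⁺ B) fg
    g = ++⁻ʳ (τ⁺ A ⇛* τ⁺ B) fg
    a = ++⁻ˡ (τ⁺ A) ad
    d = ++⁻ʳ (τ⁺ A) ad
    w = there* (map wit (τ⁻ A))
  ⟨ all σ A ⟩ η a b =
    all (src σ)
      (⟨ A ⟩ (var (here refl) ∷ All.map weaken η) (All.map weaken a) (All.map weaken b))
  ⟨ ex σ A ⟩ η a B =
    ex (src σ) (all∈ (All.map weaken B)
      (⟨ A ⟩ (var (w (here refl)) ∷ All.map (λ t → rename w (weaken t)) η)
             (All.map (λ t → rename w (weaken t)) a)
             (witVars* (τ⁻ A))))
    where
    w = there* (map wit (τ⁻ A))

module _ {L : SourceLanguage} where

  𝓘[_] : ∀ {Γ σ} → STerm L Γ σ → SFormula (L ᴵ) Γ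
  𝓘[ t ] = rel (other (𝓘 _)) (t ∷ [])

  𝓘* : ∀ {Γ ts} → All (STerm L Γ) ts → List (SFormula (L ᴵ) Γ)
  𝓘* []       = []
  𝓘* (t ∷ ts) = 𝓘[ t ] ∷ 𝓘* ts

  relativize : ∀ {Γ} → SFormula L Γ → SFormula (L ᴵ) Γ
  relativize (rel (equality σ) ts) = rel (equality σ) ts
  relativize (rel (other R) ts)    = rel (other (original R)) ts
  relativize falso                 = falso
  relativize (A ∧ B)               = relativize A ∧ relativize B
  relativize (_∨_ ⦃ () ⦄ _ _)
  relativize (A ⊃ B)               = relativize A ⊃ relativize B
  relativize (all σ A)             = all σ (𝓘[ var (here refl) ] ⊃ relativize A)
  relativize (ex σ A)              = ex σ (𝓘[ var (here refl) ] ∧ relativize A)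

module Interpretability {L : SourceLanguage} {TL : TargetLanguage L}
         (T : TargetTheory TL) (I : BaseInterpretation TL) where
  open TargetLanguage TL
  open TargetTheory T
  open BaseInterpretation I

  UInterpretable : ∀ {Γ} → SFormula (L ᴵ) Γ → Set
  UInterpretable {Γ} A =
    Σ[ t ∈ Tuple [] (τ⁺ A) ]
      ⊢ᵗ all* (map wit (τ⁻ A)) {map src Γ}
           (⟨ A ⟩ (All.map (rename (there* (map wit (τ⁻ A)))) idEnv)
                  (All.map fromClosed t)
                  (witVars* (τ⁻ A)))

  IInterpretable : ∀ {Γ} → SFormula L Γ → Set
  IInterpretable A = UInterpretable (closure (⋀ (𝓘* {L} idSub) ⊃ relativize A))

  record Sound (S : SourceTheory L) : Set where
    field
      constants   : ∀ {σ} (c : Constant (sourceSignature L) σ) →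
                    UInterpretable {[]} (𝓘[_] {L} (con c))
      application : ∀ σ τ → UInterpretable {[]}
                    (let f = var (here refl)
                         x = var (there (here refl))
                     in all σ (all (σ ⇒ τ)
                          (𝓘[_] {L} x ∧ 𝓘[_] {L} f ⊃ 𝓘[_] {L} (f · x))))
      axioms      : ∀ {Γ} {A : SFormula L Γ} → SourceTheory.NonLogicalAxiom S A →
                    IInterpretable A

  module _ {Γ : List (SType L)} (Φ : List (SFormula L Γ)) (A : SFormula L Γ) where

    -- The formulas |Φ|, |𝓘(x)| and |A| to be interpreted; the lists Φ and 𝓘(x)
    -- are read as the conjunctions of their members.
    Φᴵ 𝓘x Aᴵ : SFormula (L ᴵ) Γ
    Φᴵ = ⋀ (map relativize Φ)
    𝓘x = ⋀ (𝓘* {L} idSub)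
    Aᴵ = relativize A

    -- The types of a, c and d.
    α γ δ : List WType
    α = τ⁺ Φᴵ
    γ = τ⁺ 𝓘x
    δ = τ⁻ Aᴵ

    -- ∀a c d x ((∀e∈qacd ⟨𝓘x⟩^c_e) ∧ (∀b∈sacd ⟨Φᴵ⟩^a_b) → ⟨Aᴵ⟩^(tac)_d)
    soundnessFormula : Tuple [] ((α ++ γ ++ δ) ⇛* map _✶ (τ⁻ 𝓘x)) →
                       Tuple [] ((α ++ γ ++ δ) ⇛* map _✶ (τ⁻ Φᴵ)) →
                       Tuple [] ((α ++ γ) ⇛* τ⁺ Aᴵ) →
                       TFormula []
    soundnessFormula q s t = closure
      (all∈ (All.map fromClosed q ·· acd)
            (⟨ 𝓘x ⟩ (All.map (rename (under 𝓘x)) x) (All.map (rename (under 𝓘x)) c)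
                    (witVars* (τ⁻ 𝓘x)))
       ∧ all∈ (All.map fromClosed s ·· acd)
              (⟨ Φᴵ ⟩ (All.map (rename (under Φᴵ)) x) (All.map (rename (under Φᴵ)) a)
                      (witVars* (τ⁻ Φᴵ)))
       ⊃ ⟨ Aᴵ ⟩ x (All.map fromClosed t ·· ++⁺ a c) d)
      where
      Δ : List TType
      Δ = map src Γ ++ (map wit (α ++ γ ++ δ) ʳ++ [])

      acd : Tuple Δ (α ++ γ ++ δ)
      acd = All.map (rename (∈-++⁺ʳ (map src Γ))) (witVars* (α ++ γ ++ δ))

      a : Tuple Δ α
      a = ++⁻ˡ α acd

      c : Tuple Δ γ
      c = ++⁻ˡ γ (++⁻ʳ α acd)

      d : Tuple Δ δ
      d = ++⁻ʳ γ (++⁻ʳ α acd)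

      x : Env Γ Δ
      x = All.map (rename ∈-++⁺ˡ) idEnv

      under : ∀ (B : SFormula (L ᴵ) Γ) → Δ ⊆ (map wit (τ⁻ B) ʳ++ Δ)
      under B = there* (map wit (τ⁻ B))

{-# OPTIONS --safe #-}
-- Write X ⟶ Y when there are witness terms t and bounding terms s such that T
-- proves ∀b∈s(a,d) ⟨X⟩ᵃ_b → ⟨Y⟩^t(a)_d, uniformly in the source variables. These
-- morphisms have the operations of a cartesian closed category: composition
-- bounds by an indexed union over the bounds of the middle formula, pairing by a
-- union, and currying is λ-abstraction in combinatory logic. The uniform quantifiers leave the
-- witnesses alone and ∃ only replaces a counter-witness by a finite set of them,
-- so every intuitionistic rule is a morphism. A relativized quantifier needs
-- moreover a morphism from 𝓘(x) to 𝓘(u) for each source term u, obtained from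
-- those for constants and application. Induction on the derivation then gives
-- Φᴵ ∧ 𝓘(x) ⟶ Aᴵ, whose terms closed by λ-abstraction are the required tuples.
--
-- T need not prove that a member of ρ ✶ is nonempty, so a bound such as g a d
-- with g a variable is enlarged by a singleton.
module Submission where

open import Defs
open import Data.List using (List; []; _∷_; _++_; _ʳ++_; map)
open import Data.List.Membership.Propositional using (_∈_)
open import Data.List.Membership.Propositional.Properties using (∈-++⁺ˡ; ∈-++⁺ʳ; ∈-map⁺)
import Data.List.Properties as List
open import Data.List.Relation.Binary.Subset.Propositional using (_⊆_)
import Data.List.Relation.Binary.Subset.Propositional.Properties as ⊆
open import Data.List.Relation.Unary.All as All using (All; []; _∷_)
open import Data.List.Relation.Unary.All.Properties
  using (++⁺; ++⁻ˡ; ++⁻ʳ; map⁺; map⁻; map-id; map-cong; map-∘; lookup-map)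
open import Data.List.Relation.Unary.Any using (here; there)
open import Data.Product using (Σ-syntax; _,_)
open import Data.Unit using (tt)
open import Relation.Binary.PropositionalEquality as ≡
  using (_≡_; refl; sym; trans; cong; cong₂; module ≡-Reasoning)

open Language using (signature)
open SourceLanguage using (SType; STerm; sourceSignature)

-- Two features of the encoding shape the proof. The lists of witnessing types of a formula are
-- computed by recursion, so those of a substitution instance agree with the original ones only up
-- to propositional equality; and every bounded quantifier moves the surrounding data under a block
-- of de Bruijn binders. Both are handled by working with `Int`: a family of target formulas,
-- natural in the target context, with fixed lists of types. Weakening and instantiation of source
-- variables leave these lists alone, and formulas are compared with their substitution instances
-- once and for all, through `_≅_`. Facts to be used under binders are stated for all extensions of
-- the context and of the hypotheses, as in Kripke semantics.
--
-- A morphism is a realizer of an implication with variables in place of λ-abstractions: t may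
-- depend on a alone and s on a and d, exactly as f and g do in the clause for implication. This is
-- why the tuple t of the theorem is applied to a and c only, while q and s also receive d.

-- Tuples: extensionality, blocks of binders, concatenation

module _ {A : Set} where

  lookup-ext : ∀ {P : A → Set} {xs} {ps qs : All P xs} →
               (∀ {x} (i : x ∈ xs) → All.lookup ps i ≡ All.lookup qs i) → ps ≡ qs
  lookup-ext {ps = []}     {[]}     h = refl
  lookup-ext {ps = p ∷ ps} {q ∷ qs} h =
    cong₂ _∷_ (h (here refl)) (lookup-ext (λ i → h (there i)))

  lookup-tabulate : ∀ {P : A → Set} {xs} (f : ∀ {x} → x ∈ xs → P x) {x} (i : x ∈ xs) →
                    All.lookup (All.tabulate f) i ≡ f i
  lookup-tabulate f (here refl) = refl
  lookup-tabulate f (there i)   = lookup-tabulate (λ j → f (there j)) i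

  map-tabulate : ∀ {P Q : A → Set} {xs} (g : ∀ {x} → P x → Q x) (f : ∀ {x} → x ∈ xs → P x) →
                 All.map g (All.tabulate f) ≡ All.tabulate (λ i → g (f i))
  map-tabulate {xs = []}    g f = refl
  map-tabulate {xs = _ ∷ _} g f = cong (_ ∷_) (map-tabulate g (λ i → f (there i)))

  -- The variables of a block enter the context one by one, the last of them at the head, so their
  -- values are pushed in the same order.
  revAll : ∀ {P : A → Set} {xs ys} → All P xs → All P ys → All P (xs ʳ++ ys)
  revAll []       qs = qs
  revAll (p ∷ ps) qs = revAll ps (p ∷ qs)

  lookup-revAll : ∀ {P : A → Set} {xs ys} (ps : All P xs) (qs : All P ys) {x} (i : x ∈ ys) →
                  All.lookup (revAll ps qs) (there* xs i) ≡ All.lookup qs i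
  lookup-revAll []       qs i = refl
  lookup-revAll (p ∷ ps) qs i = lookup-revAll ps (p ∷ qs) (there i)

  map-revAll : ∀ {P Q : A → Set} (g : ∀ {x} → P x → Q x) {xs ys} (ps : All P xs) (qs : All P ys) →
               All.map g (revAll ps qs) ≡ revAll (All.map g ps) (All.map g qs)
  map-revAll g []       qs = refl
  map-revAll g (p ∷ ps) qs = map-revAll g ps (p ∷ qs)

  map-++⁺ : ∀ {P Q : A → Set} (g : ∀ {x} → P x → Q x) {xs ys} (ps : All P xs) (qs : All P ys) →
            All.map g (++⁺ ps qs) ≡ ++⁺ (All.map g ps) (All.map g qs)
  map-++⁺ g []       qs = refl
  map-++⁺ g (p ∷ ps) qs = cong (_ ∷_) (map-++⁺ g ps qs)

  map-++⁻ˡ : ∀ {P Q : A → Set} (g : ∀ {x} → P x → Q x) xs {ys} (ps : All P (xs ++ ys)) →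
             All.map g (++⁻ˡ xs ps) ≡ ++⁻ˡ xs (All.map g ps)
  map-++⁻ˡ g []       ps       = refl
  map-++⁻ˡ g (x ∷ xs) (p ∷ ps) = cong (_ ∷_) (map-++⁻ˡ g xs ps)

  map-++⁻ʳ : ∀ {P Q : A → Set} (g : ∀ {x} → P x → Q x) xs {ys} (ps : All P (xs ++ ys)) →
             All.map g (++⁻ʳ xs ps) ≡ ++⁻ʳ xs (All.map g ps)
  map-++⁻ʳ g []       ps       = refl
  map-++⁻ʳ g (x ∷ xs) (p ∷ ps) = map-++⁻ʳ g xs ps

  ++⁻ˡ-++⁺ : ∀ {P : A → Set} {xs ys} (ps : All P xs) (qs : All P ys) → ++⁻ˡ xs (++⁺ ps qs) ≡ ps
  ++⁻ˡ-++⁺ []       qs = refl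
  ++⁻ˡ-++⁺ (p ∷ ps) qs = cong (p ∷_) (++⁻ˡ-++⁺ ps qs)

  ++⁻ʳ-++⁺ : ∀ {P : A → Set} {xs ys} (ps : All P xs) (qs : All P ys) → ++⁻ʳ xs (++⁺ ps qs) ≡ qs
  ++⁻ʳ-++⁺ []       qs = refl
  ++⁻ʳ-++⁺ (p ∷ ps) qs = ++⁻ʳ-++⁺ ps qs

module _ {A B : Set} {f : A → B} where

  map-map⁺ : ∀ {P Q : B → Set} (g : ∀ {x} → P x → Q x) {xs} (ps : All (λ x → P (f x)) xs) →
             All.map g (map⁺ {P = P} {f = f} ps) ≡ map⁺ {P = Q} (All.map g ps)
  map-map⁺ g []       = refl
  map-map⁺ {P} {Q} g (p ∷ ps) = cong (_ ∷_) (map-map⁺ {P} {Q} g ps)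

  map-map⁻ : ∀ {P Q : B → Set} (g : ∀ {x} → P x → Q x) {xs} (ps : All P (map f xs)) →
             All.map g (map⁻ {P = P} {f = f} ps) ≡ map⁻ {P = Q} (All.map g ps)
  map-map⁻ g {[]}     []       = refl
  map-map⁻ {P} {Q} g {x ∷ xs} (p ∷ ps) = cong (_ ∷_) (map-map⁻ {P} {Q} g ps)

  map⁻-map⁺ : ∀ {P : B → Set} {xs} (ps : All (λ x → P (f x)) xs) → map⁻ {P = P} (map⁺ {f = f} ps) ≡ ps
  map⁻-map⁺ []       = refl
  map⁻-map⁺ (p ∷ ps) = cong (p ∷_) (map⁻-map⁺ ps)

  map⁺-map⁻ : ∀ {P : B → Set} {xs} (ps : All P (map f xs)) → map⁺ (map⁻ {f = f} ps) ≡ ps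
  map⁺-map⁻ {xs = []}     []       = refl
  map⁺-map⁻ {xs = x ∷ xs} (p ∷ ps) = cong (p ∷_) (map⁺-map⁻ ps)

-- Substitution in terms

module _ {𝕊 : Signature} where

  subst-rename : ∀ {Γ Δ Ω} {ρ : Γ ⊆ Δ} (θ : Sub {𝕊} Δ Ω) (θ′ : Sub Γ Ω) →
                 (∀ {τ} (i : τ ∈ Γ) → All.lookup θ (ρ i) ≡ All.lookup θ′ i) →
                 ∀ {σ} (t : Term 𝕊 Γ σ) → subst θ (rename ρ t) ≡ subst θ′ t
  subst-rename θ θ′ h (var x) = h x
  subst-rename θ θ′ h (con c) = refl
  subst-rename θ θ′ h (s · t) = cong₂ _·_ (subst-rename θ θ′ h s) (subst-rename θ θ′ h t)

  subst-weaken : ∀ {Γ Δ τ} (u : Term 𝕊 Δ τ) (θ : Sub Γ Δ) {σ} (t : Term 𝕊 Γ σ) →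
                 subst (u ∷ θ) (weaken t) ≡ subst θ t
  subst-weaken u θ = subst-rename (u ∷ θ) θ (λ i → refl)

  rename-rename : ∀ {Γ Δ Ω} (ρ : Δ ⊆ Ω) (ρ′ : Γ ⊆ Δ) {σ} (t : Term 𝕊 Γ σ) →
                  rename ρ (rename ρ′ t) ≡ rename (λ i → ρ (ρ′ i)) t
  rename-rename ρ ρ′ (var x) = refl
  rename-rename ρ ρ′ (con c) = refl
  rename-rename ρ ρ′ (s · t) = cong₂ _·_ (rename-rename ρ ρ′ s) (rename-rename ρ ρ′ t)

  rename-subst : ∀ {Γ Δ Ω} (ρ : Δ ⊆ Ω) (θ : Sub {𝕊} Γ Δ) {σ} (t : Term 𝕊 Γ σ) →
                 rename ρ (subst θ t) ≡ subst (All.map (rename ρ) θ) t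
  rename-subst ρ θ (var x) = sym (lookup-map θ x)
  rename-subst ρ θ (con c) = refl
  rename-subst ρ θ (s · t) = cong₂ _·_ (rename-subst ρ θ s) (rename-subst ρ θ t)

  subst-subst : ∀ {Γ Δ Ω} (θ′ : Sub {𝕊} Δ Ω) (θ : Sub Γ Δ) {σ} (t : Term 𝕊 Γ σ) →
                subst θ′ (subst θ t) ≡ subst (All.map (subst θ′) θ) t
  subst-subst θ′ θ (var x) = sym (lookup-map θ x)
  subst-subst θ′ θ (con c) = refl
  subst-subst θ′ θ (s · t) = cong₂ _·_ (subst-subst θ′ θ s) (subst-subst θ′ θ t)

  subst-idSub : ∀ {Γ σ} (t : Term 𝕊 Γ σ) → subst idSub t ≡ t
  subst-idSub (var x) = lookup-tabulate var x
  subst-idSub (con c) = refl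
  subst-idSub (s · t) = cong₂ _·_ (subst-idSub s) (subst-idSub t)

  subst-fromClosed : ∀ {Γ Δ} (θ : Sub {𝕊} Γ Δ) {σ} (t : Term 𝕊 [] σ) →
                     subst θ (fromClosed t) ≡ fromClosed t
  subst-fromClosed θ (con c) = refl
  subst-fromClosed θ (s · t) = cong₂ _·_ (subst-fromClosed θ s) (subst-fromClosed θ t)

  wkSub : ∀ {Γ τ} → Sub {𝕊} Γ (τ ∷ Γ)
  wkSub = All.map weaken idSub

  map-subst-idSub : ∀ {Γ Δ} (θ : Sub {𝕊} Γ Δ) → All.map (subst θ) idSub ≡ θ
  map-subst-idSub θ = lookup-ext λ i →
    trans (lookup-map idSub i) (cong (subst θ) (lookup-tabulate var i))

  map-idSub : ∀ {Γ Δ} (θ : Sub {𝕊} Γ Δ) → All.map (subst idSub) θ ≡ θ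
  map-idSub θ = trans (map-cong θ subst-idSub) (map-id θ)

  map-subst-weaken : ∀ {Γ Δ Ω τ} (u : Term 𝕊 Ω τ) (θ : Sub Γ Ω) (σ : Sub Δ Γ) →
                     All.map (subst (u ∷ θ)) (All.map weaken σ) ≡ All.map (subst θ) σ
  map-subst-weaken u θ σ = trans (map-∘ σ) (map-cong σ (subst-weaken u θ))

  wkSub-instantiate : ∀ {Γ Δ τ} (u : Term 𝕊 Δ τ) (θ : Sub Γ Δ) →
                      All.map (subst (u ∷ θ)) wkSub ≡ θ
  wkSub-instantiate u θ = trans (map-subst-weaken u θ idSub) (map-subst-idSub θ)

  subst-wkSub : ∀ {Γ τ σ} (t : Term 𝕊 Γ σ) → subst (wkSub {τ = τ}) t ≡ weaken t
  subst-wkSub t = trans (sym (rename-subst there idSub t)) (cong weaken (subst-idSub t))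

  idSub-instantiate : ∀ {Γ Δ τ} (u : Term 𝕊 Δ τ) (θ : Sub Γ Δ) →
                      All.map (subst (u ∷ idSub)) (lift θ) ≡ u ∷ θ
  idSub-instantiate u θ = cong (u ∷_) (trans (map-subst-weaken u idSub θ) (map-idSub θ))

  subst-lift-weaken : ∀ {Γ Δ τ} (θ : Sub Γ Δ) {σ} (t : Term 𝕊 Γ σ) →
                      subst (lift {τ = τ} θ) (weaken t) ≡ weaken (subst θ t)
  subst-lift-weaken θ t =
    trans (subst-weaken _ _ t) (sym (rename-subst there θ t))

  map-lift : ∀ {Γ Δ Ω τ} (θ′ : Sub {𝕊} Δ Ω) (θ : Sub Γ Δ) →
             All.map (subst (lift {τ = τ} θ′)) (lift θ) ≡ lift (All.map (subst θ′) θ)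
  map-lift θ′ θ = cong (_ ∷_)
    (trans (map-∘ θ) (trans (map-cong θ (subst-lift-weaken θ′)) (sym (map-∘ θ))))

  lift-idSub : ∀ {Γ τ} → lift {𝕊} {Γ} {τ = τ} idSub ≡ idSub
  lift-idSub = cong (_ ∷_) (map-tabulate weaken var)

  lift* : ∀ ts {Γ Δ} → Sub {𝕊} Γ Δ → Sub {𝕊} (ts ʳ++ Γ) (ts ʳ++ Δ)
  lift* []       θ = θ
  lift* (τ ∷ ts) θ = lift* ts (lift θ)

  rename-there* : ∀ τ ts {Γ σ} (t : Term 𝕊 Γ σ) →
                  rename (there* (τ ∷ ts)) t ≡ rename (there* ts) (weaken {τ = τ} t)
  rename-there* τ ts t = sym (rename-rename (there* ts) there t)

  subst-lift*-there* : ∀ ts {Γ Δ} (θ : Sub Γ Δ) {σ} (t : Term 𝕊 Γ σ) →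
                       subst (lift* ts θ) (rename (there* ts) t) ≡ rename (there* ts) (subst θ t)
  subst-lift*-there* []       θ t = trans (cong (subst θ) (rename-id t)) (sym (rename-id (subst θ t)))
    where
    rename-id : ∀ {Γ σ} (t : Term 𝕊 Γ σ) → rename (λ i → i) t ≡ t
    rename-id (var x) = refl
    rename-id (con c) = refl
    rename-id (s · t) = cong₂ _·_ (rename-id s) (rename-id t)
  subst-lift*-there* (τ ∷ ts) θ t = begin
    subst (lift* ts (lift θ)) (rename (there* (τ ∷ ts)) t)
      ≡⟨ cong (subst (lift* ts (lift θ))) (rename-there* τ ts t) ⟩
    subst (lift* ts (lift θ)) (rename (there* ts) (weaken t))
      ≡⟨ subst-lift*-there* ts (lift θ) (weaken t) ⟩
    rename (there* ts) (subst (lift θ) (weaken t))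
      ≡⟨ cong (rename (there* ts)) (subst-lift-weaken θ t) ⟩
    rename (there* ts) (weaken (subst θ t))
      ≡⟨ rename-there* τ ts (subst θ t) ⟨
    rename (there* (τ ∷ ts)) (subst θ t) ∎
    where open ≡-Reasoning

  subst-revAll-there* : ∀ {ts Γ Δ} (us : All (Term 𝕊 Δ) ts) (θ : Sub Γ Δ) {σ} (t : Term 𝕊 Γ σ) →
                        subst (revAll us θ) (rename (there* ts) t) ≡ subst θ t
  subst-revAll-there* us θ = subst-rename (revAll us θ) θ (lookup-revAll us θ)

  map-lift*-vars* : ∀ ts {Γ Δ} (θ : Sub {𝕊} Γ Δ) →
                    All.map (subst (lift* ts θ)) (vars* ts) ≡ vars* ts
  map-lift*-vars* []       θ = refl
  map-lift*-vars* (τ ∷ ts) θ =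
    cong₂ _∷_ (subst-lift*-there* ts (lift θ) (var (here refl))) (map-lift*-vars* ts (lift θ))

  map-revAll-vars* : ∀ {ts Γ Δ} (us : All (Term 𝕊 Δ) ts) (θ : Sub {𝕊} Γ Δ) →
                     All.map (subst (revAll us θ)) (vars* ts) ≡ us
  map-revAll-vars* []       θ = refl
  map-revAll-vars* (u ∷ us) θ =
    cong₂ _∷_ (lookup-revAll us (u ∷ θ) (here refl)) (map-revAll-vars* us (u ∷ θ))

-- Substitution in formulas

module _ {L : Language} where

  private 𝕊 = signature L

  substF-substF : ∀ {Γ Δ Ω} (θ′ : Sub {𝕊} Δ Ω) (θ : Sub Γ Δ) (A : Formula L Γ) →
                  substF θ′ (substF θ A) ≡ substF (All.map (subst θ′) θ) A
  substF-substF θ′ θ (rel R ts) =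
    cong (rel R) (trans (map-∘ ts) (map-cong ts (subst-subst θ′ θ)))
  substF-substF θ′ θ falso     = refl
  substF-substF θ′ θ (A ∧ B)   = cong₂ _∧_ (substF-substF θ′ θ A) (substF-substF θ′ θ B)
  substF-substF θ′ θ (A ∨ B)   = cong₂ _∨_ (substF-substF θ′ θ A) (substF-substF θ′ θ B)
  substF-substF θ′ θ (A ⊃ B)   = cong₂ _⊃_ (substF-substF θ′ θ A) (substF-substF θ′ θ B)
  substF-substF θ′ θ (all σ A) = cong (all σ)
    (trans (substF-substF (lift θ′) (lift θ) A) (cong (λ ϑ → substF ϑ A) (map-lift θ′ θ)))
  substF-substF θ′ θ (ex σ A)  = cong (ex σ)
    (trans (substF-substF (lift θ′) (lift θ) A) (cong (λ ϑ → substF ϑ A) (map-lift θ′ θ)))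

  substF-idSub : ∀ {Γ} (A : Formula L Γ) → substF idSub A ≡ A
  substF-idSub (rel R ts) = cong (rel R) (map-idSub ts)
  substF-idSub falso      = refl
  substF-idSub (A ∧ B)    = cong₂ _∧_ (substF-idSub A) (substF-idSub B)
  substF-idSub (A ∨ B)    = cong₂ _∨_ (substF-idSub A) (substF-idSub B)
  substF-idSub (A ⊃ B)    = cong₂ _⊃_ (substF-idSub A) (substF-idSub B)
  substF-idSub (all σ A)  = cong (all σ)
    (trans (cong (λ ϑ → substF ϑ A) lift-idSub) (substF-idSub A))
  substF-idSub (ex σ A)   = cong (ex σ)
    (trans (cong (λ ϑ → substF ϑ A) lift-idSub) (substF-idSub A))

  substF-instantiate : ∀ {Γ Δ σ} (θ : Sub Γ Δ) (A : Formula L (σ ∷ Γ)) (t : Term 𝕊 Δ σ) →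
                       substF (lift θ) A [ t ] ≡ substF (t ∷ θ) A
  substF-instantiate θ A t =
    trans (substF-substF _ _ A) (cong (λ ϑ → substF ϑ A) (idSub-instantiate t θ))

  substF-[] : ∀ {Γ Δ σ} (θ : Sub Γ Δ) (A : Formula L (σ ∷ Γ)) t →
              substF θ (A [ t ]) ≡ substF (lift θ) A [ subst θ t ]
  substF-[] θ A t = trans (substF-substF θ (t ∷ idSub) A)
    (trans (cong (λ ϑ → substF (subst θ t ∷ ϑ) A) (map-subst-idSub θ))
           (sym (substF-instantiate θ A (subst θ t))))

  substF-weakenF : ∀ {Γ Δ τ} (u : Term 𝕊 Δ τ) (θ : Sub Γ Δ) (A : Formula L Γ) →
                   substF (u ∷ θ) (weakenF A) ≡ substF θ A
  substF-weakenF u θ A =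
    trans (substF-substF _ _ A) (cong (λ ϑ → substF ϑ A) (wkSub-instantiate u θ))

  weakenF-substF : ∀ {Γ Δ τ} (θ : Sub Γ Δ) (A : Formula L Γ) →
                   weakenF {σ = τ} (substF θ A) ≡ substF (All.map weaken θ) A
  weakenF-substF θ A = trans (substF-substF _ θ A)
    (cong (λ ϑ → substF ϑ A) (map-cong θ subst-wkSub))

  substF-lift-weakenF : ∀ {Γ Δ σ} (θ : Sub Γ Δ) (A : Formula L Γ) →
                        substF (lift θ) (weakenF {σ = σ} A) ≡ weakenF (substF θ A)
  substF-lift-weakenF θ A =
    trans (substF-weakenF _ _ A) (sym (weakenF-substF θ A))

  map-substF-weakenF : ∀ {Γ Δ σ} (θ : Sub Γ Δ) (Φ : List (Formula L Γ)) →
                       map (substF (lift θ)) (map (weakenF {σ = σ}) Φ) ≡ map weakenF (map (substF θ) Φ)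
  map-substF-weakenF θ Φ = trans (sym (List.map-∘ Φ))
    (trans (List.map-cong (substF-lift-weakenF θ) Φ) (List.map-∘ Φ))

-- Derivations under substitution

-- The accessibility relation of a Kripke-style argument: from Φ one may pass to any Ψ, in any
-- context, that proves the instances of Φ under θ. New variables and new hypotheses are both
-- special cases.
Instance : ∀ {L} (𝕋 : Theory L) {Γ Δ} → Sub Γ Δ → List (Formula L Γ) → List (Formula L Δ) → Set
Instance 𝕋 θ Φ Ψ = All (λ B → Ψ ⊢[ 𝕋 ] substF θ B) Φ

module _ {L : Language} {𝕋 : Theory L} where

  private 𝕊 = signature L

  -- Eigenvariable conditions are expressed by `weakenF`, so going under a binder only requires
  -- `lift θ` to commute with weakening; the rules with an explicit term require `substF-[]`.
  substD : ∀ {Γ Δ Φ A} (θ : Sub Γ Δ) → Φ ⊢[ 𝕋 ] A → map (substF θ) Φ ⊢[ 𝕋 ] substF θ A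
  substD θ (hyp i)          = hyp (∈-map⁺ (substF θ) i)
  substD θ (axiom {A = A} a ϑ) =
    ≡.subst (Derivation 𝕋 _) (sym (substF-substF θ ϑ A)) (axiom a _)
  substD θ (structural s D) = structural (⊆.map⁺ (substF θ) s) (substD θ D)
  substD θ (cut D E)        = cut (substD θ D) (substD θ E)
  substD θ (fresh {Φ = Φ} {A} σ D) = fresh σ
    (≡.subst₂ (Derivation 𝕋) (map-substF-weakenF θ Φ) (substF-lift-weakenF θ A) (substD (lift θ) D))
  substD θ falsoL           = falsoL
  substD θ (∧L D)           = ∧L (substD θ D)
  substD θ (∧R D E)         = ∧R (substD θ D) (substD θ E)
  substD θ (∨L D E)         = ∨L (substD θ D) (substD θ E)
  substD θ (∨R₁ D)          = ∨R₁ (substD θ D)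
  substD θ (∨R₂ D)          = ∨R₂ (substD θ D)
  substD θ (⊃L D E)         = ⊃L (substD θ D) (substD θ E)
  substD θ (⊃R D)           = ⊃R (substD θ D)
  substD θ (allL {A = A} t D) = allL (subst θ t)
    (≡.subst (λ B → Derivation 𝕋 (B ∷ _) _) (substF-[] θ A t) (substD θ D))
  substD θ (allR {Φ = Φ} D) = allR
    (≡.subst (λ Ψ → Derivation 𝕋 Ψ _) (map-substF-weakenF θ Φ) (substD (lift θ) D))
  substD θ (exL {Φ = Φ} {C = C} D) = exL
    (≡.subst₂ (λ Ψ → Derivation 𝕋 (_ ∷ Ψ)) (map-substF-weakenF θ Φ) (substF-lift-weakenF θ C)
      (substD (lift θ) D))
  substD θ (exR {A = A} t D) = exR (subst θ t)
    (≡.subst (Derivation 𝕋 _) (substF-[] θ A t) (substD θ D))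
  substD θ (reductio c D)   = reductio c (substD θ D)

  ⊃-elim : ∀ {Γ} {Φ : List (Formula L Γ)} {A B} → Φ ⊢[ 𝕋 ] A ⊃ B → Φ ⊢[ 𝕋 ] A → Φ ⊢[ 𝕋 ] B
  ⊃-elim F E = cut F (⊃L E (hyp (here refl)))

  -- Each hypothesis is moved into the conclusion as an antecedent, so that the recursion meets a
  -- shorter list without mixing Φ and Ψ.
  cut* : ∀ {Γ} {Φ Ψ : List (Formula L Γ)} {A} → All (λ B → Ψ ⊢[ 𝕋 ] B) Φ →
         Φ ⊢[ 𝕋 ] A → Ψ ⊢[ 𝕋 ] A
  cut* {Φ = []}    {Ψ} []       D = structural (λ ()) D
  cut* {Φ = B ∷ Φ} {Ψ} (E ∷ Es) D = ⊃-elim (cut* Es (⊃R D)) E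

  mono : ∀ {Γ Δ Φ Ψ A} {θ : Sub Γ Δ} → Instance 𝕋 θ Φ Ψ → Φ ⊢[ 𝕋 ] A → Ψ ⊢[ 𝕋 ] substF θ A
  mono {θ = θ} ω D = cut* (map⁺ ω) (substD θ D)

  ∧-elimˡ : ∀ {Γ} {Φ : List (Formula L Γ)} {A B} → Φ ⊢[ 𝕋 ] A ∧ B → Φ ⊢[ 𝕋 ] A
  ∧-elimˡ D = cut D (∧L (hyp (here refl)))

  ∧-elimʳ : ∀ {Γ} {Φ : List (Formula L Γ)} {A B} → Φ ⊢[ 𝕋 ] A ∧ B → Φ ⊢[ 𝕋 ] B
  ∧-elimʳ D = cut D (∧L (hyp (there (here refl))))

  all-elim : ∀ {Γ σ} {Φ : List (Formula L Γ)} {A : Formula L (σ ∷ Γ)} →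
             Φ ⊢[ 𝕋 ] all σ A → ∀ t → Φ ⊢[ 𝕋 ] A [ t ]
  all-elim D t = cut D (allL t (hyp (here refl)))

  hyps : ∀ {Γ} {Φ Ψ : List (Formula L Γ)} → Φ ⊆ Ψ → All (λ B → Ψ ⊢[ 𝕋 ] B) Φ
  hyps s = All.tabulate λ i → hyp (s i)

  instance-weaken : ∀ {Γ σ} {Φ : List (Formula L Γ)} {Ψ} → map weakenF Φ ⊆ Ψ → Instance 𝕋 (wkSub {τ = σ}) Φ Ψ
  instance-weaken s = map⁻ (hyps s)

  instance-tail : ∀ {Γ Δ σ} {Φ : List (Formula L Γ)} {Ψ : List (Formula L Δ)} {u : Term 𝕊 Δ σ} {θ} →
           Instance 𝕋 (u ∷ θ) (map weakenF Φ) Ψ → Instance 𝕋 θ Φ Ψ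
  instance-tail ω = All.map (λ {B} → ≡.subst (Derivation 𝕋 _) (substF-weakenF _ _ B)) (map⁻ ω)

-- Reasoning in the target theory

module Target {L : SourceLanguage} {TL : TargetLanguage L} (T : TargetTheory TL) where
  open TargetLanguage TL public
  open TargetTheory T public

  infix 4 _⊢_
  _⊢_ : ∀ {Δ} → List (TFormula Δ) → TFormula Δ → Set
  Ψ ⊢ A = Ψ ⊢[ theory ] A

  infix 4 _≤⟨_⟩_
  _≤⟨_⟩_ : ∀ {Δ Δ′} → List (TFormula Δ) → Sub Δ Δ′ → List (TFormula Δ′) → Set
  Ψ ≤⟨ θ ⟩ Ψ′ = Instance theory θ Ψ Ψ′

  thm : ∀ {Δ} {Ψ : List (TFormula Δ)} {A} → ⊢ᵗ A → Ψ ⊢ A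
  thm = structural λ ()

  replace : ∀ {Δ Ψ τ} (A : TFormula (τ ∷ Δ)) {s t F G} → A [ s ] ≡ F → A [ t ] ≡ G →
            Ψ ⊢ s ≐ t → Ψ ⊢ F → Ψ ⊢ G
  replace A {s} {t} refl refl eq D = ⊃-elim (⊃-elim (thm (≐-replace A s t)) eq) D

  subst-instantiate-weaken : ∀ {Δ τ σ} (u : TTerm Δ τ) (t : TTerm Δ σ) →
                             subst (u ∷ idSub) (weaken t) ≡ t
  subst-instantiate-weaken u t = trans (subst-weaken u idSub t) (subst-idSub t)

  ≐-sym : ∀ {Δ Ψ τ} {s t : TTerm Δ τ} → Ψ ⊢ s ≐ t → Ψ ⊢ t ≐ s
  ≐-sym {s = s} {t} eq = replace (var (here refl) ≐ weaken s)
    (cong (s ≐_) (subst-instantiate-weaken s s)) (cong (t ≐_) (subst-instantiate-weaken t s))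
    eq (thm (≐-refl s))

  ≐-trans : ∀ {Δ Ψ τ} {s t u : TTerm Δ τ} → Ψ ⊢ s ≐ t → Ψ ⊢ t ≐ u → Ψ ⊢ s ≐ u
  ≐-trans {s = s} {t} {u} eq eq′ = replace (weaken s ≐ var (here refl))
    (cong (_≐ t) (subst-instantiate-weaken t s)) (cong (_≐ u) (subst-instantiate-weaken u s)) eq′ eq

  ≐-congˡ : ∀ {Δ Ψ σ τ} {f g : TTerm Δ (σ ⇒ τ)} (t : TTerm Δ σ) → Ψ ⊢ f ≐ g → Ψ ⊢ f · t ≐ g · t
  ≐-congˡ {f = f} {g} t eq = replace (weaken (f · t) ≐ var (here refl) · weaken t)
    (cong₂ _≐_ (subst-instantiate-weaken f (f · t)) (cong (f ·_) (subst-instantiate-weaken f t)))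
    (cong₂ _≐_ (subst-instantiate-weaken g (f · t)) (cong (g ·_) (subst-instantiate-weaken g t)))
    eq (thm (≐-refl (f · t)))

  ≐-congʳ : ∀ {Δ Ψ σ τ} (f : TTerm Δ (σ ⇒ τ)) {s t : TTerm Δ σ} → Ψ ⊢ s ≐ t → Ψ ⊢ f · s ≐ f · t
  ≐-congʳ f {s} {t} eq = replace (weaken (f · s) ≐ weaken f · var (here refl))
    (cong₂ _≐_ (subst-instantiate-weaken s (f · s)) (cong (_· s) (subst-instantiate-weaken s f)))
    (cong₂ _≐_ (subst-instantiate-weaken t (f · s)) (cong (_· t) (subst-instantiate-weaken t f)))
    eq (thm (≐-refl (f · s)))

  infixr 5 _∷_
  data Equal {Δ} (Ψ : List (TFormula Δ)) {X : Set} (f : X → TType) :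
         ∀ {xs} → All (λ x → TTerm Δ (f x)) xs → All (λ x → TTerm Δ (f x)) xs → Set where
    []  : Equal Ψ f [] []
    _∷_ : ∀ {x xs s t} {ss ts : All (λ x → TTerm Δ (f x)) xs} → Ψ ⊢ s ≐ t → Equal Ψ f ss ts →
          Equal Ψ f {x ∷ xs} (s ∷ ss) (t ∷ ts)

  Equal-map⁺ : ∀ {Δ Ψ} {X : Set} {f : X → TType} {xs} {ss ts : All (λ x → TTerm Δ (f x)) xs} →
               Equal Ψ f ss ts → Equal Ψ (λ τ → τ) (map⁺ {f = f} ss) (map⁺ ts)
  Equal-map⁺ []       = []
  Equal-map⁺ (eq ∷ es) = eq ∷ Equal-map⁺ es

  -- One component is exchanged at a time: the template has a variable in its place, the components
  -- already treated are part of θ, and those still to come stay at `as`.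
  leibniz : ∀ {Γ Δ Ψ ts} {as bs : All (TTerm Δ) ts} (θ : Sub Γ Δ) (A : TFormula (ts ʳ++ Γ)) →
            Equal Ψ (λ τ → τ) as bs →
            Ψ ⊢ substF (revAll as θ) A → Ψ ⊢ substF (revAll bs θ) A
  leibniz θ A [] D = D
  leibniz {as = a ∷ as} {b ∷ bs} θ A (eq ∷ es) D =
    leibniz (b ∷ θ) A es
      (replace (substF (revAll (All.map weaken as) (var (here refl) ∷ All.map weaken θ)) A)
         (instance-of a) (instance-of b) eq D)
    where
    instance-of : ∀ c → substF (revAll (All.map weaken as) (var (here refl) ∷ All.map weaken θ)) A [ c ]
                        ≡ substF (revAll as (c ∷ θ)) A
    instance-of c = trans (substF-substF _ _ A) (cong (λ ϑ → substF ϑ A)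
      (trans (map-revAll _ (All.map weaken as) _)
        (cong₂ (λ x y → revAll x (c ∷ y))
          (trans (map-subst-weaken c idSub as) (map-idSub as))
          (trans (map-subst-weaken c idSub θ) (map-idSub θ)))))

  -- Bounded quantifiers over tuples of finite sets

  -- Indexed by ρs rather than by `map _✶ ρs`, so that recursion on bounds and on their members runs
  -- over one list; `map⁺` and `map⁻` convert to the form used by `all∈`.
  Sets : List TType → List WType → Set
  Sets Δ ρs = All (λ ρ → WTerm Δ (ρ ✶)) ρs

  data Members {Δ} (Ψ : List (TFormula Δ)) : ∀ {ρs} → Tuple Δ ρs → Sets Δ ρs → Set where
    []  : Members Ψ [] []
    _∷_ : ∀ {ρ ρs x B} {xs : Tuple Δ ρs} {Bs} → Ψ ⊢ _∈ᵗ_ {ρ = ρ} x B → Members Ψ xs Bs →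
          Members Ψ {ρ ∷ ρs} (x ∷ xs) (B ∷ Bs)

  Members-mono : ∀ {Δ Δ′ Ψ Ψ′} {θ : Sub Δ Δ′} → Ψ ≤⟨ θ ⟩ Ψ′ →
                 ∀ {ρs} {xs : Tuple Δ ρs} {Bs} → Members Ψ xs Bs →
                 Members Ψ′ (All.map (subst θ) xs) (All.map (subst θ) Bs)
  Members-mono ω []       = []
  Members-mono ω (m ∷ ms) = mono ω m ∷ Members-mono ω ms

  infixr 5 _◂_
  _◂_ : ∀ {Γ Δ ρs} → Tuple Δ ρs → Sub {targetSignature} Γ Δ → Sub (map wit ρs ʳ++ Γ) Δ
  bs ◂ θ = revAll (map⁺ bs) θ

  map-◂-witVars* : ∀ {Γ Δ ρs} (bs : Tuple Δ ρs) (θ : Sub Γ Δ) →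
                   All.map (subst (bs ◂ θ)) (witVars* ρs) ≡ bs
  map-◂-witVars* {ρs = ρs} bs θ = trans
    (map-map⁻ {P = TTerm _} {Q = TTerm _} (subst (bs ◂ θ)) (vars* (map wit ρs)))
    (trans (cong map⁻ (map-revAll-vars* (map⁺ bs) θ)) (map⁻-map⁺ {P = TTerm _} bs))

  map-instantiate-weaken : ∀ {Γ Δ τ} (u : TTerm Δ τ) (θ : Sub Γ Δ) {Y : Set} {f : Y → TType} {ys}
                           (c : All (λ y → TTerm Γ (f y)) ys) →
                           All.map (subst (u ∷ θ)) (All.map weaken c) ≡ All.map (subst θ) c
  map-instantiate-weaken u θ c = trans (map-∘ c) (map-cong c (subst-weaken u θ))

  -- Every quantifier of the block adds a variable and a membership hypothesis. A premise valid in
  -- all extensions absorbs both: the head of the substitution is the value of the new variable, and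
  -- the head of the instance is its membership.
  all∈-intro : ∀ {Δ Ψ ρs} (Bs : Sets Δ ρs) {F : TFormula (map wit ρs ʳ++ Δ)} →
               (∀ {Δ′ Ψ′} (θ : Sub Δ Δ′) → Ψ ≤⟨ θ ⟩ Ψ′ →
                ∀ bs → Members Ψ′ bs (All.map (subst θ) Bs) → Ψ′ ⊢ substF (bs ◂ θ) F) →
               Ψ ⊢ all∈ {ρs} (map⁺ Bs) F
  all∈-intro {Ψ = Ψ} [] {F} h = ≡.subst (Ψ ⊢_) (substF-idSub F)
    (h idSub (All.tabulate λ {B} i → ≡.subst (Ψ ⊢_) (sym (substF-idSub B)) (hyp i)) [] [])
  all∈-intro {Ψ = Ψ} {ρ ∷ ρs} (B ∷ Bs) {F} h = allR (⊃R
    (≡.subst (λ Cs → (_ ∷ map weakenF Ψ) ⊢ all∈ {ρs} Cs F) (sym (map-map⁺ {P = WTerm _} {Q = WTerm _} weaken Bs))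
      (all∈-intro (All.map weaken Bs) {F} step)))
    where
    step : ∀ {Δ′ Ψ′} (θ : Sub (wit ρ ∷ _) Δ′) →
           (_∈ᵗ_ {ρ = ρ} (var (here refl)) (weaken B) ∷ map weakenF Ψ) ≤⟨ θ ⟩ Ψ′ →
           ∀ bs → Members Ψ′ bs (All.map (subst θ) (All.map weaken Bs)) → Ψ′ ⊢ substF (bs ◂ θ) F
    step {Ψ′ = Ψ′} (b ∷ θ) (m ∷ ω) bs ms = h θ (instance-tail ω) (b ∷ bs)
      (≡.subst (λ C → Ψ′ ⊢ _∈ᵗ_ {ρ = ρ} b C) (subst-weaken b θ B) m
       ∷ ≡.subst (Members Ψ′ bs) (map-instantiate-weaken b θ Bs) ms)

  substF-all∈ : ∀ {Γ Δ ρs} (θ : Sub Γ Δ) (Bs : Sets Γ ρs) (F : TFormula (map wit ρs ʳ++ Γ)) →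
                substF θ (all∈ {ρs} (map⁺ Bs) F) ≡
                all∈ {ρs} (map⁺ (All.map (subst θ) Bs)) (substF (lift* (map wit ρs) θ) F)
  substF-all∈ θ []       F = refl
  substF-all∈ {ρs = ρ ∷ ρs} θ (B ∷ Bs) F = cong (all (wit ρ)) (cong₂ _⊃_
    (cong (_∈ᵗ_ {ρ = ρ} (var (here refl))) (subst-lift-weaken θ B))
    (begin
      substF (lift θ) (all∈ {ρs} (All.map weaken (map⁺ Bs)) F)
        ≡⟨ cong (λ Cs → substF (lift θ) (all∈ {ρs} Cs F)) (map-map⁺ {P = WTerm _} {Q = WTerm _} weaken Bs) ⟩
      substF (lift θ) (all∈ {ρs} (map⁺ (All.map weaken Bs)) F)
        ≡⟨ substF-all∈ (lift θ) (All.map weaken Bs) F ⟩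
      all∈ {ρs} (map⁺ (All.map (subst (lift θ)) (All.map weaken Bs))) _
        ≡⟨ cong (λ Cs → all∈ {ρs} (map⁺ Cs) _)
             (trans (map-∘ Bs) (trans (map-cong Bs (subst-lift-weaken θ)) (sym (map-∘ Bs)))) ⟩
      all∈ {ρs} (map⁺ (All.map weaken (All.map (subst θ) Bs))) _
        ≡⟨ cong (λ Cs → all∈ {ρs} Cs _) (map-map⁺ {P = WTerm _} {Q = WTerm _} weaken (All.map (subst θ) Bs)) ⟨
      all∈ {ρs} (All.map weaken (map⁺ (All.map (subst θ) Bs))) _ ∎))
    where open ≡-Reasoning

  -- The substitution θ accumulates the values of the quantifiers already removed, which keeps the
  -- remaining block syntactically of the form `all∈`.
  all∈-elim : ∀ {Γ Δ Ψ ρs} (θ : Sub Γ Δ) (Bs : Sets Γ ρs) {F : TFormula (map wit ρs ʳ++ Γ)} {bs} →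
              Ψ ⊢ substF θ (all∈ {ρs} (map⁺ Bs) F) → Members Ψ bs (All.map (subst θ) Bs) →
              Ψ ⊢ substF (bs ◂ θ) F
  all∈-elim θ [] D [] = D
  all∈-elim {Ψ = Ψ} {ρ ∷ ρs} θ (B ∷ Bs) {F} {b ∷ bs} D (m ∷ ms) =
    all∈-elim (b ∷ θ) (All.map weaken Bs) {F}
      (⊃-elim
        (≡.subst (Ψ ⊢_)
          (trans (substF-instantiate θ body b) (cong₂ _⊃_
            (cong (_∈ᵗ_ {ρ = ρ} b) (subst-weaken b θ B))
            (cong (λ Cs → substF (b ∷ θ) (all∈ {ρs} Cs F)) (map-map⁺ {P = WTerm _} {Q = WTerm _} weaken Bs))))
          (all-elim {A = substF (lift θ) body} D b))
        m)
      (≡.subst (Members Ψ bs) (sym (map-instantiate-weaken b θ Bs)) ms)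
    where
    body : TFormula (wit ρ ∷ _)
    body = _∈ᵗ_ {ρ = ρ} (var (here refl)) (weaken B) ⊃ all∈ {ρs} (All.map weaken (map⁺ Bs)) F

  all*-elim : ∀ {Γ Δ Ψ} ρs (θ : Sub Γ Δ) {F : TFormula (map wit ρs ʳ++ Γ)} →
              Ψ ⊢ substF θ (all* (map wit ρs) F) → ∀ (bs : Tuple Δ ρs) → Ψ ⊢ substF (bs ◂ θ) F
  all*-elim []       θ D []       = D
  all*-elim {Ψ = Ψ} (ρ ∷ ρs) θ D (b ∷ bs) = all*-elim ρs (b ∷ θ)
    (≡.subst (Ψ ⊢_) (substF-instantiate θ _ b) (all-elim D b)) bs

  -- Witnesses are built as combinatory terms over witnessing types only, with
  -- closed target terms as constants, since λ-abstraction is available only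
  -- for terms all of whose subterms have witnessing type.
  witSignature : Signature
  witSignature = record { Type = WType ; arrow = _⇒_ ; Constant = λ ρ → WTerm [] ρ }

  W : List WType → WType → Set
  W = Term witSignature

  WSets : List WType → List WType → Set
  WSets Ξ ρs = All (λ ρ → W Ξ (ρ ✶)) ρs

  ev : ∀ {Ξ Δ} → Tuple Δ Ξ → ∀ {ρ} → W Ξ ρ → WTerm Δ ρ
  ev a (var x) = All.lookup a x
  ev a (con c) = fromClosed c
  ev a (s · t) = ev a s · ev a t

  subst-ev : ∀ {Ξ Δ Δ′} (θ : Sub Δ Δ′) (a : Tuple Δ Ξ) {ρ} (t : W Ξ ρ) →
             subst θ (ev a t) ≡ ev (All.map (subst θ) a) t
  subst-ev θ a (var x) = sym (lookup-map a x)
  subst-ev θ a (con c) = subst-fromClosed θ c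
  subst-ev θ a (s · t) = cong₂ _·_ (subst-ev θ a s) (subst-ev θ a t)

  ev-subst : ∀ {Ξ Ω Δ} (a : Tuple Δ Ω) (ϑ : Sub Ξ Ω) {ρ} (t : W Ξ ρ) →
             ev a (subst ϑ t) ≡ ev (All.map (ev a) ϑ) t
  ev-subst a ϑ (var x) = sym (lookup-map ϑ x)
  ev-subst a ϑ (con c) = refl
  ev-subst a ϑ (s · t) = cong₂ _·_ (ev-subst a ϑ s) (ev-subst a ϑ t)

  ev-rename : ∀ {Ξ Ω Δ} {r : Ξ ⊆ Ω} (a : Tuple Δ Ω) (a′ : Tuple Δ Ξ) →
              (∀ {ρ} (i : ρ ∈ Ξ) → All.lookup a (r i) ≡ All.lookup a′ i) →
              ∀ {ρ} (t : W Ξ ρ) → ev a (rename r t) ≡ ev a′ t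
  ev-rename a a′ h (var x) = h x
  ev-rename a a′ h (con c) = refl
  ev-rename a a′ h (s · t) = cong₂ _·_ (ev-rename a a′ h s) (ev-rename a a′ h t)

  ev-idSub : ∀ {Ξ Δ} (a : Tuple Δ Ξ) → All.map (ev a) idSub ≡ a
  ev-idSub a = lookup-ext λ i → trans (lookup-map idSub i) (cong (ev a) (lookup-tabulate var i))

  ev-revAll-vars* : ∀ {σs Ξ Δ} (us : Tuple Δ σs) (a : Tuple Δ Ξ) →
                    All.map (ev (revAll us a)) (vars* σs) ≡ us
  ev-revAll-vars* []       a = refl
  ev-revAll-vars* (u ∷ us) a =
    cong₂ _∷_ (lookup-revAll us (u ∷ a) (here refl)) (ev-revAll-vars* us (u ∷ a))

  ev-revAll-there* : ∀ {σs Ξ Δ} (us : Tuple Δ σs) (a : Tuple Δ Ξ) {ρ} (t : W Ξ ρ) →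
                     ev (revAll us a) (rename (there* σs) t) ≡ ev a t
  ev-revAll-there* us a = ev-rename (revAll us a) a (lookup-revAll us a)

  -- Abstraction and finite unions from combinators

  K : ∀ {Ξ} ρ τ → W Ξ (ρ ⇒ τ ⇒ ρ)
  K ρ τ = con (con (Πʷ ρ τ))

  S : ∀ {Ξ} ρ σ τ → W Ξ ((ρ ⇒ σ ⇒ τ) ⇒ (ρ ⇒ σ) ⇒ ρ ⇒ τ)
  S ρ σ τ = con (con (Σʷ ρ σ τ))

  -- Bracket abstraction: the identity is `S K K`, every other variable and every constant goes
  -- under `K`, and `S` distributes over application.
  lam : ∀ {Ξ ρ τ} → W (ρ ∷ Ξ) τ → W Ξ (ρ ⇒ τ)
  lam {ρ = ρ} (var (here refl)) = S ρ (ρ ⇒ ρ) ρ · K ρ (ρ ⇒ ρ) · K ρ ρ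
  lam (var (there x))           = K _ _ · var x
  lam (con c)                   = K _ _ · con c
  lam (s · t)                   = S _ _ _ · lam s · lam t

  -- Abstractions are only ever compared after application to an argument, so the combinator
  -- equations and congruence of application suffice.
  β : ∀ {Ξ Δ Ψ ρ τ} (a : Tuple Δ Ξ) (t : W (ρ ∷ Ξ) τ) (u : WTerm Δ ρ) →
      Ψ ⊢ ev a (lam t) · u ≐ ev (u ∷ a) t
  β {ρ = ρ} a (var (here refl)) u = ≐-trans
    (thm (Σʷ-eq ρ (ρ ⇒ ρ) ρ (con (Πʷ ρ (ρ ⇒ ρ))) (con (Πʷ ρ ρ)) u))
    (thm (Πʷ-eq ρ (ρ ⇒ ρ) u (con (Πʷ ρ ρ) · u)))
  β {ρ = ρ} {τ} a (var (there x)) u = thm (Πʷ-eq τ ρ (All.lookup a x) u)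
  β {ρ = ρ} {τ} a (con c) u         = thm (Πʷ-eq τ ρ (fromClosed c) u)
  β {ρ = ρ} {τ} a (_·_ {σ = σ} s t) u = ≐-trans
    (thm (Σʷ-eq ρ σ τ (ev a (lam s)) (ev a (lam t)) u))
    (≐-trans (≐-congˡ (ev a (lam t) · u) (β a s u)) (≐-congʳ (ev (u ∷ a) s) (β a t u)))

  Λ : ∀ {Ξ ρ} σs → W (σs ʳ++ Ξ) ρ → W Ξ (σs ⇛ ρ)
  Λ []       t = t
  Λ (σ ∷ σs) t = lam (Λ σs t)

  apply-cong : ∀ {Δ Ψ} σs {ρ} {f g : WTerm Δ (σs ⇛ ρ)} (us : Tuple Δ σs) →
               Ψ ⊢ f ≐ g → Ψ ⊢ apply {ρ = ρ} f us ≐ apply {ρ = ρ} g us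
  apply-cong []       []       eq = eq
  apply-cong (σ ∷ σs) (u ∷ us) eq = apply-cong σs us (≐-congˡ u eq)

  β* : ∀ {Ξ Δ Ψ} σs {ρ} (a : Tuple Δ Ξ) (t : W (σs ʳ++ Ξ) ρ) (us : Tuple Δ σs) →
       Ψ ⊢ apply {ρ = ρ} (ev a (Λ σs t)) us ≐ ev (revAll us a) t
  β* []       a t []       = thm (≐-refl (ev a t))
  β* (σ ∷ σs) a t (u ∷ us) =
    ≐-trans (apply-cong σs us (β a (Λ σs t) u)) (β* σs (u ∷ a) t us)

  Λ* : ∀ {Ξ ρs} σs → Sub {witSignature} ρs (σs ʳ++ Ξ) → Sub {witSignature} (σs ⇛* ρs) Ξ
  Λ* σs ts = map⁺ (All.map (Λ σs) ts)

  Λ*-·· : ∀ {Ξ Δ Ψ} σs {ρs} (a : Tuple Δ Ξ) (ts : Sub ρs (σs ʳ++ Ξ)) (us : Tuple Δ σs) →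
          Equal Ψ wit (_··_ {σs = σs} {ρs} (All.map (ev a) (Λ* σs ts)) us) (All.map (ev (revAll us a)) ts)
  Λ*-·· σs a []       us = []
  Λ*-·· σs a (t ∷ ts) us = β* σs a t us ∷ Λ*-·· σs a ts us

  infixr 17 _∪ʷ_
  _∪ʷ_ : ∀ {Ξ ρ} → W Ξ (ρ ✶) → W Ξ (ρ ✶) → W Ξ (ρ ✶)
  s ∪ʷ t = con (con (unionʷ _)) · s · t

  singleʷ : ∀ {Ξ ρ} → W Ξ ρ → W Ξ (ρ ✶)
  singleʷ t = con (con (singletonʷ _)) · t

  -- The union of s as its block of variables ranges over the product of the Bs, obtained by nesting
  -- one indexed union for each variable.
  ⋃ʷ : ∀ {Ξ ρ σs} → WSets Ξ σs → W (σs ʳ++ Ξ) (ρ ✶) → W Ξ (ρ ✶)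
  ⋃ʷ []       s = s
  ⋃ʷ (B ∷ Bs) s = con (con (indexedUnionʷ _ _)) · lam (⋃ʷ (All.map weaken Bs) s) · B

  ∈-resp : ∀ {Δ Ψ ρ} {x : WTerm Δ ρ} {B C : WTerm Δ (ρ ✶)} →
           Ψ ⊢ B ≐ C → Ψ ⊢ _∈ᵗ_ {ρ = ρ} x B → Ψ ⊢ _∈ᵗ_ {ρ = ρ} x C
  ∈-resp {ρ = ρ} {x} {B} {C} = replace (_∈ᵗ_ {ρ = ρ} (weaken x) (var (here refl)))
    (cong (λ y → _∈ᵗ_ {ρ = ρ} y B) (subst-instantiate-weaken B x))
    (cong (λ y → _∈ᵗ_ {ρ = ρ} y C) (subst-instantiate-weaken C x))

  ∈-⋃-intro : ∀ {Δ Ψ ρ τ} {x : WTerm Δ τ} {q : WTerm Δ (ρ ⇒ τ ✶)} {B : WTerm Δ (ρ ✶)} {u : WTerm Δ ρ} →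
              Ψ ⊢ _∈ᵗ_ {ρ = ρ} u B → Ψ ⊢ _∈ᵗ_ {ρ = τ} x (q · u) → Ψ ⊢ _∈ᵗ_ {ρ = τ} x (⋃ {ρ = ρ} {τ} q B)
  ∈-⋃-intro {Ψ = Ψ} {ρ} {τ} {x} {q} {B} {u} D E =
    ⊃-elim (∧-elimʳ (thm (∈-⋃ ρ τ x q B))) (exR u (∧R
      (≡.subst (λ C → Ψ ⊢ _∈ᵗ_ {ρ = ρ} u C) (sym (subst-instantiate-weaken u B)) D)
      (≡.subst (Ψ ⊢_) (sym (cong₂ (λ y p → _∈ᵗ_ {ρ = τ} y (p · u))
         (subst-instantiate-weaken u x) (subst-instantiate-weaken u q))) E)))

  ∈-⋃ʷ : ∀ {Ξ Δ Ψ ρ σs} (a : Tuple Δ Ξ) (Bs : WSets Ξ σs) (s : W (σs ʳ++ Ξ) (ρ ✶))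
         {us : Tuple Δ σs} {x : WTerm Δ ρ} → Members Ψ us (All.map (ev a) Bs) →
         Ψ ⊢ _∈ᵗ_ {ρ = ρ} x (ev (revAll us a) s) → Ψ ⊢ _∈ᵗ_ {ρ = ρ} x (ev a (⋃ʷ Bs s))
  ∈-⋃ʷ a [] s {[]} [] D = D
  ∈-⋃ʷ {Ψ = Ψ} {ρ} {σ ∷ σs} a (B ∷ Bs) s {u ∷ us} {x} (m ∷ ms) D =
    ∈-⋃-intro {ρ = σ} {ρ} m (∈-resp {ρ = ρ} (≐-sym (β a (⋃ʷ (All.map weaken Bs) s) u))
      (∈-⋃ʷ (u ∷ a) (All.map weaken Bs) s {us} {x}
        (≡.subst (Members Ψ us)
          (sym (trans (map-∘ Bs) (map-cong Bs (ev-rename (u ∷ a) a (λ i → refl))))) ms) D))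

  -- These terms have two uses: they fill witnesses and counter-witnesses whose value is immaterial,
  -- and their singletons make a bound provably inhabited.
  defaultᵗ : ∀ ρ → WTerm [] ρ
  defaultᵗ (gr X)  = con (eʷ X)
  defaultᵗ (ρ ⇒ τ) = con (Πʷ τ ρ) · defaultᵗ τ
  defaultᵗ (ρ ✶)   = con (singletonʷ ρ) · defaultᵗ ρ

  default : ∀ {Ξ} ρ → W Ξ ρ
  default ρ = con (defaultᵗ ρ)

  ∈-single : ∀ {Δ Ψ ρ} (x : WTerm Δ ρ) → Ψ ⊢ _∈ᵗ_ {ρ = ρ} x (⟨_⟩ᵘ {ρ = ρ} x)
  ∈-single {ρ = ρ} x = ⊃-elim (∧-elimʳ (thm (∈-singleton ρ x x))) (thm (≐-refl x))

  ∈-∪ˡ : ∀ {Δ Ψ ρ} {x : WTerm Δ ρ} {B C : WTerm Δ (ρ ✶)} →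
         Ψ ⊢ _∈ᵗ_ {ρ = ρ} x B → Ψ ⊢ _∈ᵗ_ {ρ = ρ} x (_∪_ {ρ = ρ} B C)
  ∈-∪ˡ {ρ = ρ} {x} {B} {C} D = ⊃-elim (∧-elimʳ (thm (∈-union ρ x B C))) (∨R₁ D)

  ∈-∪ʳ : ∀ {Δ Ψ ρ} {x : WTerm Δ ρ} {B C : WTerm Δ (ρ ✶)} →
         Ψ ⊢ _∈ᵗ_ {ρ = ρ} x C → Ψ ⊢ _∈ᵗ_ {ρ = ρ} x (_∪_ {ρ = ρ} B C)
  ∈-∪ʳ {ρ = ρ} {x} {B} {C} D = ⊃-elim (∧-elimʳ (thm (∈-union ρ x B C))) (∨R₂ D)

  -- Interpretations as natural families of target formulas

  Form : List (SType L) → List WType → List WType → Set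
  Form Γ P N = ∀ {Δ} → Env Γ Δ → Tuple Δ P → Tuple Δ N → TFormula Δ

  Natural : ∀ {Γ P N} → Form Γ P N → Set
  Natural f = ∀ {Δ Δ′} (θ : Sub Δ Δ′) η a b →
    substF θ (f η a b) ≡ f (All.map (subst θ) η) (All.map (subst θ) a) (All.map (subst θ) b)

  -- The types of witnesses and counter-witnesses are data here, not functions of a formula, so
  -- changing the source environment does not affect them. Naturality is what lets a form be moved
  -- under target binders and instantiated there.
  record Int (Γ : List (SType L)) : Set where
    constructor int
    field
      P N     : List WType
      form    : Form Γ P N
      natural : Natural form
  open Int public

  form-≡ : ∀ {Γ} (X : Int Γ) {Δ} {η η′ : Env Γ Δ} {a a′ b b′} →
           η ≡ η′ → a ≡ a′ → b ≡ b′ → form X η a b ≡ form X η′ a′ b′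
  form-≡ X refl refl refl = refl

  ⌜⌝-subst : ∀ {Γ Δ Δ′ σ} (θ : Sub Δ Δ′) (u : STerm L Γ σ) (η : Env Γ Δ) →
             subst θ (⌜ u ⌝ η) ≡ ⌜ u ⌝ (All.map (subst θ) η)
  ⌜⌝-subst θ (var x) η = sym (lookup-map η x)
  ⌜⌝-subst θ (con c) η = refl
  ⌜⌝-subst θ (s · t) η = cong₂ _·_ (⌜⌝-subst θ s η) (⌜⌝-subst θ t η)

  ⌜⌝-rename : ∀ {Γ Δ Δ′ σ} (r : Δ ⊆ Δ′) (u : STerm L Γ σ) (η : Env Γ Δ) →
              rename r (⌜ u ⌝ η) ≡ ⌜ u ⌝ (All.map (rename r) η)
  ⌜⌝-rename r (var x) η = sym (lookup-map η x)
  ⌜⌝-rename r (con c) η = refl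
  ⌜⌝-rename r (s · t) η = cong₂ _·_ (⌜⌝-rename r s η) (⌜⌝-rename r t η)

  ∀∈ : ∀ {Γ} (X : Int Γ) {Δ} → Env Γ Δ → Tuple Δ (P X) → Sets Δ (N X) → TFormula Δ
  ∀∈ X η a B = all∈ {N X} (map⁺ B) (form X (All.map (rename w) η) (All.map (rename w) a) (witVars* (N X)))
    where w = there* (map wit (N X))

  ∀∈-≡ : ∀ {Γ} (X : Int Γ) {Δ} {η η′ : Env Γ Δ} {a a′ B B′} →
         η ≡ η′ → a ≡ a′ → B ≡ B′ → ∀∈ X η a B ≡ ∀∈ X η′ a′ B′
  ∀∈-≡ X refl refl refl = refl

  map-◂-there* : ∀ {Γ Δ ρs} {X : Set} {f : X → TType} (bs : Tuple Δ ρs) (θ : Sub Γ Δ) {xs}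
                 (a : All (λ x → TTerm Γ (f x)) xs) →
                 All.map (subst (bs ◂ θ)) (All.map (rename (there* (map wit ρs))) a) ≡ All.map (subst θ) a
  map-◂-there* bs θ a = trans (map-∘ a) (map-cong a (subst-revAll-there* (map⁺ bs) θ))

  ∀∈-body : ∀ {Γ} (X : Int Γ) {Δ Δ′} (θ : Sub Δ Δ′) (η : Env Γ Δ) a b →
            let w = there* (map wit (N X)) in
            substF (b ◂ θ) (form X (All.map (rename w) η) (All.map (rename w) a) (witVars* (N X)))
              ≡ form X (All.map (subst θ) η) (All.map (subst θ) a) b
  ∀∈-body X θ η a b = trans (natural X (b ◂ θ) _ _ _)
    (form-≡ X (map-◂-there* b θ η) (map-◂-there* b θ a) (map-◂-witVars* b θ))

  natural-∀∈ : ∀ {Γ} (X : Int Γ) {Δ Δ′} (θ : Sub Δ Δ′) (η : Env Γ Δ) a B →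
               substF θ (∀∈ X η a B) ≡
               ∀∈ X (All.map (subst θ) η) (All.map (subst θ) a) (All.map (subst θ) B)
  natural-∀∈ X θ η a B = trans (substF-all∈ θ B _) (cong (all∈ (map⁺ (All.map (subst θ) B)))
    (trans (natural X (lift* ts θ) _ _ _) (form-≡ X (under η) (under a) vars-fixed)))
    where
    ts = map wit (N X)
    under : ∀ {Y : Set} {f : Y → TType} {ys} (c : All (λ y → TTerm _ (f y)) ys) →
            All.map (subst (lift* ts θ)) (All.map (rename (there* ts)) c)
              ≡ All.map (rename (there* ts)) (All.map (subst θ) c)
    under c = trans (map-∘ c) (trans (map-cong c (subst-lift*-there* ts θ)) (sym (map-∘ c)))
    vars-fixed : All.map (subst (lift* ts θ)) (witVars* (N X)) ≡ witVars* (N X)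
    vars-fixed = trans (map-map⁻ {P = TTerm _} {Q = TTerm _} (subst (lift* ts θ)) (vars* ts))
                       (cong map⁻ (map-lift*-vars* ts θ))

  ∀∈-intro : ∀ {Γ} (X : Int Γ) {Δ Ψ} (η : Env Γ Δ) a B →
             (∀ {Δ′ Ψ′} (θ : Sub Δ Δ′) → Ψ ≤⟨ θ ⟩ Ψ′ → ∀ b → Members Ψ′ b (All.map (subst θ) B) →
              Ψ′ ⊢ form X (All.map (subst θ) η) (All.map (subst θ) a) b) →
             Ψ ⊢ ∀∈ X η a B
  ∀∈-intro X η a B h = all∈-intro B λ {_} {Ψ′} θ ω b m →
    ≡.subst (Ψ′ ⊢_) (sym (∀∈-body X θ η a b)) (h θ ω b m)

  map-subst-idSub-family : ∀ {Δ} {Y : Set} {f : Y → TType} {ys} (c : All (λ y → TTerm Δ (f y)) ys) →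
                           All.map (subst idSub) c ≡ c
  map-subst-idSub-family c = trans (map-cong c subst-idSub) (map-id c)

  ∀∈-elim : ∀ {Γ} (X : Int Γ) {Δ Ψ} (η : Env Γ Δ) a {B b} →
            Ψ ⊢ ∀∈ X η a B → Members Ψ b B → Ψ ⊢ form X η a b
  ∀∈-elim X {Δ} {Ψ} η a {B} {b} D m = ≡.subst (Ψ ⊢_)
    (trans (∀∈-body X idSub η a b) (form-≡ X (map-subst-idSub-family η) (map-subst-idSub-family a) refl))
    (all∈-elim idSub B (≡.subst (Ψ ⊢_) (sym (substF-idSub _)) D)
      (≡.subst (Members Ψ b) (sym (map-subst-idSub-family B)) m))

  ∀∈-mono : ∀ {Γ} (X : Int Γ) {Δ Δ′ Ψ Ψ′} {θ : Sub Δ Δ′} → Ψ ≤⟨ θ ⟩ Ψ′ → ∀ (η : Env Γ Δ) a B →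
            Ψ ⊢ ∀∈ X η a B →
            Ψ′ ⊢ ∀∈ X (All.map (subst θ) η) (All.map (subst θ) a) (All.map (subst θ) B)
  ∀∈-mono X {Ψ′ = Ψ′} {θ} ω η a B D = ≡.subst (Ψ′ ⊢_) (natural-∀∈ X θ η a B) (mono ω D)

  infix 4 _⊢_⊑_
  -- Inclusion is expressed by members in all extensions, not by a formula of the target, to match
  -- the premise of `∀∈-intro`.
  _⊢_⊑_ : ∀ {Δ} → List (TFormula Δ) → ∀ {ρs} → Sets Δ ρs → Sets Δ ρs → Set
  Ψ ⊢ B ⊑ C = ∀ {Δ′ Ψ′} (θ : Sub _ Δ′) → Ψ ≤⟨ θ ⟩ Ψ′ → ∀ b →
    Members Ψ′ b (All.map (subst θ) B) → Members Ψ′ b (All.map (subst θ) C)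

  ∀∈-⊑ : ∀ {Γ} (X : Int Γ) {Δ Ψ} (η : Env Γ Δ) a {B C} →
         Ψ ⊢ B ⊑ C → Ψ ⊢ ∀∈ X η a C → Ψ ⊢ ∀∈ X η a B
  ∀∈-⊑ X η a {B} {C} s D = ∀∈-intro X η a B λ θ ω b m →
    ∀∈-elim X _ _ (∀∈-mono X ω η a C D) (s θ ω b m)

  ⊑-Equal : ∀ {Δ Ψ ρs} {B C : Sets Δ ρs} → Equal Ψ (λ ρ → wit (ρ ✶)) B C → Ψ ⊢ B ⊑ C
  ⊑-Equal []         θ ω []       []       = []
  ⊑-Equal {ρs = ρ ∷ _} (eq ∷ eqs) θ ω (b ∷ bs) (m ∷ ms) =
    ∈-resp {ρ = ρ} (mono ω eq) m ∷ ⊑-Equal eqs θ ω bs ms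

  singles : ∀ {Ξ ρs} → Sub {witSignature} ρs Ξ → WSets Ξ ρs
  singles = All.map singleʷ

  Members-singles : ∀ {Ξ Δ Ψ ρs} (ε : Tuple Δ Ξ) (v : Sub ρs Ξ) →
                    Members Ψ (All.map (ev ε) v) (All.map (ev ε) (singles v))
  Members-singles ε []             = []
  Members-singles {ρs = ρ ∷ _} ε (t ∷ v) = ∈-single {ρ = ρ} (ev ε t) ∷ Members-singles ε v

  unions : ∀ {Ξ ρs} → WSets Ξ ρs → WSets Ξ ρs → WSets Ξ ρs
  unions []       []       = []
  unions (B ∷ Bs) (C ∷ Cs) = (B ∪ʷ C) ∷ unions Bs Cs

  ⊑-unionsˡ : ∀ {Ξ Δ Ψ ρs} (ε : Tuple Δ Ξ) (Bs Cs : WSets Ξ ρs) →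
              Ψ ⊢ All.map (ev ε) Bs ⊑ All.map (ev ε) (unions Bs Cs)
  ⊑-unionsˡ ε []       []       θ ω []       []       = []
  ⊑-unionsˡ {ρs = ρ ∷ _} ε (B ∷ Bs) (C ∷ Cs) θ ω (b ∷ bs) (m ∷ ms) =
    ∈-∪ˡ {ρ = ρ} m ∷ ⊑-unionsˡ ε Bs Cs θ ω bs ms

  ⊑-unionsʳ : ∀ {Ξ Δ Ψ ρs} (ε : Tuple Δ Ξ) (Bs Cs : WSets Ξ ρs) →
              Ψ ⊢ All.map (ev ε) Cs ⊑ All.map (ev ε) (unions Bs Cs)
  ⊑-unionsʳ ε []       []       θ ω []       []       = []
  ⊑-unionsʳ {ρs = ρ ∷ _} ε (B ∷ Bs) (C ∷ Cs) θ ω (b ∷ bs) (m ∷ ms) =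
    ∈-∪ʳ {ρ = ρ} m ∷ ⊑-unionsʳ ε Bs Cs θ ω bs ms

  subst-evs : ∀ {Ξ Δ Δ′} (θ : Sub Δ Δ′) (a : Tuple Δ Ξ) {F : WType → WType} {ρs}
              (ts : All (λ ρ → W Ξ (F ρ)) ρs) →
              All.map (subst θ) (All.map (ev a) ts) ≡ All.map (ev (All.map (subst θ) a)) ts
  subst-evs θ a ts = trans (map-∘ ts) (map-cong ts (subst-ev θ a))

  evs-subst : ∀ {Ξ Ω Δ} (a : Tuple Δ Ω) (ϑ : Sub Ξ Ω) {F : WType → WType} {ρs}
              (ts : All (λ ρ → W Ξ (F ρ)) ρs) →
              All.map (ev a) (All.map (subst ϑ) ts) ≡ All.map (ev (All.map (ev a) ϑ)) ts
  evs-subst a ϑ ts = trans (map-∘ ts) (map-cong ts (ev-subst a ϑ))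

  -- The member us of the bounds picks one set out of the indexed union; β identifies that set with
  -- the value of ss at us.
  ⊑-⋃ : ∀ {Ξ Δ Ψ σs ρs} (ε : Tuple Δ Ξ) (Bs : WSets Ξ σs) (ss : WSets (σs ʳ++ Ξ) ρs) {us} →
        Members Ψ us (All.map (ev ε) Bs) →
        Ψ ⊢ All.map (ev (revAll us ε)) ss ⊑ All.map (ev ε) (All.map (⋃ʷ Bs) ss)
  ⊑-⋃ ε Bs []       mu θ ω []       []       = []
  ⊑-⋃ {ρs = ρ ∷ _} ε Bs (s ∷ ss) {us} mu {Ψ′ = Ψ′} θ ω (b ∷ bs) (m ∷ ms) =
    ≡.subst (λ C → Ψ′ ⊢ _∈ᵗ_ {ρ = ρ} b C) (sym (subst-ev θ ε (⋃ʷ Bs s)))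
      (∈-⋃ʷ (All.map (subst θ) ε) Bs s
        (≡.subst (Members Ψ′ _) (subst-evs θ ε Bs) (Members-mono ω mu))
        (≡.subst (λ C → Ψ′ ⊢ _∈ᵗ_ {ρ = ρ} b C)
          (trans (subst-ev θ (revAll us ε) s) (cong (λ x → ev x s) (map-revAll (subst θ) us ε))) m))
    ∷ ⊑-⋃ ε Bs ss mu θ ω bs ms

  -- Morphisms: identity and composition

  varsˡ : ∀ P {N} → Sub {witSignature} P (P ++ N)
  varsˡ P = ++⁻ˡ P idSub

  varsʳ : ∀ P {N} → Sub {witSignature} N (P ++ N)
  varsʳ P = ++⁻ʳ P idSub

  ev-varsˡ : ∀ {P N Δ} (a : Tuple Δ P) (b : Tuple Δ N) → All.map (ev (++⁺ a b)) (varsˡ P) ≡ a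
  ev-varsˡ {P} a b = trans (map-++⁻ˡ _ P idSub)
    (trans (cong (++⁻ˡ P) (ev-idSub (++⁺ a b))) (++⁻ˡ-++⁺ a b))

  ev-varsʳ : ∀ {P N Δ} (a : Tuple Δ P) (b : Tuple Δ N) → All.map (ev (++⁺ a b)) (varsʳ P) ≡ b
  ev-varsʳ {P} a b = trans (map-++⁻ʳ _ P idSub)
    (trans (cong (++⁻ʳ P) (ev-idSub (++⁺ a b))) (++⁻ʳ-++⁺ a b))

  -- Validity holds under arbitrary hypotheses Ψ in an arbitrary target context, so a morphism can
  -- be applied in the middle of a target derivation. The terms do not depend on η: they are uniform
  -- in the source variables.
  record Mor {Γ} (X Y : Int Γ) : Set where
    field
      t     : Sub {witSignature} (P Y) (P X)
      s     : WSets (P X ++ N Y) (N X)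
      valid : ∀ {Δ} {Ψ : List (TFormula Δ)} (η : Env Γ Δ) a d →
              Ψ ⊢ ∀∈ X η a (All.map (ev (++⁺ a d)) s) → Ψ ⊢ form Y η (All.map (ev a) t) d
  open Mor public

  -- The index of `mk` forces both sides to have the same lists of types. Matching on it thus
  -- identifies the types, and no term has to be transported along an equality.
  data _≅_ {Γ} : Int Γ → Int Γ → Set where
    mk : ∀ {P N} {f g : Form Γ P N} {nf : Natural {Γ} {P} {N} f} {ng : Natural {Γ} {P} {N} g} →
         (∀ {Δ} (η : Env Γ Δ) a b → f η a b ≡ g η a b) → int P N f nf ≅ int P N g ng

  -- The bound is the singleton of the given counter-witness, so the bounded hypothesis yields f at
  -- precisely that d.
  mor-id : ∀ {Γ P N} {f g : Form Γ P N} {nf : Natural {Γ} {P} {N} f} {ng : Natural {Γ} {P} {N} g} →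
           (∀ {Δ} {Ψ : List (TFormula Δ)} (η : Env Γ Δ) a d → Ψ ⊢ f η a d → Ψ ⊢ g η a d) →
           Mor (int P N f nf) (int P N g ng)
  mor-id {Γ} {P} {N} {f} {g} {nf} {ng} h = record
    { t     = idSub
    ; s     = singles (varsʳ P)
    ; valid = λ {_} {Ψ} η a d D → ≡.subst (λ c → Ψ ⊢ g η c d) (sym (ev-idSub a))
        (h η a d (∀∈-elim (int P N f nf) η a D
          (≡.subst (λ c → Members Ψ c (All.map (ev (++⁺ a d)) (singles (varsʳ P))))
            (ev-varsʳ a d) (Members-singles (++⁺ a d) (varsʳ P)))))
    }

  ≅⇒mor : ∀ {Γ} {X Y : Int Γ} → X ≅ Y → Mor X Y
  ≅⇒mor (mk h) = mor-id λ {_} {Ψ} η a d → ≡.subst (Ψ ⊢_) (h η a d)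

  mor-∘ : ∀ {Γ} {X Y Z : Int Γ} → Mor Y Z → Mor X Y → Mor X Z
  mor-∘ {Γ} {X} {Y} {Z} g f = record
    { t     = All.map (subst (t f)) (t g)
    ; s     = All.map (⋃ʷ B) (All.map (subst ϑ) (s f))
    ; valid = λ {Δ} {Ψ} η a d D →
        ≡.subst (λ c → Ψ ⊢ form Z η c d) (sym (evs-subst a (t f) (t g)))
          (valid g η (All.map (ev a) (t f)) d (∀∈-intro Y _ _ _ λ {_} {Ψ′} θ ω y my →
            let a′ = All.map (subst θ) a
                d′ = All.map (subst θ) d
                ε  = ++⁺ a′ d′
                mB = ≡.subst (Members Ψ′ y) (eqB θ a d) my
            in ≡.subst (λ c → Ψ′ ⊢ form Y _ c y) (sym (subst-evs θ a (t f)))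
              -- For a single y in the bound of g, the bound that f asks for at y is included in the
              -- union over all such y, for which the hypothesis is available.
              (valid f _ a′ y (∀∈-⊑ X _ _
                 (≡.subst (λ C → Ψ′ ⊢ C ⊑ _) (eqS a′ d′ y) (⊑-⋃ ε B (All.map (subst ϑ) (s f)) mB))
                 (≡.subst (λ C → Ψ′ ⊢ ∀∈ X _ _ C)
                   (trans (subst-evs θ (++⁺ a d) _)
                      (cong (λ ε → All.map (ev ε) _) (map-++⁺ (subst θ) a d)))
                   (∀∈-mono X ω η a _ D))))))
    }
    where
    -- The bound of g on the middle counter-witnesses, with the witnesses that f computes from a.
    B : WSets (P X ++ N Z) (N Y)
    B = All.map (subst (++⁺ (All.map (subst (varsˡ (P X))) (t f)) (varsʳ (P X)))) (s g)

    -- In the bound of f, the counter-witnesses of Y become the block of variables over which the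
    -- union is taken.
    ϑ : Sub (P X ++ N Y) (N Y ʳ++ (P X ++ N Z))
    ϑ = ++⁺ (All.map (rename (there* (N Y))) (varsˡ (P X))) (vars* (N Y))

    eqB : ∀ {Δ Δ′} (θ : Sub Δ Δ′) (a : Tuple Δ (P X)) d →
          All.map (subst θ) (All.map (ev (++⁺ (All.map (ev a) (t f)) d)) (s g)) ≡
          All.map (ev (++⁺ (All.map (subst θ) a) (All.map (subst θ) d))) B
    eqB θ a d = begin
      All.map (subst θ) (All.map (ev (++⁺ (All.map (ev a) (t f)) d)) (s g))
        ≡⟨ subst-evs θ _ (s g) ⟩
      All.map (ev (All.map (subst θ) (++⁺ (All.map (ev a) (t f)) d))) (s g)
        ≡⟨ cong (λ ε → All.map (ev ε) (s g)) (trans (map-++⁺ (subst θ) _ d)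
             (cong (λ c → ++⁺ c _) (subst-evs θ a (t f)))) ⟩
      All.map (ev (++⁺ (All.map (ev a′) (t f)) d′)) (s g)
        ≡⟨ cong (λ ε → All.map (ev ε) (s g)) (trans (map-++⁺ (ev (++⁺ a′ d′)) _ (varsʳ (P X)))
             (cong₂ ++⁺ (trans (evs-subst (++⁺ a′ d′) (varsˡ (P X)) (t f))
                               (cong (λ ε → All.map (ev ε) (t f)) (ev-varsˡ a′ d′)))
                        (ev-varsʳ a′ d′))) ⟨
      All.map (ev (All.map (ev (++⁺ a′ d′)) _)) (s g)
        ≡⟨ evs-subst (++⁺ a′ d′) _ (s g) ⟨
      All.map (ev (++⁺ a′ d′)) B ∎
      where
      open ≡-Reasoning
      a′ = All.map (subst θ) a
      d′ = All.map (subst θ) d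

    eqS : ∀ {Δ} (a : Tuple Δ (P X)) d y →
          All.map (ev (revAll y (++⁺ a d))) (All.map (subst ϑ) (s f)) ≡ All.map (ev (++⁺ a y)) (s f)
    eqS a d y = trans (evs-subst _ ϑ (s f)) (cong (λ ε → All.map (ev ε) (s f))
      (trans (map-++⁺ _ _ (vars* (N Y)))
        (cong₂ ++⁺ (trans (map-∘ (varsˡ (P X)))
                     (trans (map-cong (varsˡ (P X)) (ev-revAll-there* y (++⁺ a d))) (ev-varsˡ a d)))
                   (ev-revAll-vars* y (++⁺ a d)))))

  -- Connectives and quantifiers on interpretations

  map-lift-weaken : ∀ {Γ Δ τ} (θ : Sub Γ Δ) {Y : Set} {f : Y → TType} {ys}
                    (c : All (λ y → TTerm Γ (f y)) ys) →
                    All.map (subst (lift {τ = τ} θ)) (All.map weaken c) ≡ All.map weaken (All.map (subst θ) c)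
  map-lift-weaken θ c = trans (map-∘ c) (trans (map-cong c (subst-lift-weaken θ)) (sym (map-∘ c)))

  subst-apply : ∀ {Δ Δ′} (θ : Sub Δ Δ′) σs {ρ} (f : WTerm Δ (σs ⇛ ρ)) (us : Tuple Δ σs) →
                subst θ (apply {ρ = ρ} f us) ≡ apply {ρ = ρ} (subst θ f) (All.map (subst θ) us)
  subst-apply θ []       f []       = refl
  subst-apply θ (σ ∷ σs) f (u ∷ us) = subst-apply θ σs (f · u) us

  subst-·· : ∀ {Δ Δ′} (θ : Sub Δ Δ′) σs ρs (fs : Tuple Δ (σs ⇛* ρs)) (us : Tuple Δ σs) →
             All.map (subst θ) (_··_ {σs = σs} {ρs} fs us) ≡
             _··_ {σs = σs} {ρs} (All.map (subst θ) fs) (All.map (subst θ) us)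
  subst-·· θ σs []       []       us = refl
  subst-·· θ σs (ρ ∷ ρs) (f ∷ fs) us = cong₂ _∷_ (subst-apply θ σs f us) (subst-·· θ σs ρs fs us)

  falsoᴵ : ∀ {Γ} → Int Γ
  falsoᴵ = int [] [] (λ _ _ _ → falso) (λ _ _ _ _ → refl)

  infixr 15 _∧ᴵ_
  _∧ᴵ_ : ∀ {Γ} → Int Γ → Int Γ → Int Γ
  X ∧ᴵ Y = int (P X ++ P Y) (N X ++ N Y)
    (λ η a b → form X η (++⁻ˡ (P X) a) (++⁻ˡ (N X) b) ∧ form Y η (++⁻ʳ (P X) a) (++⁻ʳ (N X) b))
    (λ θ η a b → cong₂ _∧_
      (trans (natural X θ η _ _) (cong₂ (form X _) (map-++⁻ˡ (subst θ) (P X) a) (map-++⁻ˡ (subst θ) (N X) b)))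
      (trans (natural Y θ η _ _) (cong₂ (form Y _) (map-++⁻ʳ (subst θ) (P X) a) (map-++⁻ʳ (subst θ) (N X) b))))

  P⊃ : ∀ {Γ} → Int Γ → Int Γ → List WType
  P⊃ X Y = (P X ⇛* P Y) ++ ((P X ++ N Y) ⇛* map _✶ (N X))

  appˡ : ∀ {Γ Δ} (X Y : Int Γ) → Tuple Δ (P⊃ X Y) → Tuple Δ (P X) → Tuple Δ (P Y)
  appˡ X Y fg a = ++⁻ˡ (P X ⇛* P Y) fg ·· a

  appʳ : ∀ {Γ Δ} (X Y : Int Γ) → Tuple Δ (P⊃ X Y) → Tuple Δ (P X ++ N Y) → Sets Δ (N X)
  appʳ X Y fg ad = map⁻ (++⁻ʳ (P X ⇛* P Y) fg ·· ad)

  subst-appˡ : ∀ {Γ Δ Δ′} (X Y : Int Γ) (θ : Sub Δ Δ′) fg a →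
               All.map (subst θ) (appˡ X Y fg a) ≡ appˡ X Y (All.map (subst θ) fg) (All.map (subst θ) a)
  subst-appˡ X Y θ fg a = trans (subst-·· θ (P X) (P Y) _ a)
    (cong (λ f → _··_ {σs = P X} {P Y} f (All.map (subst θ) a)) (map-++⁻ˡ (subst θ) (P X ⇛* P Y) fg))

  subst-appʳ : ∀ {Γ Δ Δ′} (X Y : Int Γ) (θ : Sub Δ Δ′) fg ad →
               All.map (subst θ) (appʳ X Y fg ad) ≡ appʳ X Y (All.map (subst θ) fg) (All.map (subst θ) ad)
  subst-appʳ X Y θ fg ad = trans (map-map⁻ {P = WTerm _} {Q = WTerm _} (subst θ) _) (cong map⁻
    (trans (subst-·· θ (P X ++ N Y) (map _✶ (N X)) _ ad)
      (cong (λ f → _··_ {σs = P X ++ N Y} {map _✶ (N X)} f (All.map (subst θ) ad)) (map-++⁻ʳ (subst θ) (P X ⇛* P Y) fg))))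

  infixr 13 _⊃ᴵ_
  _⊃ᴵ_ : ∀ {Γ} → Int Γ → Int Γ → Int Γ
  X ⊃ᴵ Y = int (P⊃ X Y) (P X ++ N Y)
    (λ η fg ad → ∀∈ X η (++⁻ˡ (P X) ad) (appʳ X Y fg ad) ⊃ form Y η (appˡ X Y fg (++⁻ˡ (P X) ad)) (++⁻ʳ (P X) ad))
    (λ θ η fg ad → cong₂ _⊃_
      (trans (natural-∀∈ X θ η _ _) (cong₂ (∀∈ X _) (map-++⁻ˡ (subst θ) (P X) ad) (subst-appʳ X Y θ fg ad)))
      (trans (natural Y θ η _ _) (cong₂ (form Y _)
        (trans (subst-appˡ X Y θ fg (++⁻ˡ (P X) ad)) (cong (appˡ X Y (All.map (subst θ) fg)) (map-++⁻ˡ (subst θ) (P X) ad)))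
        (map-++⁻ʳ (subst θ) (P X) ad))))

  allᴵ : ∀ {Γ} σ → Int (σ ∷ Γ) → Int Γ
  allᴵ σ X = int (P X) (N X)
    (λ η a b → all (src σ) (form X (var (here refl) ∷ All.map weaken η) (All.map weaken a) (All.map weaken b)))
    (λ θ η a b → cong (all (src σ)) (trans (natural X (lift θ) _ _ _)
      (form-≡ X (cong (_ ∷_) (map-lift-weaken θ η)) (map-lift-weaken θ a) (map-lift-weaken θ b))))

  exᴵ : ∀ {Γ} σ → Int (σ ∷ Γ) → Int Γ
  exᴵ σ X = int (P X) (map _✶ (N X))
    (λ η a B → ex (src σ) (∀∈ X (var (here refl) ∷ All.map weaken η) (All.map weaken a) (All.map weaken (map⁻ B))))
    (λ θ η a B → cong (ex (src σ)) (trans (natural-∀∈ X (lift θ) _ _ _)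
      (∀∈-≡ X (cong (_ ∷_) (map-lift-weaken θ η)) (map-lift-weaken θ a) (trans (map-lift-weaken θ (map⁻ B))
        (cong (All.map weaken) (map-map⁻ {P = WTerm _} {Q = WTerm _} (subst θ) B))))))

  wkᴵ : ∀ {Γ σ} → Int Γ → Int (σ ∷ Γ)
  wkᴵ X = int (P X) (N X) (λ { (u ∷ η) → form X η }) λ { θ (u ∷ η) → natural X θ η }

  instᴵ : ∀ {Γ σ} → STerm L Γ σ → Int (σ ∷ Γ) → Int Γ
  instᴵ u X = int (P X) (N X) (λ η → form X (⌜ u ⌝ η ∷ η)) λ θ η a b →
    trans (natural X θ _ a b) (form-≡ X (cong (_∷ _) (⌜⌝-subst θ u η)) refl refl)

  subᴵ : ∀ {Γ Γ′} → Sub {sourceSignature L} Γ Γ′ → Int Γ → Int Γ′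
  subᴵ ϑ X = int (P X) (N X) (λ η → form X (All.map (λ t → ⌜ t ⌝ η) ϑ)) λ θ η a b →
    trans (natural X θ _ a b) (form-≡ X (trans (map-∘ ϑ) (map-cong ϑ (λ t → ⌜⌝-subst θ t η))) refl refl)

  ∀∈-subᴵ : ∀ {Γ Γ′} (ϑ : Sub Γ Γ′) (X : Int Γ) {Δ} (η : Env Γ′ Δ) a B →
            ∀∈ (subᴵ ϑ X) η a B ≡ ∀∈ X (All.map (λ t → ⌜ t ⌝ η) ϑ) a B
  ∀∈-subᴵ ϑ X η a B = cong (all∈ {N X} (map⁺ B)) (form-≡ X
    (sym (trans (map-∘ ϑ) (map-cong ϑ (λ t → ⌜⌝-rename (there* (map wit (N X))) t η)))) refl refl)

  ∀∈-instᴵ : ∀ {Γ σ} (u : STerm L Γ σ) (X : Int (σ ∷ Γ)) {Δ} (η : Env Γ Δ) a B →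
             ∀∈ (instᴵ u X) η a B ≡ ∀∈ X (⌜ u ⌝ η ∷ η) a B
  ∀∈-instᴵ u X η a B = cong (all∈ {N X} (map⁺ B)) (form-≡ X
    (cong₂ _∷_ (sym (⌜⌝-rename (there* (map wit (N X))) u η)) refl) refl refl)

  -- Morphisms for source substitution and quantifiers

  map-subst-wkSub : ∀ {Δ τ} {Y : Set} {f : Y → TType} {ys} (c : All (λ y → TTerm Δ (f y)) ys) →
                    All.map (subst (wkSub {τ = τ})) c ≡ All.map weaken c
  map-subst-wkSub c = map-cong c subst-wkSub

  weaken-evs : ∀ {Ξ Δ τ} (a : Tuple Δ Ξ) {F : WType → WType} {ρs} (ts : All (λ ρ → W Ξ (F ρ)) ρs) →
               All.map (weaken {τ = τ}) (All.map (ev a) ts) ≡ All.map (ev (All.map weaken a)) ts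
  weaken-evs a ts = trans (sym (map-subst-wkSub (All.map (ev a) ts)))
    (trans (subst-evs wkSub a ts) (cong (λ ε → All.map (ev ε) ts) (map-subst-wkSub a)))

  weakenF-form : ∀ {Γ} (X : Int Γ) {Δ τ} (η : Env Γ Δ) a b →
                 weakenF {σ = τ} (form X η a b) ≡ form X (All.map weaken η) (All.map weaken a) (All.map weaken b)
  weakenF-form X η a b = trans (natural X wkSub η a b)
    (form-≡ X (map-subst-wkSub η) (map-subst-wkSub a) (map-subst-wkSub b))

  weakenF-∀∈ : ∀ {Γ} (X : Int Γ) {Δ τ} (η : Env Γ Δ) a B →
               weakenF {σ = τ} (∀∈ X η a B) ≡ ∀∈ X (All.map weaken η) (All.map weaken a) (All.map weaken B)
  weakenF-∀∈ X η a B = trans (natural-∀∈ X wkSub η a B)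
    (∀∈-≡ X (map-subst-wkSub η) (map-subst-wkSub a) (map-subst-wkSub B))

  weaken-evs-++ : ∀ {Ξ Ω Δ τ} (a : Tuple Δ Ξ) (d : Tuple Δ Ω) {F : WType → WType} {ρs}
                  (ts : All (λ ρ → W (Ξ ++ Ω) (F ρ)) ρs) →
                  All.map (weaken {τ = τ}) (All.map (ev (++⁺ a d)) ts)
                    ≡ All.map (ev (++⁺ (All.map weaken a) (All.map weaken d))) ts
  weaken-evs-++ a d ts =
    trans (weaken-evs (++⁺ a d) ts) (cong (λ ε → All.map (ev ε) ts) (map-++⁺ weaken a d))

  unweaken : ∀ {Δ τ} {u : TTerm Δ τ} {Y : Set} {f : Y → TType} {ys} (c : All (λ y → TTerm Δ (f y)) ys) →
             All.map (subst (u ∷ idSub)) (All.map weaken c) ≡ c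
  unweaken {u = u} c = trans (map-instantiate-weaken u idSub c) (map-subst-idSub-family c)

  defaults : ∀ {Ξ} ρs → Sub {witSignature} ρs Ξ
  defaults []       = []
  defaults (ρ ∷ ρs) = default ρ ∷ defaults ρs

  mor-sub : ∀ {Γ Γ′} (ϑ : Sub Γ Γ′) {X Y : Int Γ} → Mor X Y → Mor (subᴵ ϑ X) (subᴵ ϑ Y)
  mor-sub ϑ {X} f = record
    { t     = t f
    ; s     = s f
    ; valid = λ {_} {Ψ} η a d D → valid f _ a d (≡.subst (Ψ ⊢_) (∀∈-subᴵ ϑ X η a _) D)
    }

  mor-all : ∀ {Γ σ} {X : Int Γ} {Y : Int (σ ∷ Γ)} → Mor (wkᴵ X) Y → Mor X (allᴵ σ Y)
  mor-all {X = X} {Y} f = record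
    { t     = t f
    ; s     = s f
    ; valid = λ {_} {Ψ} η a d D → allR
        (≡.subst (λ c → map weakenF Ψ ⊢ form Y _ c _) (sym (weaken-evs a (t f)))
          (valid f (var (here refl) ∷ All.map weaken η) _ _
            (≡.subst (map weakenF Ψ ⊢_)
              (trans (weakenF-∀∈ X η a _) (∀∈-≡ X refl refl (weaken-evs-++ a d (s f))))
              (mono (instance-weaken λ i → i) D))))
    }

  mor-instantiate : ∀ {Γ σ} {X : Int (σ ∷ Γ)} (u : STerm L Γ σ) → Mor (allᴵ σ X) (instᴵ u X)
  mor-instantiate {X = X} u = mor-id λ {_} {Ψ} η a d D → ≡.subst (Ψ ⊢_)
    (trans (natural X (⌜ u ⌝ η ∷ idSub) _ _ _)
      (form-≡ X (cong₂ _∷_ refl (unweaken η)) (unweaken a) (unweaken d)))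
    (all-elim D (⌜ u ⌝ η))

  mor-witness : ∀ {Γ σ} {X : Int (σ ∷ Γ)} (u : STerm L Γ σ) → Mor (instᴵ u X) (exᴵ σ X)
  mor-witness {X = X} u = record
    { t     = idSub
    -- A counter-witness of the existential formula is a tuple of sets, and these very sets bound
    -- the instance.
    ; s     = map⁻ (varsʳ (P X))
    ; valid = λ {_} {Ψ} η a B D → exR (⌜ u ⌝ η) (≡.subst (Ψ ⊢_) (sym (trans (natural-∀∈ X (⌜ u ⌝ η ∷ idSub) _ _ _)
        (∀∈-≡ X (cong₂ _∷_ refl (unweaken η)) (trans (unweaken (All.map (ev a) idSub)) (ev-idSub a)) (unweaken (map⁻ B)))))
        (≡.subst (Ψ ⊢_) (trans (∀∈-instᴵ u X η a _) (∀∈-≡ X refl refl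
            (trans (map-map⁻ {P = W _} {Q = WTerm _} (ev (++⁺ a B)) (varsʳ (P X))) (cong map⁻ (ev-varsʳ a B))))) D))
    }

  mor-ex : ∀ {Γ σ} {X : Int (σ ∷ Γ)} {Z : Int Γ} → Mor X (wkᴵ Z) → Mor (exᴵ σ X) Z
  mor-ex {σ = σ} {X} {Z} f = record
    { t     = t f
    -- The counter-witnesses of the existential premise are themselves tuples of sets. Only one is
    -- needed, the bound of f, and its singleton contains it.
    ; s     = singles (map⁺ (s f))
    ; valid = λ {_} {Ψ} η a d D → cut
        (∀∈-elim (exᴵ σ X) η a D (Members-singles (++⁺ a d) (map⁺ (s f))))
        (exL (≡.subst (Derivation theory _)
          (sym (trans (weakenF-form Z η _ d) (cong (λ c → form Z _ c _) (weaken-evs a (t f)))))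
          (valid f (var (here refl) ∷ All.map weaken η) _ _
            (≡.subst (Derivation theory _) (∀∈-≡ X refl refl
              (trans (cong (All.map weaken) (trans (cong map⁻ (map-map⁺ {P = W _} {Q = WTerm _} (ev (++⁺ a d)) (s f)))
                        (map⁻-map⁺ {P = WTerm _} _)))
                     (weaken-evs-++ a d (s f))))
              (hyp (here refl))))))
    }

  -- Morphisms for the propositional connectives

  mor-const : ∀ {Γ} {X Y : Int Γ} (c : Tuple [] (P Y)) →
              (∀ {Δ} {Ψ : List (TFormula Δ)} (η : Env Γ Δ) d → Ψ ⊢ form Y η (All.map fromClosed c) d) → Mor X Y
  mor-const {X = X} {Y} c h = record
    { t     = All.map con c
    ; s     = singles (defaults (N X))
    ; valid = λ {_} {Ψ} η a d D → ≡.subst (λ c → Ψ ⊢ form Y η c d) (sym (map-∘ c)) (h η d)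
    }

  mor-absurd : ∀ {Γ} {Y : Int Γ} → Mor falsoᴵ Y
  mor-absurd {Y = Y} = record
    { t     = defaults (P Y)
    ; s     = []
    ; valid = λ η a d D → cut D falsoL
    }

  mor-pair : ∀ {Γ} {X Y Z : Int Γ} → Mor X Y → Mor X Z → Mor X (Y ∧ᴵ Z)
  mor-pair {X = X} {Y} {Z} f g = record
    { t     = ++⁺ (t f) (t g)
    ; s     = unions sf sg
    ; valid = λ {_} {Ψ} η a d D → ∧R
        (≡.subst (λ c → Ψ ⊢ form Y η c _)
          (sym (trans (cong (++⁻ˡ (P Y)) (map-++⁺ (ev a) (t f) (t g))) (++⁻ˡ-++⁺ _ _)))
          (valid f η a _ (≡.subst (λ C → Ψ ⊢ ∀∈ X η a C) (ev-sf a d)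
            (∀∈-⊑ X η a (⊑-unionsˡ (++⁺ a d) sf sg) D))))
        (≡.subst (λ c → Ψ ⊢ form Z η c _)
          (sym (trans (cong (++⁻ʳ (P Y)) (map-++⁺ (ev a) (t f) (t g))) (++⁻ʳ-++⁺ (All.map (ev a) (t f)) _)))
          (valid g η a _ (≡.subst (λ C → Ψ ⊢ ∀∈ X η a C) (ev-sg a d)
            (∀∈-⊑ X η a (⊑-unionsʳ (++⁺ a d) sf sg) D))))
    }
    where
    sf = All.map (subst (++⁺ (varsˡ (P X)) (++⁻ˡ (N Y) (varsʳ (P X))))) (s f)
    sg = All.map (subst (++⁺ (varsˡ (P X)) (++⁻ʳ (N Y) (varsʳ (P X))))) (s g)

    ev-sf : ∀ {Δ} (a : Tuple Δ (P X)) d →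
            All.map (ev (++⁺ a d)) sf ≡ All.map (ev (++⁺ a (++⁻ˡ (N Y) d))) (s f)
    ev-sf a d = trans (evs-subst _ _ (s f)) (cong (λ ε → All.map (ev ε) (s f))
      (trans (map-++⁺ _ (varsˡ (P X)) _) (cong₂ ++⁺ (ev-varsˡ a d)
        (trans (map-++⁻ˡ _ (N Y) _) (cong (++⁻ˡ (N Y)) (ev-varsʳ a d))))))

    ev-sg : ∀ {Δ} (a : Tuple Δ (P X)) d →
            All.map (ev (++⁺ a d)) sg ≡ All.map (ev (++⁺ a (++⁻ʳ (N Y) d))) (s g)
    ev-sg a d = trans (evs-subst _ _ (s g)) (cong (λ ε → All.map (ev ε) (s g))
      (trans (map-++⁺ _ (varsˡ (P X)) _) (cong₂ ++⁺ (ev-varsˡ a d)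
        (trans (map-++⁻ʳ _ (N Y) _) (cong (++⁻ʳ (N Y)) (ev-varsʳ a d))))))

  -- A projection that may also use the second factor to change the first. With an equation as
  -- second factor, this is replacement of equals.
  mor-∧ˡ : ∀ {Γ P N} {f g : Form Γ P N} {nf : Natural {Γ} {P} {N} f} {ng : Natural {Γ} {P} {N} g} (Y : Int Γ) →
           (∀ {Δ} {Ψ : List (TFormula Δ)} (η : Env Γ Δ) a d b b′ →
              Ψ ⊢ f η a d → Ψ ⊢ form Y η b b′ → Ψ ⊢ g η a d) →
           Mor (int P N f nf ∧ᴵ Y) (int P N g ng)
  mor-∧ˡ {Γ} {P = P′} {N′} {f} {g} {nf} {ng} Y h = record
    { t     = ++⁻ˡ P′ idSub
    ; s     = singles v
    ; valid = λ {_} {Ψ} η a d D →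
        let E = ∀∈-elim (int P′ N′ f nf ∧ᴵ Y) η a D (Members-singles (++⁺ a d) v)
        in ≡.subst (λ c → Ψ ⊢ g η c d) (sym (trans (map-++⁻ˡ (ev a) P′ idSub) (cong (++⁻ˡ P′) (ev-idSub a))))
          (h η _ d _ _ (≡.subst (λ c → Ψ ⊢ f η _ c)
             (trans (cong (++⁻ˡ N′) (map-++⁺ (ev (++⁺ a d)) (varsʳ (P′ ++ P Y)) (defaults (N Y))))
               (trans (++⁻ˡ-++⁺ _ _) (ev-varsʳ a d)))
             (∧-elimˡ E)) (∧-elimʳ E))
    }
    where
    v : Sub (N′ ++ N Y) ((P′ ++ P Y) ++ N′)
    -- The conjunction has to be challenged on both sides before its first half can be extracted;
    -- the challenge for Y may be arbitrary.
    v = ++⁺ (varsʳ (P′ ++ P Y)) (defaults (N Y))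

  mor-∧ʳ : ∀ {Γ} {X Y : Int Γ} → Mor (X ∧ᴵ Y) Y
  mor-∧ʳ {X = X} {Y} = record
    { t     = ++⁻ʳ (P X) idSub
    ; s     = singles v
    ; valid = λ {_} {Ψ} η a d D → ≡.subst (Ψ ⊢_)
        (cong₂ (form Y η)
          (sym (trans (map-++⁻ʳ (ev a) (P X) idSub) (cong (++⁻ʳ (P X)) (ev-idSub a))))
          (trans (cong (++⁻ʳ (N X)) (map-++⁺ (ev (++⁺ a d)) (defaults (N X)) (varsʳ (P X ++ P Y))))
            (trans (++⁻ʳ-++⁺ (All.map (ev (++⁺ a d)) (defaults (N X))) _) (ev-varsʳ a d))))
        (∧-elimʳ (∀∈-elim (X ∧ᴵ Y) η a D (Members-singles (++⁺ a d) v)))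
    }
    where
    v : Sub (N X ++ N Y) ((P X ++ P Y) ++ N Y)
    v = ++⁺ (defaults (N X)) (varsʳ (P X ++ P Y))

  Equal-sym : ∀ {Δ Ψ} {X : Set} {f : X → TType} {xs} {ss ts : All (λ x → TTerm Δ (f x)) xs} →
              Equal Ψ f ss ts → Equal Ψ f ts ss
  Equal-sym []         = []
  Equal-sym (eq ∷ eqs) = ≐-sym eq ∷ Equal-sym eqs

  Equal-map⁻ : ∀ {Δ Ψ} {X Y : Set} {f : X → TType} {g : Y → X} {ys} {ss ts : All (λ x → TTerm Δ (f x)) (map g ys)} →
               Equal Ψ f ss ts → Equal Ψ (λ y → f (g y)) {ys} (map⁻ ss) (map⁻ ts)
  Equal-map⁻ {ys = []}    []         = []
  Equal-map⁻ {ys = _ ∷ _} (eq ∷ eqs) = eq ∷ Equal-map⁻ eqs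

  -- By naturality a form at given witnesses is an instance of the same form at a block of fresh
  -- variables, and `leibniz` applies to the latter.
  form-Equal : ∀ {Γ} (X : Int Γ) {Δ Ψ} (η : Env Γ Δ) {a a′} b →
               Equal Ψ wit a a′ → Ψ ⊢ form X η a b → Ψ ⊢ form X η a′ b
  form-Equal X {Δ} {Ψ} η {a} {a′} b eqs D = ≡.subst (Ψ ⊢_) (at a′)
    (leibniz idSub A (Equal-map⁺ eqs) (≡.subst (Ψ ⊢_) (sym (at a)) D))
    where
    w = there* (map wit (P X))
    A = form X (All.map (rename w) η) (witVars* (P X)) (All.map (rename w) b)
    at : ∀ c → substF (c ◂ idSub) A ≡ form X η c b
    at c = trans (natural X (c ◂ idSub) _ _ _) (form-≡ X
      (trans (map-◂-there* c idSub η) (map-subst-idSub-family η))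
      (map-◂-witVars* c idSub)
      (trans (map-◂-there* c idSub b) (map-subst-idSub-family b)))

  ∀∈-∧ : ∀ {Γ} (X Y : Int Γ) {Δ Ψ} (η : Env Γ Δ) a b B →
         Ψ ⊢ ∀∈ X η a (++⁻ˡ (N X) B) → Ψ ⊢ ∀∈ Y η b (++⁻ʳ (N X) B) → Ψ ⊢ ∀∈ (X ∧ᴵ Y) η (++⁺ a b) B
  ∀∈-∧ X Y {Ψ = Ψ} η a b B D E = ∀∈-intro (X ∧ᴵ Y) η (++⁺ a b) B λ {_} {Ψ′} θ ω c m → ∧R
    (≡.subst (Ψ′ ⊢_) (form-≡ X refl (sym (trans (cong (++⁻ˡ (P X)) (map-++⁺ (subst θ) a b)) (++⁻ˡ-++⁺ _ _))) refl)
      (∀∈-elim X _ _ (∀∈-mono X ω η a _ D)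
        (≡.subst (Members Ψ′ _) (sym (map-++⁻ˡ (subst θ) (N X) B)) (Members-++⁻ˡ (N X) m))))
    (≡.subst (Ψ′ ⊢_) (form-≡ Y refl
        (sym (trans (cong (++⁻ʳ (P X)) (map-++⁺ (subst θ) a b)) (++⁻ʳ-++⁺ (All.map (subst θ) a) _))) refl)
      (∀∈-elim Y _ _ (∀∈-mono Y ω η b _ E)
        (≡.subst (Members Ψ′ _) (sym (map-++⁻ʳ (subst θ) (N X) B)) (Members-++⁻ʳ (N X) m))))
    where
    Members-++⁻ˡ : ∀ {Δ Ψ} ρs {σs} {bs : Tuple Δ (ρs ++ σs)} {Bs} →
                   Members Ψ bs Bs → Members Ψ (++⁻ˡ ρs bs) (++⁻ˡ ρs Bs)
    Members-++⁻ˡ []       ms       = []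
    Members-++⁻ˡ (ρ ∷ ρs) (m ∷ ms) = m ∷ Members-++⁻ˡ ρs ms

    Members-++⁻ʳ : ∀ {Δ Ψ} ρs {σs} {bs : Tuple Δ (ρs ++ σs)} {Bs} →
                   Members Ψ bs Bs → Members Ψ (++⁻ʳ ρs bs) (++⁻ʳ ρs Bs)
    Members-++⁻ʳ []       ms       = ms
    Members-++⁻ʳ (ρ ∷ ρs) (m ∷ ms) = Members-++⁻ʳ ρs ms

  Members-++⁺ : ∀ {Δ Ψ ρs σs} {bs : Tuple Δ ρs} {Bs} {cs : Tuple Δ σs} {Cs} →
                Members Ψ bs Bs → Members Ψ cs Cs → Members Ψ (++⁺ bs cs) (++⁺ Bs Cs)
  Members-++⁺ []       ns = ns
  Members-++⁺ (m ∷ ms) ns = m ∷ Members-++⁺ ms ns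

  -- Projecting to Y requires the set bounding X to be inhabited.
  ∀∈-∧ʳ : ∀ {Γ} (X Y : Int Γ) {Δ Ψ} (η : Env Γ Δ) a {b B C} → Members Ψ b B →
          Ψ ⊢ ∀∈ (X ∧ᴵ Y) η a (++⁺ B C) → Ψ ⊢ ∀∈ Y η (++⁻ʳ (P X) a) C
  ∀∈-∧ʳ X Y η a {b} {B} {C} m D = ∀∈-intro Y η _ C λ {_} {Ψ′} θ ω c n → ≡.subst (Ψ′ ⊢_)
    (form-≡ Y refl (sym (map-++⁻ʳ (subst θ) (P X) a)) (++⁻ʳ-++⁺ (All.map (subst θ) b) c))
    (∧-elimʳ (∀∈-elim (X ∧ᴵ Y) _ _ (∀∈-mono (X ∧ᴵ Y) ω η a _ D)
      (≡.subst (Members Ψ′ _) (sym (map-++⁺ (subst θ) B C)) (Members-++⁺ (Members-mono ω m) n))))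

  applyʷ : ∀ {Ξ} σs {ρ} → W Ξ (σs ⇛ ρ) → Sub {witSignature} σs Ξ → W Ξ ρ
  applyʷ []       f []       = f
  applyʷ (σ ∷ σs) f (u ∷ us) = applyʷ σs (f · u) us

  apply*ʷ : ∀ {Ξ} σs ρs → Sub {witSignature} (σs ⇛* ρs) Ξ → Sub {witSignature} σs Ξ → Sub {witSignature} ρs Ξ
  apply*ʷ σs []       []       us = []
  apply*ʷ σs (ρ ∷ ρs) (f ∷ fs) us = applyʷ σs f us ∷ apply*ʷ σs ρs fs us

  ev-applyʷ : ∀ {Ξ Δ} (ε : Tuple Δ Ξ) σs {ρ} (f : W Ξ (σs ⇛ ρ)) us →
              ev ε (applyʷ σs {ρ} f us) ≡ apply {ρ = ρ} (ev ε f) (All.map (ev ε) us)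
  ev-applyʷ ε []       f []       = refl
  ev-applyʷ ε (σ ∷ σs) f (u ∷ us) = ev-applyʷ ε σs (f · u) us

  ev-apply*ʷ : ∀ {Ξ Δ} (ε : Tuple Δ Ξ) σs ρs (fs : Sub (σs ⇛* ρs) Ξ) us →
               All.map (ev ε) (apply*ʷ σs ρs fs us) ≡ _··_ {σs = σs} {ρs} (All.map (ev ε) fs) (All.map (ev ε) us)
  ev-apply*ʷ ε σs []       []       us = refl
  ev-apply*ʷ ε σs (ρ ∷ ρs) (f ∷ fs) us = cong₂ _∷_ (ev-applyʷ ε σs f us) (ev-apply*ʷ ε σs ρs fs us)

  -- The bound of f splits in two. Its X half remains a bound; its Y half, abstracted over the
  -- witnesses of Y and the counter-witnesses of Z, becomes the second component of the witness of
  -- the implication.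
  mor-curry : ∀ {Γ} {X Y Z : Int Γ} → Mor (X ∧ᴵ Y) Z → Mor X (Y ⊃ᴵ Z)
  mor-curry {Γ} {X} {Y} {Z} f = record
    { t     = ++⁺ (Λ* (P Y) t₁) (Λ* (P Y ++ N Z) t₂)
    ; s     = s₀
    ; valid = λ {_} {Ψ} η a yz D →
        let y = ++⁻ˡ (P Y) yz
            z = ++⁻ʳ (P Y) yz
            S′ = All.map (ev (++⁺ (++⁺ a y) z)) (s f)
            c = All.map (ev a) (++⁺ (Λ* (P Y) t₁) (Λ* (P Y ++ N Z) t₂))
            Ψ₁ = ∀∈ Y η y (appʳ Y Z c yz) ∷ Ψ
        -- The implication speaks of λ-terms applied to y and to yz, f of their β-reducts; the goal
        -- and the bound in the hypothesis are converted by `Λ*-··`.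
        in ⊃R (form-Equal Z η z
          (≡.subst₂ (λ g u → Equal Ψ₁ wit u (_··_ {σs = P Y} {P Z} g y))
            (sym (trans (cong (++⁻ˡ (P Y ⇛* P Z)) (map-++⁺ (ev a) (Λ* (P Y) t₁) _)) (++⁻ˡ-++⁺ _ _)))
            (ev-t₁ a y)
            (Equal-sym (Λ*-·· (P Y) a t₁ y)))
          (valid f η (++⁺ a y) z (∀∈-∧ X Y η a y S′
            (≡.subst (Ψ₁ ⊢_) (∀∈-≡ X refl refl (ev-s₀ a yz)) (structural there D))
            (∀∈-⊑ Y η y
              (⊑-Equal (≡.subst₂ (λ g u → Equal Ψ₁ (λ ρ → wit (ρ ✶)) u (map⁻ (_··_ {σs = P Y ++ N Z} {map _✶ (N Y)} g yz)))
                (sym (trans (cong (++⁻ʳ (P Y ⇛* P Z)) (map-++⁺ (ev a) (Λ* (P Y) t₁) _)) (++⁻ʳ-++⁺ (All.map (ev a) (Λ* (P Y) t₁)) _)))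
                (ev-t₂ a yz)
                (Equal-map⁻ (Equal-sym (Λ*-·· (P Y ++ N Z) a t₂ yz)))))
              (hyp (here refl))))))
    }
    where
    t₁ : Sub (P Z) (P Y ʳ++ P X)
    t₁ = All.map (subst (++⁺ (All.map (rename (there* (P Y))) idSub) (vars* (P Y)))) (t f)

    yz : Sub (P Y ++ N Z) ((P Y ++ N Z) ʳ++ P X)
    yz = vars* (P Y ++ N Z)

    ϑ₁ : Sub (P X ++ P Y) ((P Y ++ N Z) ʳ++ P X)
    ϑ₁ = ++⁺ (All.map (rename (there* (P Y ++ N Z))) idSub) (++⁻ˡ (P Y) yz)

    ϑ : Sub ((P X ++ P Y) ++ N Z) ((P Y ++ N Z) ʳ++ P X)
    ϑ = ++⁺ ϑ₁ (++⁻ʳ (P Y) yz)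

    t₂ : Sub (map _✶ (N Y)) ((P Y ++ N Z) ʳ++ P X)
    t₂ = map⁺ (All.map (subst ϑ) (++⁻ʳ (N X) (s f)))

    ϑ₂ : Sub (P X ++ P Y) (P X ++ (P Y ++ N Z))
    ϑ₂ = ++⁺ (varsˡ (P X)) (++⁻ˡ (P Y) (varsʳ (P X)))

    ϑ₀ : Sub ((P X ++ P Y) ++ N Z) (P X ++ (P Y ++ N Z))
    ϑ₀ = ++⁺ ϑ₂ (++⁻ʳ (P Y) (varsʳ (P X)))

    s₀ : WSets (P X ++ (P Y ++ N Z)) (N X)
    s₀ = All.map (subst ϑ₀) (++⁻ˡ (N X) (s f))

    ev-under : ∀ {Δ σs} (us : Tuple Δ σs) (a : Tuple Δ (P X)) →
               All.map (ev (revAll us a)) (All.map (rename (there* σs)) idSub) ≡ a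
    ev-under us a = trans (map-∘ idSub) (trans (map-cong idSub (ev-revAll-there* us a)) (ev-idSub a))

    ev-t₁ : ∀ {Δ} (a : Tuple Δ (P X)) y → All.map (ev (revAll y a)) t₁ ≡ All.map (ev (++⁺ a y)) (t f)
    ev-t₁ a y = trans (evs-subst _ _ (t f)) (cong (λ ε → All.map (ev ε) (t f))
      (trans (map-++⁺ _ _ (vars* (P Y))) (cong₂ ++⁺ (ev-under y a) (ev-revAll-vars* y a))))

    ev-t₂ : ∀ {Δ} (a : Tuple Δ (P X)) u → map⁻ (All.map (ev (revAll u a)) t₂) ≡
            ++⁻ʳ (N X) (All.map (ev (++⁺ (++⁺ a (++⁻ˡ (P Y) u)) (++⁻ʳ (P Y) u))) (s f))
    ev-t₂ a u = trans (cong map⁻ (map-map⁺ {P = W _} {Q = WTerm _} (ev (revAll u a)) _))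
      (trans (map⁻-map⁺ {P = WTerm _} _) (trans (evs-subst _ ϑ (++⁻ʳ (N X) (s f)))
        (trans (cong (λ ε → All.map (ev ε) (++⁻ʳ (N X) (s f)))
            (trans (map-++⁺ _ ϑ₁ (++⁻ʳ (P Y) yz)) (cong₂ ++⁺
              (trans (map-++⁺ _ _ (++⁻ˡ (P Y) yz)) (cong₂ ++⁺ (ev-under u a)
                (trans (map-++⁻ˡ _ (P Y) yz) (cong (++⁻ˡ (P Y)) (ev-revAll-vars* u a)))))
              (trans (map-++⁻ʳ _ (P Y) yz) (cong (++⁻ʳ (P Y)) (ev-revAll-vars* u a))))))
          (map-++⁻ʳ (ev _) (N X) (s f)))))

    ev-s₀ : ∀ {Δ} (a : Tuple Δ (P X)) u → All.map (ev (++⁺ a u)) s₀ ≡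
            ++⁻ˡ (N X) (All.map (ev (++⁺ (++⁺ a (++⁻ˡ (P Y) u)) (++⁻ʳ (P Y) u))) (s f))
    ev-s₀ a u = trans (evs-subst _ ϑ₀ (++⁻ˡ (N X) (s f)))
      (trans (cong (λ ε → All.map (ev ε) (++⁻ˡ (N X) (s f)))
          (trans (map-++⁺ _ ϑ₂ (++⁻ʳ (P Y) (varsʳ (P X)))) (cong₂ ++⁺
            (trans (map-++⁺ _ (varsˡ (P X)) _) (cong₂ ++⁺ (ev-varsˡ a u)
              (trans (map-++⁻ˡ _ (P Y) (varsʳ (P X))) (cong (++⁻ˡ (P Y)) (ev-varsʳ a u)))))
            (trans (map-++⁻ʳ _ (P Y) (varsʳ (P X))) (cong (++⁻ʳ (P Y)) (ev-varsʳ a u))))))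
        (map-++⁻ˡ (ev _) (N X) (s f)))

  -- The implication is challenged at the pair of its argument x and the counter-witness d, and X is
  -- bounded by what the implication demands there.
  mor-eval : ∀ {Γ} {X Y : Int Γ} → Mor ((X ⊃ᴵ Y) ∧ᴵ X) Y
  mor-eval {Γ} {X} {Y} = record
    { t     = apply*ʷ (P X) (P Y) (++⁻ˡ (P X ⇛* P Y) (++⁻ˡ (P⊃ X Y) idSub)) (++⁻ʳ (P⊃ X Y) idSub)
    ; s     = ++⁺ (singles xd) (unions gxd (singles (defaults (N X))))
    ; valid = λ {Δ} {Ψ} η a d D →
        let ε  = ++⁺ a d
            fg = ++⁻ˡ (P⊃ X Y) a
            x  = ++⁻ʳ (P⊃ X Y) a
            D′ = ≡.subst (λ C → Ψ ⊢ ∀∈ ((X ⊃ᴵ Y) ∧ᴵ X) η a C) (map-++⁺ (ev ε) (singles xd) _) D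
            -- Each half of the hypothesis is extracted by exhibiting a member of the bound of the
            -- other half: `default` gives access to the implication, `single` to X.
            single  = ≡.subst (λ c → Members Ψ c (All.map (ev ε) (singles xd))) (ev-xd a d) (Members-singles ε xd)
            default = Members-unionsʳ ε gxd (singles (defaults (N X))) (Members-singles ε (defaults (N X)))
            E  = ≡.subst (Ψ ⊢_) (form-≡ (X ⊃ᴵ Y) refl refl (++⁻ˡ-++⁺ (++⁺ x d) _))
                   (∧-elimˡ (∀∈-elim ((X ⊃ᴵ Y) ∧ᴵ X) η a D′ (Members-++⁺ single default)))
        in ≡.subst (Ψ ⊢_)
          (form-≡ Y refl
            (trans (cong (appˡ X Y fg) (++⁻ˡ-++⁺ x d)) (sym (ev-t a)))
            (++⁻ʳ-++⁺ x d))
          (⊃-elim E (≡.subst (Ψ ⊢_)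
            (∀∈-≡ X refl (sym (++⁻ˡ-++⁺ x d)) (ev-gxd a d))
            (∀∈-⊑ X η x (⊑-unionsˡ ε gxd (singles (defaults (N X))))
              (∀∈-∧ʳ (X ⊃ᴵ Y) X η a single D′))))
    }
    where
    Ω = (P⊃ X Y ++ P X) ++ N Y

    vfg : Sub (P⊃ X Y) Ω
    vfg = ++⁻ˡ (P⊃ X Y) (varsˡ (P⊃ X Y ++ P X))

    xd : Sub (P X ++ N Y) Ω
    xd = ++⁺ (++⁻ʳ (P⊃ X Y) (varsˡ (P⊃ X Y ++ P X))) (varsʳ (P⊃ X Y ++ P X))

    gxd : WSets Ω (N X)
    gxd = map⁻ (apply*ʷ (P X ++ N Y) (map _✶ (N X)) (++⁻ʳ (P X ⇛* P Y) vfg) xd)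

    Members-unionsʳ : ∀ {Ξ Δ Ψ ρs} (ε : Tuple Δ Ξ) (Bs Cs : WSets Ξ ρs) {bs} →
                      Members Ψ bs (All.map (ev ε) Cs) → Members Ψ bs (All.map (ev ε) (unions Bs Cs))
    Members-unionsʳ ε []       []       []       = []
    Members-unionsʳ {ρs = ρ ∷ _} ε (B ∷ Bs) (C ∷ Cs) (m ∷ ms) =
      ∈-∪ʳ {ρ = ρ} m ∷ Members-unionsʳ ε Bs Cs ms

    ev-xd : ∀ {Δ} (a : Tuple Δ (P⊃ X Y ++ P X)) d → All.map (ev (++⁺ a d)) xd ≡ ++⁺ (++⁻ʳ (P⊃ X Y) a) d
    ev-xd a d = trans (map-++⁺ _ _ (varsʳ (P⊃ X Y ++ P X))) (cong₂ ++⁺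
      (trans (map-++⁻ʳ _ (P⊃ X Y) _) (cong (++⁻ʳ (P⊃ X Y)) (ev-varsˡ a d))) (ev-varsʳ a d))

    ev-t : ∀ {Δ} (a : Tuple Δ (P⊃ X Y ++ P X)) →
           All.map (ev a) (apply*ʷ (P X) (P Y) (++⁻ˡ (P X ⇛* P Y) (++⁻ˡ (P⊃ X Y) idSub)) (++⁻ʳ (P⊃ X Y) idSub))
           ≡ appˡ X Y (++⁻ˡ (P⊃ X Y) a) (++⁻ʳ (P⊃ X Y) a)
    ev-t a = trans (ev-apply*ʷ a (P X) (P Y) _ _) (cong₂ (_··_ {σs = P X} {P Y})
      (trans (map-++⁻ˡ (ev a) (P X ⇛* P Y) _) (cong (++⁻ˡ (P X ⇛* P Y))
        (trans (map-++⁻ˡ (ev a) (P⊃ X Y) idSub) (cong (++⁻ˡ (P⊃ X Y)) (ev-idSub a)))))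
      (trans (map-++⁻ʳ (ev a) (P⊃ X Y) idSub) (cong (++⁻ʳ (P⊃ X Y)) (ev-idSub a))))

    ev-gxd : ∀ {Δ} (a : Tuple Δ (P⊃ X Y ++ P X)) d →
             All.map (ev (++⁺ a d)) gxd ≡ appʳ X Y (++⁻ˡ (P⊃ X Y) a) (++⁺ (++⁻ʳ (P⊃ X Y) a) d)
    ev-gxd a d = trans (map-map⁻ {P = W _} {Q = WTerm _} (ev (++⁺ a d)) _) (cong map⁻
      (trans (ev-apply*ʷ (++⁺ a d) (P X ++ N Y) (map _✶ (N X)) _ xd)
        (cong₂ (_··_ {σs = P X ++ N Y} {map _✶ (N X)})
          (trans (map-++⁻ʳ _ (P X ⇛* P Y) vfg) (cong (++⁻ʳ (P X ⇛* P Y))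
            (trans (map-++⁻ˡ _ (P⊃ X Y) _) (cong (++⁻ˡ (P⊃ X Y)) (ev-varsˡ a d)))))
          (ev-xd a d))))

-- The interpretation of formulas and the soundness theorem

module Interpreted {L : SourceLanguage} {TL : TargetLanguage L} (T : TargetTheory TL)
         (I : BaseInterpretation TL) where
  open Target T public
  open BaseInterpretation I public
  open Interpretability T I public

  -- Mutual with `⟦_⟧`: packaging A needs its naturality, which for a compound formula comes from
  -- that of the connective applied to the packaged subformulas.
  ⟨⟩-natural : ∀ {Γ} (A : SFormula (L ᴵ) Γ) → Natural {Γ} {τ⁺ A} {τ⁻ A} ⟨ A ⟩
  ⟦_⟧ : ∀ {Γ} → SFormula (L ᴵ) Γ → Int Γ
  ⟦ A ⟧ = int (τ⁺ A) (τ⁻ A) ⟨ A ⟩ (⟨⟩-natural A)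

  -- `⟨_⟩` keeps its sets in a tuple over `map _✶`, the operations on `Int` keep them as `Sets`, so
  -- for ⊃ and ∃ the agreement is not definitional.
  ⊃-unfold : ∀ {Γ} (A B : SFormula (L ᴵ) Γ) {Δ} (η : Env Γ Δ) fg ad →
             ⟨ A ⊃ B ⟩ η fg ad ≡ form (⟦ A ⟧ ⊃ᴵ ⟦ B ⟧) η fg ad
  ex-unfold : ∀ {Γ σ} (A : SFormula (L ᴵ) (σ ∷ Γ)) {Δ} (η : Env Γ Δ) a b →
              ⟨ ex σ A ⟩ η a b ≡ form (exᴵ σ ⟦ A ⟧) η a b

  ⟨⟩-natural (rel (equality σ) (s ∷ t ∷ [])) θ η a b = cong₂ _≐_ (⌜⌝-subst θ s η) (⌜⌝-subst θ t η)
  ⟨⟩-natural (rel (other R) ts) θ η a b = trans (substF-substF θ _ (base R))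
    (cong (λ ϑ → substF ϑ (base R))
      (trans (map-++⁺ (subst θ) (map⁺ (All.map (λ t → ⌜ t ⌝ η) ts)) (++⁺ (map⁺ a) (map⁺ b)))
        (cong₂ ++⁺
          (trans (map-map⁺ {P = TTerm _} {Q = TTerm _} (subst θ) _)
            (cong map⁺ (trans (map-∘ ts) (map-cong ts (λ t → ⌜⌝-subst θ t η)))))
          (trans (map-++⁺ (subst θ) (map⁺ a) (map⁺ b))
            (cong₂ ++⁺ (map-map⁺ {P = TTerm _} {Q = TTerm _} (subst θ) a)
                       (map-map⁺ {P = TTerm _} {Q = TTerm _} (subst θ) b))))))
  ⟨⟩-natural falso       θ η a b = refl
  ⟨⟩-natural (A ∧ B)     = natural (⟦ A ⟧ ∧ᴵ ⟦ B ⟧)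
  ⟨⟩-natural (_∨_ ⦃ () ⦄ _ _)
  ⟨⟩-natural (A ⊃ B) θ η fg ad = trans (cong (substF θ) (⊃-unfold A B η fg ad))
    (trans (natural (⟦ A ⟧ ⊃ᴵ ⟦ B ⟧) θ η fg ad) (sym (⊃-unfold A B _ _ _)))
  ⟨⟩-natural (all σ A)   = natural (allᴵ σ ⟦ A ⟧)
  ⟨⟩-natural (ex σ A) θ η a b = trans (cong (substF θ) (ex-unfold A η a b))
    (trans (natural (exᴵ σ ⟦ A ⟧) θ η a b) (sym (ex-unfold A _ _ _)))

  ⊃-unfold A B η fg ad = cong₂ _⊃_ (cong₂ (all∈ {τ⁻ A}) (sym (map⁺-map⁻ {P = WTerm _} _)) refl) refl

  ex-unfold {σ = σ} A η a b = cong (ex (src σ)) (cong₂ (all∈ {τ⁻ A})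
    (trans (cong (All.map weaken) (sym (map⁺-map⁻ {P = WTerm _} b)))
           (map-map⁺ {P = WTerm _} {Q = WTerm _} weaken (map⁻ b)))
    (form-≡ ⟦ A ⟧ (cong₂ _∷_ refl (sym (map-∘ η))) (sym (map-∘ a)) refl))

  -- The interpretation of substitution instances

  ≅-sym : ∀ {Γ} {X Y : Int Γ} → X ≅ Y → Y ≅ X
  ≅-sym (mk h) = mk λ η a b → sym (h η a b)

  ≅-trans : ∀ {Γ} {X Y Z : Int Γ} → X ≅ Y → Y ≅ Z → X ≅ Z
  ≅-trans (mk h) (mk k) = mk λ η a b → trans (h η a b) (k η a b)

  ∧-cong : ∀ {Γ} {X X′ Y Y′ : Int Γ} → X ≅ X′ → Y ≅ Y′ → (X ∧ᴵ Y) ≅ (X′ ∧ᴵ Y′)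
  ∧-cong (mk h) (mk k) = mk λ η a b → cong₂ _∧_ (h η _ _) (k η _ _)

  ⊃-cong : ∀ {Γ} {X X′ Y Y′ : Int Γ} → X ≅ X′ → Y ≅ Y′ → (X ⊃ᴵ Y) ≅ (X′ ⊃ᴵ Y′)
  ⊃-cong (mk h) (mk k) = mk λ η a b → cong₂ _⊃_ (cong (all∈ _) (h _ _ _)) (k η _ _)

  all-cong : ∀ {Γ σ} {X Y : Int (σ ∷ Γ)} → X ≅ Y → allᴵ σ X ≅ allᴵ σ Y
  all-cong (mk h) = mk λ η a b → cong (all _) (h _ _ _)

  ex-cong : ∀ {Γ σ} {X Y : Int (σ ∷ Γ)} → X ≅ Y → exᴵ σ X ≅ exᴵ σ Y
  ex-cong (mk h) = mk λ η a b → cong (ex _) (cong (all∈ _) (h _ _ _))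

  sub-cong : ∀ {Γ Γ′} (ϑ : Sub Γ Γ′) {X Y : Int Γ} → X ≅ Y → subᴵ ϑ X ≅ subᴵ ϑ Y
  sub-cong ϑ (mk h) = mk λ η a b → h _ a b

  ⌜⌝-subst-source : ∀ {Γ Γ′ Δ σ} (ϑ : Sub {sourceSignature L} Γ Γ′) (t : STerm L Γ σ) (η : Env Γ′ Δ) →
                    ⌜ subst ϑ t ⌝ η ≡ ⌜ t ⌝ (All.map (λ u → ⌜ u ⌝ η) ϑ)
  ⌜⌝-subst-source ϑ (var x) η = sym (lookup-map ϑ x)
  ⌜⌝-subst-source ϑ (con c) η = refl
  ⌜⌝-subst-source ϑ (s · t) η = cong₂ _·_ (⌜⌝-subst-source ϑ s η) (⌜⌝-subst-source ϑ t η)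

  ⌜⌝-weaken : ∀ {Γ Δ σ τ} (v : TTerm Δ (src τ)) (η : Env Γ Δ) (t : STerm L Γ σ) → ⌜ weaken t ⌝ (v ∷ η) ≡ ⌜ t ⌝ η
  ⌜⌝-weaken v η (var x) = refl
  ⌜⌝-weaken v η (con c) = refl
  ⌜⌝-weaken v η (s · t) = cong₂ _·_ (⌜⌝-weaken v η s) (⌜⌝-weaken v η t)

  ⌜⌝-idSub : ∀ {Γ Δ} (η : Env Γ Δ) → All.map (λ u → ⌜ u ⌝ η) idSub ≡ η
  ⌜⌝-idSub η = lookup-ext λ i → trans (lookup-map idSub i) (cong (λ u → ⌜ u ⌝ η) (lookup-tabulate var i))

  ⌜⌝-lift : ∀ {Γ Γ′ Δ σ} (ϑ : Sub Γ Γ′) (η : Env Γ′ Δ) →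
            All.map (λ u → ⌜ u ⌝ (var (here refl) ∷ All.map (weaken {τ = src σ}) η)) (lift {τ = σ} ϑ)
              ≡ var (here refl) ∷ All.map weaken (All.map (λ u → ⌜ u ⌝ η) ϑ)
  ⌜⌝-lift ϑ η = cong₂ _∷_ refl (trans (map-∘ ϑ) (trans
    (map-cong ϑ λ u → trans (⌜⌝-weaken _ _ u) (sym (⌜⌝-rename there u η))) (sym (map-∘ ϑ))))

  ⟦⊃⟧ : ∀ {Γ} (A B : SFormula (L ᴵ) Γ) → ⟦ A ⊃ B ⟧ ≅ (⟦ A ⟧ ⊃ᴵ ⟦ B ⟧)
  ⟦⊃⟧ A B = mk (⊃-unfold A B)

  ⟦ex⟧ : ∀ {Γ σ} (A : SFormula (L ᴵ) (σ ∷ Γ)) → ⟦ ex σ A ⟧ ≅ exᴵ σ ⟦ A ⟧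
  ⟦ex⟧ A = mk (ex-unfold A)

  ⟦substF⟧ : ∀ {Γ Γ′} (ϑ : Sub Γ Γ′) (A : SFormula (L ᴵ) Γ) → ⟦ substF ϑ A ⟧ ≅ subᴵ ϑ ⟦ A ⟧
  ⟦substF⟧ ϑ (rel (equality σ) (s ∷ t ∷ [])) =
    mk λ η a b → cong₂ _≐_ (⌜⌝-subst-source ϑ s η) (⌜⌝-subst-source ϑ t η)
  ⟦substF⟧ ϑ (rel (other R) ts) = mk λ η a b →
    cong (λ us → substF (++⁺ (map⁺ us) (++⁺ (map⁺ a) (map⁺ b))) (base R))
      (trans (map-∘ ts) (map-cong ts (λ t → ⌜⌝-subst-source ϑ t η)))
  ⟦substF⟧ ϑ falso   = mk λ η a b → refl
  ⟦substF⟧ ϑ (A ∧ B) = ≅-trans {Y = subᴵ ϑ ⟦ A ⟧ ∧ᴵ subᴵ ϑ ⟦ B ⟧}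
    (∧-cong (⟦substF⟧ ϑ A) (⟦substF⟧ ϑ B)) (mk λ η a b → refl)
  ⟦substF⟧ ϑ (_∨_ ⦃ () ⦄ _ _)
  ⟦substF⟧ ϑ (A ⊃ B) = ≅-trans (⟦⊃⟧ (substF ϑ A) (substF ϑ B))
    (≅-trans {Y = subᴵ ϑ ⟦ A ⟧ ⊃ᴵ subᴵ ϑ ⟦ B ⟧} (⊃-cong (⟦substF⟧ ϑ A) (⟦substF⟧ ϑ B))
      (≅-trans {Y = subᴵ ϑ (⟦ A ⟧ ⊃ᴵ ⟦ B ⟧)} (mk λ η a b → cong₂ _⊃_ (∀∈-subᴵ ϑ ⟦ A ⟧ η _ _) refl)
        (sub-cong ϑ (≅-sym (⟦⊃⟧ A B)))))
  ⟦substF⟧ ϑ (all σ A) = ≅-trans {Y = allᴵ σ (subᴵ (lift ϑ) ⟦ A ⟧)} (all-cong (⟦substF⟧ (lift ϑ) A))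
    (mk λ η a b → cong (all (src σ)) (form-≡ ⟦ A ⟧ (⌜⌝-lift ϑ η) refl refl))
  ⟦substF⟧ ϑ (ex σ A) = ≅-trans (⟦ex⟧ (substF (lift ϑ) A))
    (≅-trans {Y = exᴵ σ (subᴵ (lift ϑ) ⟦ A ⟧)} (ex-cong (⟦substF⟧ (lift ϑ) A))
      (≅-trans {Y = subᴵ ϑ (exᴵ σ ⟦ A ⟧)} (mk λ η a b → cong (ex (src σ))
          (trans (∀∈-subᴵ (lift ϑ) ⟦ A ⟧ _ _ _) (∀∈-≡ ⟦ A ⟧ (⌜⌝-lift ϑ η) refl refl)))
        (sub-cong ϑ (≅-sym (⟦ex⟧ A)))))

  ⟦weakenF⟧ : ∀ {Γ σ} (A : SFormula (L ᴵ) Γ) → ⟦ weakenF {σ = σ} A ⟧ ≅ wkᴵ ⟦ A ⟧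
  ⟦weakenF⟧ A = ≅-trans {Y = subᴵ wkSub ⟦ A ⟧} (⟦substF⟧ wkSub A) (mk λ { (v ∷ η) a b → form-≡ ⟦ A ⟧
    (trans (map-∘ idSub) (trans (map-cong idSub (⌜⌝-weaken v η)) (⌜⌝-idSub η))) refl refl })

  ⟦[]⟧ : ∀ {Γ σ} (A : SFormula (L ᴵ) (σ ∷ Γ)) (u : STerm L Γ σ) → ⟦ A [ u ] ⟧ ≅ instᴵ u ⟦ A ⟧
  ⟦[]⟧ A u = ≅-trans {Y = subᴵ (u ∷ idSub) ⟦ A ⟧} (⟦substF⟧ (u ∷ idSub) A)
    (mk λ η a b → form-≡ ⟦ A ⟧ (cong₂ _∷_ refl (⌜⌝-idSub η)) refl refl)

  -- Intuitionistic rules as morphisms between formulas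

  infix 4 _⟶_
  -- Wrapped in a record so that A and B can be read off the type, from `⟦ A ⟧` and `⟦ B ⟧` they
  -- could not be inferred.
  record _⟶_ {Γ} (A B : SFormula (L ᴵ) Γ) : Set where
    constructor wrap
    field unwrap : Mor ⟦ A ⟧ ⟦ B ⟧
  open _⟶_ public

  infixr 9 _∙_
  _∙_ : ∀ {Γ} {A B C : SFormula (L ᴵ) Γ} → B ⟶ C → A ⟶ B → A ⟶ C
  wrap g ∙ wrap f = wrap (mor-∘ g f)

  ⟶-refl : ∀ {Γ} {A B : SFormula (L ᴵ) Γ} → A ≡ B → A ⟶ B
  ⟶-refl {A = A} refl = wrap (mor-id {nf = ⟨⟩-natural A} λ η a d D → D)

  π₁ : ∀ {Γ} {A B : SFormula (L ᴵ) Γ} → A ∧ B ⟶ A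
  π₁ {A = A} {B} = wrap (mor-∧ˡ {nf = ⟨⟩-natural A} ⟦ B ⟧ λ η a d b b′ D E → D)

  π₂ : ∀ {Γ} {A B : SFormula (L ᴵ) Γ} → A ∧ B ⟶ B
  π₂ {A = A} = wrap (mor-∧ʳ {X = ⟦ A ⟧})

  pair : ∀ {Γ} {A B C : SFormula (L ᴵ) Γ} → A ⟶ B → A ⟶ C → A ⟶ B ∧ C
  pair (wrap f) (wrap g) = wrap (mor-pair f g)

  curry : ∀ {Γ} {A B C : SFormula (L ᴵ) Γ} → A ∧ B ⟶ C → A ⟶ B ⊃ C
  curry {A = A} {B} {C} (wrap f) =
    wrap (mor-∘ (≅⇒mor (≅-sym (⟦⊃⟧ B C))) (mor-curry {X = ⟦ A ⟧} {⟦ B ⟧} {⟦ C ⟧} f))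

  uncurry : ∀ {Γ} {A B C : SFormula (L ᴵ) Γ} → A ⟶ B ⊃ C → A ⟶ B → A ⟶ C
  uncurry {A = A} {B} {C} (wrap f) (wrap g) = wrap (mor-∘ (mor-eval {X = ⟦ B ⟧} {⟦ C ⟧})
    (mor-pair (mor-∘ (≅⇒mor (⟦⊃⟧ B C)) f) g))

  absurd : ∀ {Γ} {A : SFormula (L ᴵ) Γ} → falso ⟶ A
  absurd {A = A} = wrap (mor-absurd {Y = ⟦ A ⟧})

  ∀-intro : ∀ {Γ σ} {A : SFormula (L ᴵ) Γ} {B : SFormula (L ᴵ) (σ ∷ Γ)} → weakenF A ⟶ B → A ⟶ all σ B
  ∀-intro {A = A} (wrap f) = wrap (mor-all (mor-∘ f (≅⇒mor (≅-sym (⟦weakenF⟧ A)))))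

  ∀-elim : ∀ {Γ σ} {A : SFormula (L ᴵ) (σ ∷ Γ)} u → all σ A ⟶ A [ u ]
  ∀-elim {A = A} u = wrap (mor-∘ (≅⇒mor (≅-sym (⟦[]⟧ A u))) (mor-instantiate {X = ⟦ A ⟧} u))

  ∃-intro : ∀ {Γ σ} {A : SFormula (L ᴵ) (σ ∷ Γ)} u → A [ u ] ⟶ ex σ A
  ∃-intro {A = A} u = wrap (mor-∘ (≅⇒mor (≅-sym (⟦ex⟧ A)))
    (mor-∘ (mor-witness {X = ⟦ A ⟧} u) (≅⇒mor (⟦[]⟧ A u))))

  ∃-elim : ∀ {Γ σ} {A : SFormula (L ᴵ) (σ ∷ Γ)} {C} → A ⟶ weakenF C → ex σ A ⟶ C
  ∃-elim {A = A} {C} (wrap f) = wrap (mor-∘ (mor-ex (mor-∘ (≅⇒mor (⟦weakenF⟧ C)) f)) (≅⇒mor (⟦ex⟧ A)))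

  substitute : ∀ {Γ Γ′} {A B : SFormula (L ᴵ) Γ} (ϑ : Sub Γ Γ′) → A ⟶ B → substF ϑ A ⟶ substF ϑ B
  substitute {A = A} {B} ϑ (wrap f) =
    wrap (mor-∘ (≅⇒mor (≅-sym (⟦substF⟧ ϑ B))) (mor-∘ (mor-sub ϑ f) (≅⇒mor (⟦substF⟧ ϑ A))))

  -- Relativization and interpretable closed formulas

  relativize-substF : ∀ {Γ Γ′} (ϑ : Sub Γ Γ′) (A : SFormula L Γ) →
                      relativize (substF ϑ A) ≡ substF ϑ (relativize A)
  relativize-substF ϑ (rel (equality σ) ts) = refl
  relativize-substF ϑ (rel (other R) ts)    = refl
  relativize-substF ϑ falso     = refl
  relativize-substF ϑ (A ∧ B)   = cong₂ _∧_ (relativize-substF ϑ A) (relativize-substF ϑ B)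
  relativize-substF ϑ (_∨_ ⦃ () ⦄ _ _)
  relativize-substF ϑ (A ⊃ B)   = cong₂ _⊃_ (relativize-substF ϑ A) (relativize-substF ϑ B)
  relativize-substF ϑ (all σ A) = cong (λ B → all σ (_ ⊃ B)) (relativize-substF (lift ϑ) A)
  relativize-substF ϑ (ex σ A)  = cong (λ B → ex σ (_ ∧ B)) (relativize-substF (lift ϑ) A)

  𝓗 : ∀ {Γ} → List (SFormula L Γ) → SFormula (L ᴵ) Γ
  𝓗 Φ = ⋀ (map relativize Φ)

  𝓘vars : ∀ Γ → SFormula (L ᴵ) Γ
  𝓘vars Γ = ⋀ (𝓘* {L} idSub)

  𝓗-weaken : ∀ {Γ σ} (Φ : List (SFormula L Γ)) → weakenF {σ = σ} (𝓗 Φ) ≡ 𝓗 (map weakenF Φ)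
  𝓗-weaken []      = refl
  𝓗-weaken (A ∷ Φ) = cong₂ _∧_ (sym (relativize-substF _ A)) (𝓗-weaken Φ)

  𝓘*-substF : ∀ {Γ Γ′ ts} (ϑ : Sub Γ Γ′) (us : All (STerm L Γ) ts) →
              substF ϑ (⋀ (𝓘* {L} us)) ≡ ⋀ (𝓘* {L} (All.map (subst ϑ) us))
  𝓘*-substF ϑ []       = refl
  𝓘*-substF ϑ (u ∷ us) = cong (_ ∧_) (𝓘*-substF ϑ us)

  𝓘vars-weaken : ∀ {Γ σ} → 𝓘[_] {L} (var (here refl)) ∧ weakenF {σ = σ} (𝓘vars Γ) ≡ 𝓘vars (σ ∷ Γ)
  𝓘vars-weaken = cong (_ ∧_) (trans (𝓘*-substF wkSub idSub)
    (cong (λ us → ⋀ (𝓘* {L} us)) (trans (map-subst-idSub wkSub) (map-tabulate weaken var))))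

  const : ∀ {Γ} {A B : SFormula (L ᴵ) Γ} (c : Tuple [] (τ⁺ B)) →
          (∀ {Δ} {Ψ : List (TFormula Δ)} (η : Env Γ Δ) d → Ψ ⊢ ⟨ B ⟩ η (All.map fromClosed c) d) → A ⟶ B
  const {B = B} c h = wrap (mor-const {Y = ⟦ B ⟧} c h)

  interpretable : ∀ {Γ A} {X : SFormula (L ᴵ) Γ} → UInterpretable {[]} A → X ⟶ substF [] A
  interpretable {A = A} {X} (c , D) = wrap (mor-∘ (≅⇒mor (≅-sym (⟦substF⟧ [] A)))
    (mor-const {X = ⟦ X ⟧} {Y = subᴵ [] ⟦ A ⟧} c λ {_} {Ψ} η d → ≡.subst (Ψ ⊢_)
      (trans (⟨⟩-natural A (d ◂ []) [] _ _) (form-≡ ⟦ A ⟧ refl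
        (trans (map-∘ c) (map-cong c (subst-fromClosed (d ◂ [])))) (map-◂-witVars* d [])))
      (all*-elim (τ⁻ A) [] (mono [] D) d)))

  -- A closed inhabitant of each source type, to be put for a variable introduced by the rule
  -- `fresh`.
  fresh-type : ∀ σ → STerm L [] σ
  fresh-type (gr X)  = con (e X)
  fresh-type (σ ⇒ τ) = con (Π τ σ) · fresh-type τ

  -- Soundness by induction on derivations

  module _ {S : SourceTheory L} (sound : Sound S) where
    open Sound sound

    ⟶-application : ∀ {Γ σ τ} {X : SFormula (L ᴵ) Γ} (f : STerm L Γ (σ ⇒ τ)) (u : STerm L Γ σ) →
                    X ⟶ 𝓘[_] {L} u ∧ 𝓘[_] {L} f ⊃ 𝓘[_] {L} (f · u)
    ⟶-application {σ = σ} {τ} f u =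
      ⟶-refl (cong (λ v → 𝓘[_] {L} v ∧ 𝓘[_] {L} f ⊃ 𝓘[_] {L} (f · v))
               (trans (subst-weaken f idSub u) (subst-idSub u)))
      ∙ ∀-elim f ∙ ∀-elim {A = substF (lift []) (all (σ ⇒ τ) B)} u
      ∙ interpretable {A = all σ (all (σ ⇒ τ) B)} (application σ τ)
      where
      B : SFormula (L ᴵ) (σ ⇒ τ ∷ σ ∷ [])
      B = 𝓘[_] {L} (var (there (here refl))) ∧ 𝓘[_] {L} (var (here refl))
          ⊃ 𝓘[_] {L} (var (here refl) · var (there (here refl)))

    𝓘-lookup : ∀ {Γ σ ts} (us : All (STerm L Γ) ts) (i : σ ∈ ts) → ⋀ (𝓘* {L} us) ⟶ 𝓘[_] {L} (All.lookup us i)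
    𝓘-lookup (u ∷ us) (here refl) = π₁
    𝓘-lookup (u ∷ us) (there i)   = 𝓘-lookup us i ∙ π₂

    𝓘-term : ∀ {Γ σ} (u : STerm L Γ σ) → 𝓘vars Γ ⟶ 𝓘[_] {L} u
    𝓘-term (var x) = ⟶-refl (cong (𝓘[_] {L}) (lookup-tabulate var x)) ∙ 𝓘-lookup idSub x
    𝓘-term (con c) = interpretable {A = 𝓘[_] {L} (con c)} (constants c)
    𝓘-term (f · u) = uncurry (⟶-application f u) (pair (𝓘-term u) (𝓘-term f))

    𝓘-terms : ∀ {Γ ts} (us : All (STerm L Γ) ts) → 𝓘vars Γ ⟶ ⋀ (𝓘* {L} us)
    -- The empty conjunction is `falso ⊃ falso`, hence the curried projection to `falso`.
    𝓘-terms []       = curry π₂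
    𝓘-terms (u ∷ us) = pair (𝓘-term u) (𝓘-terms us)

    -- The head of the context is the innermost quantifier of the closure, so the tail of ϑ is
    -- instantiated before its head.
    closure-elim : ∀ {Γ Γ′} {X : SFormula (L ᴵ) Γ′} {A : SFormula (L ᴵ) Γ} (ϑ : Sub Γ Γ′) →
                   X ⟶ substF [] (closure A) → X ⟶ substF ϑ A
    closure-elim []      f = f
    closure-elim {A = A} (u ∷ ϑ) f =
      ⟶-refl (substF-instantiate ϑ A u) ∙ ∀-elim u ∙ closure-elim ϑ f

    -- An equation carries no witnesses and is read as equality in T, so C keeps its witnesses when
    -- x is replaced by y.
    replace-mor : ∀ {Γ σ} (C : SFormula (L ᴵ) (σ ∷ Γ)) (x y : STerm L Γ σ) →
                  C [ x ] ∧ rel (equality σ) (x ∷ y ∷ []) ⟶ C [ y ]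
    replace-mor {σ = σ} C x y = wrap (mor-∘ (≅⇒mor (≅-sym (⟦[]⟧ C y)))
      (mor-∘ (mor-∧ˡ {nf = natural (instᴵ x ⟦ C ⟧)} {ng = natural (instᴵ y ⟦ C ⟧)} ⟦ x≡y ⟧
          (λ η a d _ _ D E → replace (⟨ C ⟩ (var (here refl) ∷ All.map weaken η) (All.map weaken a) (All.map weaken d))
            (at η a d (⌜ x ⌝ η)) (at η a d (⌜ y ⌝ η)) E D))
        (mor-pair {Y = instᴵ x ⟦ C ⟧} {Z = ⟦ x≡y ⟧}
          (mor-∘ (≅⇒mor (⟦[]⟧ C x)) (unwrap (π₁ {A = C [ x ]} {x≡y})))
          (unwrap (π₂ {A = C [ x ]} {x≡y})))))
      where
      x≡y = rel (equality σ) (x ∷ y ∷ [])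
      at : ∀ {Δ} (η : Env _ Δ) a d v →
           ⟨ C ⟩ (var (here refl) ∷ All.map weaken η) (All.map weaken a) (All.map weaken d) [ v ] ≡ ⟨ C ⟩ (v ∷ η) a d
      at η a d v = trans (⟨⟩-natural C (v ∷ idSub) _ _ _)
        (form-≡ ⟦ C ⟧ (cong₂ _∷_ refl (unweaken η)) (unweaken a) (unweaken d))

    ⟶-axiom : ∀ {Γ Γ′} {A : SFormula L Γ} → SourceAxiom L (SourceTheory.NonLogicalAxiom S) A →
              (ϑ : Sub Γ Γ′) → 𝓘vars Γ′ ⟶ substF ϑ (relativize A)
    ⟶-axiom (reflexivity σ) ϑ = ∀-intro (curry (const [] λ η d → thm (≐-refl _)))
    -- The instance is proved in its own context from the empty conjunction and only then
    -- substituted.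
    ⟶-axiom {A = A} (replacement σ {B} _) ϑ = substitute {A = falso ⊃ falso} {relativize A} ϑ
      (∀-intro (curry (∀-intro (curry (curry
        (⟶-refl (sym (relativize-substF (y ∷ idSub) B)) ∙ replace-mor (relativize B) x y
         ∙ ⟶-refl (cong (_∧ _) (relativize-substF (x ∷ idSub) B)) ∙ π₂))))))
      ∙ curry π₂
      where
      x = var (there (here refl))
      y = var (here refl)
    ⟶-axiom {A = A} (Π-equation σ τ) ϑ = substitute {A = falso ⊃ falso} {relativize A} ϑ
      (const [] λ η d → thm (Π-eq σ τ _ _)) ∙ curry π₂
    ⟶-axiom {A = A} (Σ-equation ρ σ τ) ϑ = substitute {A = falso ⊃ falso} {relativize A} ϑ
      (const [] λ η d → thm (Σ-eq ρ σ τ _ _ _)) ∙ curry π₂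
    ⟶-axiom {Γ} {A = A} (nonLogical a) ϑ =
      -- A non-logical axiom is interpretable relative to 𝓘 of its variables, so 𝓘 must be provided
      -- for the terms of ϑ put in their place.
      uncurry (closure-elim {A = 𝓘vars Γ ⊃ relativize A} ϑ (interpretable {A = closure (𝓘vars Γ ⊃ relativize A)} (axioms a)))
              (⟶-refl (trans (cong (λ us → ⋀ (𝓘* {L} us)) (sym (map-subst-idSub ϑ))) (sym (𝓘*-substF ϑ idSub)))
               ∙ 𝓘-terms ϑ)

    𝓗-lookup : ∀ {Γ Φ} {A : SFormula L Γ} → A ∈ Φ → 𝓗 Φ ⟶ relativize A
    𝓗-lookup (here refl) = π₁
    𝓗-lookup (there i)   = 𝓗-lookup i ∙ π₂

    𝓗-⊆ : ∀ {Γ Φ Ψ} → Φ ⊆ Ψ → 𝓗 {Γ} Ψ ⟶ 𝓗 Φ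
    𝓗-⊆ {Φ = []}    s = curry π₂
    𝓗-⊆ {Φ = A ∷ Φ} s = pair (𝓗-lookup (s (here refl))) (𝓗-⊆ λ i → s (there i))

    𝓘-bound : ∀ {Γ σ} → SFormula (L ᴵ) (σ ∷ Γ)
    𝓘-bound = 𝓘[_] {L} (var (here refl))

    -- Entering a binder adds a conjunct to `𝓘vars`, namely 𝓘 of the new variable; this is what the
    -- relativization of the quantifiers supplies.
    weaken-premise : ∀ {Γ σ} (Φ : List (SFormula L Γ)) {X B : SFormula (L ᴵ) (σ ∷ Γ)} →
                     X ⟶ weakenF (𝓗 Φ ∧ 𝓘vars Γ) → X ⟶ 𝓘-bound → X ⟶ 𝓗 (map weakenF Φ) ∧ 𝓘vars (σ ∷ Γ)
    weaken-premise Φ f g = pair (⟶-refl (𝓗-weaken Φ) ∙ π₁ ∙ f) (⟶-refl 𝓘vars-weaken ∙ pair g (π₂ ∙ f))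

    soundness : ∀ {Γ Φ} {A : SFormula L Γ} → Φ ⊢[ SourceTheory.theory S ] A → 𝓗 Φ ∧ 𝓘vars Γ ⟶ relativize A
    soundness (hyp i) = 𝓗-lookup i ∙ π₁
    soundness (axiom {A = A} a ϑ) = ⟶-refl (sym (relativize-substF ϑ A)) ∙ ⟶-axiom a ϑ ∙ π₂
    soundness (structural s D) = soundness D ∙ pair (𝓗-⊆ s ∙ π₁) π₂
    soundness (cut D E) = soundness E ∙ pair (pair (soundness D) π₁) π₂
    soundness {Γ} {Φ} {A} (fresh σ D) =
      ⟶-refl (trans (cong (substF _) (relativize-substF _ A)) (instantiated (relativize A)))
      -- The premise needs 𝓘 of a variable that the end sequent does not know. Replacing the
      -- variable by the closed term `c` turns this demand into `𝓘-term c`.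
      ∙ substitute (c ∷ idSub) (soundness D ∙ weaken-premise Φ {B = falso} π₂ π₁)
      ∙ ⟶-refl (cong (𝓘[_] {L} c ∧_) (sym (instantiated (𝓗 Φ ∧ 𝓘vars Γ))))
      ∙ pair (𝓘-term c ∙ π₂) (⟶-refl refl)
      where
      c : STerm L Γ σ
      c = fromClosed (fresh-type σ)
      instantiated : ∀ B → substF (c ∷ idSub) (weakenF B) ≡ B
      instantiated B = trans (substF-weakenF c idSub B) (substF-idSub B)
    soundness falsoL = absurd ∙ π₁ ∙ π₁
    soundness (∧L D) = soundness D ∙ pair (pair (π₁ ∙ π₁ ∙ π₁) (pair (π₂ ∙ π₁ ∙ π₁) (π₂ ∙ π₁))) π₂
    soundness (∧R D E) = pair (soundness D) (soundness E)
    soundness (∨L ⦃ () ⦄ _ _)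
    soundness (∨R₁ ⦃ () ⦄ _)
    soundness (∨R₂ ⦃ () ⦄ _)
    soundness (⊃L D E) = soundness E ∙ pair
      (pair (uncurry (π₁ ∙ π₁) (soundness D ∙ pair (π₂ ∙ π₁) π₂)) (π₂ ∙ π₁)) π₂
    soundness (⊃R D) = curry (soundness D ∙ pair (pair π₂ (π₁ ∙ π₁)) (π₂ ∙ π₁))
    soundness (allL {A = A} u D) = soundness D ∙ pair
      (pair (⟶-refl (sym (relativize-substF _ A)) ∙ uncurry (∀-elim u ∙ π₁ ∙ π₁) (𝓘-term u ∙ π₂)) (π₂ ∙ π₁)) π₂
    soundness (allR {Φ = Φ} D) = ∀-intro (curry (soundness D ∙ weaken-premise Φ {B = falso} π₁ π₂))
    soundness (exL {Φ = Φ} {A = A} {C} D) = uncurry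
      -- `∃-elim` admits no side formulas, so Φ and 𝓘 of the variables are moved into an implication
      -- and given back by the outer `uncurry`.
      (∃-elim (curry (⟶-refl (relativize-substF _ C) ∙ soundness D ∙ pair
        (pair (π₂ ∙ π₁) (π₁ ∙ weaken-premise Φ {B = falso} π₂ (π₁ ∙ π₁)))
        (π₂ ∙ weaken-premise Φ {B = falso} π₂ (π₁ ∙ π₁)))) ∙ π₁ ∙ π₁)
      (pair (π₂ ∙ π₁) π₂)
    soundness (exR {A = A} u D) = ∃-intro u ∙ pair (𝓘-term u ∙ π₂) (⟶-refl (relativize-substF _ A) ∙ soundness D)
    soundness (reductio () _)

  -- Closed witnesses and the final statement

  fromClosed-ev : ∀ {Δ ρ} (u : W [] ρ) → fromClosed {Γ = Δ} (ev [] u) ≡ ev [] u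
  fromClosed-ev (con c) = rename-rename (λ ()) (λ ()) c
  fromClosed-ev (s · t) = cong₂ _·_ (fromClosed-ev s) (fromClosed-ev t)

  -- The terms of a morphism have σs as their context, whereas `Λ` binds a context in reversed
  -- order; `vars*` translates between the two.
  abstraction : ∀ σs {ρs} → Sub {witSignature} ρs σs → Tuple [] (σs ⇛* ρs)
  abstraction σs ts = All.map (ev []) (Λ* σs (All.map (subst (vars* σs)) ts))

  abstraction-β : ∀ {Δ Ψ} σs {ρs} (ts : Sub ρs σs) (us : Tuple Δ σs) →
                  Equal Ψ wit (_··_ {σs = σs} {ρs} (All.map fromClosed (abstraction σs ts)) us) (All.map (ev us) ts)
  abstraction-β {Ψ = Ψ} σs {ρs} ts us = ≡.subst₂ (λ f → Equal Ψ wit (_··_ {σs = σs} {ρs} f us))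
    (sym (trans (map-∘ (Λ* σs _)) (map-cong (Λ* σs _) fromClosed-ev)))
    (trans (evs-subst _ (vars* σs) ts) (cong (λ ε → All.map (ev ε) ts) (ev-revAll-vars* us [])))
    (Λ*-·· σs [] (All.map (subst (vars* σs)) ts) us)

  closure-intro : ∀ {Δ} {A : TFormula Δ} → [] ⊢ A → [] ⊢ closure A
  closure-intro {[]}    D = D
  closure-intro {τ ∷ Δ} D = closure-intro (allR D)

  module _ {Γ : List (SType L)} (Φ : List (SFormula L Γ)) (A : SFormula L Γ)
           (f : 𝓗 Φ ∧ 𝓘vars Γ ⟶ relativize A) where
    private
      Xᵠ = ⟦ Φᴵ Φ A ⟧
      Xⁱ = ⟦ 𝓘x Φ A ⟧
      α′ = α Φ A
      γ′ = γ Φ A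
      δ′ = δ Φ A
      M  = unwrap f

    -- The bounds of the morphism see a and c grouped as one tuple of witnesses, followed by d; the
    -- theorem lists a, c, d with the other bracketing.
    reassociate : Sub {witSignature} ((α′ ++ γ′) ++ δ′) (α′ ++ γ′ ++ δ′)
    reassociate = ++⁺ (++⁺ (varsˡ α′) (++⁻ˡ γ′ (varsʳ α′))) (++⁻ʳ γ′ (varsʳ α′))

    sets : WSets (α′ ++ γ′ ++ δ′) (N Xᵠ ++ N Xⁱ)
    sets = All.map (subst reassociate) (s M)

    q′ : Tuple [] ((α′ ++ γ′ ++ δ′) ⇛* map _✶ (N Xⁱ))
    q′ = abstraction (α′ ++ γ′ ++ δ′) (map⁺ (++⁻ʳ (N Xᵠ) sets))

    s′ : Tuple [] ((α′ ++ γ′ ++ δ′) ⇛* map _✶ (N Xᵠ))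
    s′ = abstraction (α′ ++ γ′ ++ δ′) (map⁺ (++⁻ˡ (N Xᵠ) sets))

    t′ : Tuple [] ((α′ ++ γ′) ⇛* τ⁺ (Aᴵ Φ A))
    t′ = abstraction (α′ ++ γ′) (t M)

    ev-sets : ∀ {Δ} (u : Tuple Δ (α′ ++ γ′ ++ δ′)) → All.map (ev u) sets ≡
              All.map (ev (++⁺ (++⁺ (++⁻ˡ α′ u) (++⁻ˡ γ′ (++⁻ʳ α′ u))) (++⁻ʳ γ′ (++⁻ʳ α′ u)))) (s M)
    ev-sets u = trans (evs-subst u reassociate (s M)) (cong (λ ε → All.map (ev ε) (s M))
      (trans (map-++⁺ (ev u) (++⁺ (varsˡ α′) (++⁻ˡ γ′ (varsʳ α′))) _) (cong₂ ++⁺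
        (trans (map-++⁺ (ev u) (varsˡ α′) _) (cong₂ ++⁺
          (trans (map-++⁻ˡ (ev u) α′ idSub) (cong (++⁻ˡ α′) (ev-idSub u)))
          (trans (map-++⁻ˡ (ev u) γ′ _) (cong (++⁻ˡ γ′) rest))))
        (trans (map-++⁻ʳ (ev u) γ′ _) (cong (++⁻ʳ γ′) rest)))))
      where
      rest : All.map (ev u) (varsʳ α′) ≡ ++⁻ʳ α′ u
      rest = trans (map-++⁻ʳ (ev u) α′ idSub) (cong (++⁻ʳ α′) (ev-idSub u))

    -- The closed tuple applied to the variables equals the open sets only provably, by β; an
    -- inclusion is all that `∀∈-⊑` asks for.
    bounded : ∀ {Δ Ψ ρs} (u : Tuple Δ (α′ ++ γ′ ++ δ′)) (C : WSets (α′ ++ γ′ ++ δ′) ρs) →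
              Ψ ⊢ All.map (ev u) C ⊑
                map⁻ (_··_ {σs = α′ ++ γ′ ++ δ′} {map _✶ ρs} (All.map fromClosed (abstraction (α′ ++ γ′ ++ δ′) (map⁺ C))) u)
    bounded {Ψ = Ψ} {ρs} u C = ⊑-Equal (≡.subst
      (λ B → Equal Ψ (λ ρ → wit (ρ ✶)) B (map⁻ (_··_ {σs = α′ ++ γ′ ++ δ′} {map _✶ ρs}
        (All.map fromClosed (abstraction (α′ ++ γ′ ++ δ′) (map⁺ C))) u)))
      (trans (cong map⁻ (map-map⁺ {P = W _} {Q = WTerm _} (ev u) C)) (map⁻-map⁺ {P = WTerm _} _))
      (Equal-map⁻ (Equal-sym (abstraction-β (α′ ++ γ′ ++ δ′) (map⁺ C) u))))

    assemble : ⊢ᵗ soundnessFormula Φ A q′ s′ t′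
    assemble = closure-intro (⊃R (form-Equal ⟦ Aᴵ Φ A ⟧ x d
      (Equal-sym (abstraction-β (α′ ++ γ′) (t M) (++⁺ a c)))
      (valid M x (++⁺ a c) d (∀∈-∧ Xᵠ Xⁱ x a c _
        -- In the premise of the morphism Φ precedes 𝓘(x), in `soundnessFormula` it follows; hence
        -- the crossed projections.
        (hypothesis Xᵠ a
          (trans (map-++⁻ˡ (ev acd) (N Xᵠ) sets) (cong (++⁻ˡ (N Xᵠ)) (ev-sets acd)))
          (bounded acd (++⁻ˡ (N Xᵠ) sets)) (∧-elimʳ (hyp (here refl))))
        (hypothesis Xⁱ c
          (trans (map-++⁻ʳ (ev acd) (N Xᵠ) sets) (cong (++⁻ʳ (N Xᵠ)) (ev-sets acd)))
          (bounded acd (++⁻ʳ (N Xᵠ) sets)) (∧-elimˡ (hyp (here refl))))))))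
      where
      acd : Tuple (map src Γ ++ (map wit (α′ ++ γ′ ++ δ′) ʳ++ [])) (α′ ++ γ′ ++ δ′)
      acd = All.map (rename (∈-++⁺ʳ (map src Γ))) (witVars* (α′ ++ γ′ ++ δ′))
      a = ++⁻ˡ α′ acd
      c = ++⁻ˡ γ′ (++⁻ʳ α′ acd)
      d = ++⁻ʳ γ′ (++⁻ʳ α′ acd)
      x : Env Γ (map src Γ ++ (map wit (α′ ++ γ′ ++ δ′) ʳ++ []))
      x = All.map (rename ∈-++⁺ˡ) idEnv

      hypothesis : ∀ (X : Int Γ) {Δ Ψ} {η : Env Γ Δ} a {B C E} → B ≡ C → Ψ ⊢ B ⊑ map⁻ E →
                   Ψ ⊢ all∈ {N X} E (form X (All.map (rename (there* (map wit (N X)))) η)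
                         (All.map (rename (there* (map wit (N X)))) a) (witVars* (N X))) →
                   Ψ ⊢ ∀∈ X η a C
      hypothesis X {Ψ = Ψ} {η} a {E = E} refl sub D =
        ∀∈-⊑ X η a sub (≡.subst (λ C → Ψ ⊢ all∈ {N X} C _) (sym (map⁺-map⁻ {P = WTerm _} E)) D)

theorem3p20 :
    (L : SourceLanguage) (S : SourceTheory L)
    (TL : TargetLanguage L) (T : TargetTheory TL)
    (I : BaseInterpretation TL) →
    let open TargetLanguage TL
        open TargetTheory T
        open BaseInterpretation I
        open Interpretability T I
    in
    Sound S →
    (Γ : List (SourceLanguage.SType L))
    (Φ : List (SFormula L Γ)) (A : SFormula L Γ) →
    Φ ⊢[ SourceTheory.theory S ] A →
    Σ[ q ∈ Tuple [] ((α Φ A ++ γ Φ A ++ δ Φ A) ⇛* map _✶ (τ⁻ (𝓘x Φ A))) ]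
    Σ[ s ∈ Tuple [] ((α Φ A ++ γ Φ A ++ δ Φ A) ⇛* map _✶ (τ⁻ (Φᴵ Φ A))) ]
    Σ[ t ∈ Tuple [] ((α Φ A ++ γ Φ A) ⇛* τ⁺ (Aᴵ Φ A)) ]
    ⊢ᵗ soundnessFormula Φ A q s t
theorem3p20 L S TL T I sound Γ Φ A D = q′ Φ A f , s′ Φ A f , t′ Φ A f , assemble Φ A f
  where
  open Interpreted T I
  f = soundness sound D
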